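{- Let $\mathfrak g=\mathfrak g(A,\Psi)$ be a BKM superalgebra with quasi Dynkin diagram $(G,\Psi)$ (vertex set $I$), and let $\mathcal{LS}(G,\Psi)$ be the associated free partially commutative Lie superalgebra. Fix a nonzero $\mathbf k\in\mathbb Z_+[I]$ such that $k_i\le 1$ for $i\in I^{re}\sqcup\Psi_0$. Then: (1) The root space $\mathfrak g_{\eta(\mathbf k)}$ can be identified with the grade space $\mathcal{LS}_{\mathbf k}(G,\Psi)$: the natural grade preserving surjective homomorphism $\mathcal{LS}(G,\Psi)\to\mathfrak n_+$, $e_i\mapsto e_i$, restricts to a linear isomorphism $\mathcal{LS}_{\mathbf k}(G,\Psi)\cong\mathfrak g_{\eta(\mathbf k)}$. In particular $\operatorname{mult}\eta(\mathbf k)=\dim\mathcal{LS}_{\mathbf k}(G,\Psi)$. (2) The root space $\mathfrak g_{\eta(\mathbf k)}$ is independent of the Serre relations, i.e. the ideal of $\mathcal{LS}(G,\Psi)$ generated by the Serre elements has zero component in degree $\mathbf k$.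
   Context: BKM superalgebras (over $\mathbb C$). Let $I=\{1,\dots,n\}$ or $I=\mathbb N$, and $\Psi\subseteq I$. A BKM supermatrix is a matrix $A=(a_{ij})_{i,j\in I}$ together with $\Psi$ such that: $a_{ii}=2$ or $a_{ii}\le 0$; $a_{ij}\le 0$ if $i\ne j$; $a_{ij}=0\iff a_{ji}=0$; $a_{ij}\in\mathbb Z$ if $a_{ii}=2$; $a_{ij}\in 2\mathbb Z$ if $a_{ii}=2$ and $i\in\Psi$; $A$ is symmetrizable ($DA$ symmetric for some diagonal $D$ with positive entries). Put $I^{re}=\{i:a_{ii}=2\}$, $\Psi^{re}=\Psi\cap I^{re}$, $\Psi_0=\{i\in\Psi:a_{ii}=0\}$. The BKM superalgebra $\mathfrak g(A,\Psi)$ is the Lie superalgebra generated by $e_i,f_i,h_i$ ($i\in I$), with $h_i$ even, $e_i,f_i$ odd if $i\in\Psi$ and even otherwise, and relations: $[h_i,h_j]=0$; $[h_i,e_j]=a_{ij}e_j$, $[h_i,f_j]=-a_{ij}f_j$; $[e_i,f_j]=\delta_{ij}h_i$; the Serre relations: $(\mathrm{ad}\,e_i)^{1-a_{ij}}e_j=0=(\mathrm{ad}\,f_i)^{1-a_{ij}}f_j$ if $i\in I^{re}$, $i\neq j$; $(\mathrm{ad}\,e_i)^{1-a_{ij}/2}e_j=0=(\mathrm{ad}\,f_i)^{1-a_{ij}/2}f_j$ if $i\in\Psi^{re}$, $i\ne j$; $(\mathrm{ad}\,e_i)^{1-a_{ii}/2}e_i=0=(\mathrm{ad}\,f_i)^{1-a_{ii}/2}f_i$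 if $i\in\Psi_0$; and the commutation relations $[e_i,e_j]=0=[f_i,f_j]$ if $a_{ij}=0$. The Serre elements are the left-hand sides $(\mathrm{ad}\,e_i)^{1-a_{ij}}e_j$, $(\mathrm{ad}\,e_i)^{1-a_{ij}/2}e_j$, $(\mathrm{ad}\,e_i)^{1-a_{ii}/2}e_i$ under the stated conditions. $\mathfrak g$ is graded by $Q=\bigoplus_{i\in I}\mathbb Z\alpha_i$ with $\deg e_i=\alpha_i$, $\deg f_i=-\alpha_i$, $\deg h_i=0$; $\mathfrak g_\alpha$ is the graded component (root space), $\operatorname{mult}(\alpha)=\dim\mathfrak g_\alpha$, and $\mathfrak n_+=\bigoplus_{\alpha\in Q_+\setminus\{0\}}\mathfrak g_\alpha$ is the subalgebra generated by the $e_i$. One has $\mathfrak g=\mathfrak n_-\oplus\mathfrak h\oplus\mathfrak n_+$. $\mathbb Z_+[I]$ is the set of finitely supported tuples $\mathbf k=(k_i:i\in I)$ of non-negative integers; $\eta(\mathbf k)=\sum k_i\alpha_i$. The quasi Dynkin diagram $(G,\Psi)$ is the simple graph $G$ with vertex set $I$, where $i\ne j$ are adjacent iff $a_{ij}\ne0$, together with the set $\Psi$ of odd vertices. $\mathcal{LS}(G,\Psi)$ is the quotient of the free Lie superalgebra on generators $e_i$ ($i\in I$; odd iff $i\in\Psi$) by the ideal generated by $[e_i,e_j]$ for all non-adjacent $i\neq j$; it is graded by $\mathbb Z_+[I]$, with graded components $\mathcal{LS}_{\mathbf k}(G,\Psi)$.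
   Formalization: In the definition of 𝔤, the Serre relation (ad e_i)^{1-a_ij/2} e_j=0 for i∈Ψ^re (which forces e_j=0 if a_ij≠0, making (1) false) is replaced by (ad [e_i,e_i])^{1-a_ij/2} e_j=0, likewise for the f_i; part (2) covers both forms. -}

module Defs where

open import Level using (Level; 0ℓ; _⊔_) renaming (suc to lsuc)
open import Data.Bool.Base using (if_then_else_)
open import Data.Empty using (⊥-elim)
open import Data.Fin.Base using (Fin)
import Data.Fin.Properties as Fin
open import Data.Integer.Base using (ℤ; +_; -[1+_])
import Data.Integer.Properties as ℤ
open import Data.List.Base using (List; []; _∷_; _++_)
open import Data.List.Membership.Propositional using (_∉_)
open import Data.List.Membership.Propositional.Properties using (∈-++⁺ˡ; ∈-++⁺ʳ)
open import Data.List.Relation.Unary.Any using (here)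
open import Data.Nat.Base as ℕ using (ℕ; zero; suc)
import Data.Nat.Properties as ℕ
open import Data.Parity.Base as ℙ using (Parity; 0ℙ; 1ℙ)
import Data.Parity.Properties as ℙ
open import Data.Product.Base using (Σ; ∃; _×_; _,_; proj₁; proj₂)
open import Data.Sum.Base using (_⊎_)
open import Data.Vec.Functional using (Vector)
open import Function.Base using (_∘_)
open import Function.Bundles using (_⇔_)
open import Relation.Binary.Core using (Rel)
open import Relation.Binary.Definitions using (DecidableEquality)
open import Relation.Binary.PropositionalEquality as ≡ using (_≡_; _≢_)
open import Relation.Binary.Structures using (IsPartialOrder)
open import Relation.Nullary using (¬_; yes; no; does)
open import Relation.Unary using (Pred; Decidable)
open import Algebra.Apartness.Bundles using (HeytingField; HeytingCommutativeRing)
open import Algebra.Bundles using (CommutativeMonoid; CommutativeRing; Ring)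
import Algebra.Definitions.RawMonoid as RawMonoid
open import Algebra.Module.Bundles using (LeftModule; RawLeftModule)
import Algebra.Module.Morphism.LeftModuleMonomorphism as LeftModuleMonomorphism
open import Algebra.Module.Morphism.Structures using (module LeftModuleMorphisms)

-- The instance of interest is ℂ with the order  z ≤ w  iff  w - z  is a
-- non-negative real, so that  z ≤ 0#  says "z is real and non-positive".
-- Only the properties below are used, and _#_ plays the role of ≠.
record ScalarField c ℓ₁ ℓ₂ ℓ₃ : Set (lsuc (c ⊔ ℓ₁ ⊔ ℓ₂ ⊔ ℓ₃)) where
  infix 4 _≤_
  field
    heytingField : HeytingField c ℓ₁ ℓ₂

  open HeytingField heytingField public

  commutativeRing : CommutativeRing c ℓ₁
  commutativeRing =
    HeytingCommutativeRing.commutativeRing heytingCommutativeRing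

  open CommutativeRing commutativeRing public using (ring; +-rawMonoid)

  -- n · x  is the n-fold sum  x + ⋯ + x
  open RawMonoid +-rawMonoid public using () renaming (_×_ to _·_)

  field
    _≤_            : Rel Carrier ℓ₃
    isPartialOrder : IsPartialOrder _≈_ _≤_
    +-monoˡ-≤      : ∀ z {x y} → x ≤ y → x + z ≤ y + z
    *-nonNeg       : ∀ {x y} → 0# ≤ x → 0# ≤ y → 0# ≤ x * y
    0≤1            : 0# ≤ 1#
    charZero       : ∀ n → suc n · 1# # 0#

  fromℤ : ℤ → Carrier
  fromℤ (+ n)    = n · 1#
  fromℤ -[1+ n ] = - (suc n · 1#)

  sgn : Parity → Carrier
  sgn 0ℙ = 1#
  sgn 1ℙ = - 1#

module _ {r ℓr} {R : Ring r ℓr} {m ℓm} (M : LeftModule R m ℓm) where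
  open Ring R using (Carrier; _≈_; 0#)
  open LeftModule M

  linearCombination : ∀ {d} → Vector Carrier d → Vector Carrierᴹ d → Carrierᴹ
  linearCombination t b =
    RawMonoid.sum +ᴹ-rawMonoid (λ j → t j *ₗ b j)

  record IsBasis {d} (b : Vector Carrierᴹ d) : Set (r ⊔ ℓr ⊔ m ⊔ ℓm) where
    field
      independent : ∀ t → linearCombination t b ≈ᴹ 0ᴹ → ∀ j → t j ≈ 0#
      spanning    : ∀ x → ∃ λ t → x ≈ᴹ linearCombination t b

  HasDimension : ℕ → Set (r ⊔ ℓr ⊔ m ⊔ ℓm)
  HasDimension d = ∃ λ (b : Vector Carrierᴹ d) → IsBasis b

data IndexSet : Set where
  finite   : ℕ → IndexSet
  infinite : IndexSet

⟦_⟧ : IndexSet → Set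
⟦ finite n ⟧ = Fin n
⟦ infinite ⟧ = ℕ

index-≟ : ∀ s → DecidableEquality ⟦ s ⟧
index-≟ (finite n) = Fin._≟_
index-≟ infinite   = ℕ._≟_

module _ {a ℓ} (I : Set) (M : CommutativeMonoid a ℓ) where
  open CommutativeMonoid M

  record FinitelySupported : Set (a ⊔ ℓ) where
    field
      at       : I → Carrier
      support  : List I
      vanishes : ∀ {i} → i ∉ support → at i ≈ ε

  open FinitelySupported

  ⨁ : CommutativeMonoid (a ⊔ ℓ) ℓ
  ⨁ = record
    { Carrier = FinitelySupported
    ; _≈_     = λ k l → ∀ i → at k i ≈ at l i
    ; _∙_     = λ k l → record
      { at       = λ i → at k i ∙ at l i
      ; support  = support k ++ support l
      ; vanishes = λ i∉ → trans
          (∙-cong (vanishes k (i∉ ∘ ∈-++⁺ˡ))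
                  (vanishes l (i∉ ∘ ∈-++⁺ʳ (support k))))
          (identityˡ ε)
      }
    ; ε = record { at = λ _ → ε ; support = [] ; vanishes = λ _ → refl }
    ; isCommutativeMonoid = record
      { isMonoid = record
        { isSemigroup = record
          { isMagma = record
            { isEquivalence = record
              { refl  = λ _ → refl
              ; sym   = λ p i → sym (p i)
              ; trans = λ p q i → trans (p i) (q i)
              }
            ; ∙-cong = λ p q i → ∙-cong (p i) (q i)
            }
          ; assoc = λ k l m i → assoc (at k i) (at l i) (at m i)
          }
        ; identity = (λ k i → identityˡ (at k i)) , (λ k i → identityʳ (at k i))
        }
      ; comm = λ k l i → comm (at k i) (at l i)
      }
    }

  single : DecidableEquality I → I → Carrier → FinitelySupported
  single _≟_ i x = record
    { at       = λ j → if does (i ≟ j) then x else ε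
    ; support  = i ∷ []
    ; vanishes = outside
    }
    where
    outside : ∀ {j} → j ∉ i ∷ [] → (if does (i ≟ j) then x else ε) ≈ ε
    outside {j} j∉ with i ≟ j
    ... | yes i≡j = ⊥-elim (j∉ (here (≡.sym i≡j)))
    ... | no  _   = refl

open FinitelySupported public

ℤ₊[_] : Set → CommutativeMonoid 0ℓ 0ℓ
ℤ₊[ I ] = ⨁ I ℕ.+-0-commutativeMonoid

rootLattice : Set → CommutativeMonoid 0ℓ 0ℓ
rootLattice I = ⨁ I ℤ.+-0-commutativeMonoid

η : ∀ {I} → CommutativeMonoid.Carrier ℤ₊[ I ] →
    CommutativeMonoid.Carrier (rootLattice I)
η k = record
  { at       = λ i → + at k i
  ; support  = support k
  ; vanishes = λ i∉ → ≡.cong +_ (vanishes k i∉)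
  }

module _ {c ℓ₁ ℓ₂ ℓ₃} (𝕂 : ScalarField c ℓ₁ ℓ₂ ℓ₃) where
  open ScalarField 𝕂

  infixl 6 _+ᵗ_
  infixr 7 _*ᵗ_

  data Term (X : Set) : Set c where
    gen   : X → Term X
    0ᵗ    : Term X
    _+ᵗ_  : Term X → Term X → Term X
    _*ᵗ_  : Carrier → Term X → Term X
    [_,_] : Term X → Term X → Term X

  mapᵗ : ∀ {X Y} → (X → Y) → Term X → Term Y
  mapᵗ f (gen x)   = gen (f x)
  mapᵗ f 0ᵗ        = 0ᵗ
  mapᵗ f (x +ᵗ y)  = mapᵗ f x +ᵗ mapᵗ f y
  mapᵗ f (t *ᵗ x)  = t *ᵗ mapᵗ f x
  mapᵗ f [ x , y ] = [ mapᵗ f x , mapᵗ f y ]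

  -- ad x ^ n $ y  is  (ad x)ⁿ y
  infix 8 ad_^_$_
  ad_^_$_ : ∀ {X} → Term X → ℕ → Term X → Term X
  ad x ^ zero  $ y = y
  ad x ^ suc n $ y = [ x , ad x ^ n $ y ]

  data Homogeneous {X : Set} {a ℓ} (G : CommutativeMonoid a ℓ)
                   (deg : X → CommutativeMonoid.Carrier G) :
                   CommutativeMonoid.Carrier G → Term X → Set (c ⊔ a ⊔ ℓ) where
    gen   : ∀ {g x} → CommutativeMonoid._≈_ G g (deg x) →
            Homogeneous G deg g (gen x)
    0ᵗ    : ∀ {g} → Homogeneous G deg g 0ᵗ
    _+ᵗ_  : ∀ {g x y} → Homogeneous G deg g x → Homogeneous G deg g y →
            Homogeneous G deg g (x +ᵗ y)
    _*ᵗ_  : ∀ {g} t {x} → Homogeneous G deg g x → Homogeneous G deg g (t *ᵗ x)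
    [_,_] : ∀ {g h k x y} → Homogeneous G deg g x → Homogeneous G deg h y →
            {CommutativeMonoid._≈_ G k (CommutativeMonoid._∙_ G g h)} →
            Homogeneous G deg k [ x , y ]

  record Presentation r : Set (c ⊔ lsuc r) where
    infix 4 _≐_
    field
      Generator : Set
      parity    : Generator → Parity
      _≐_       : Rel (Term Generator) r

  -- The presented Lie superalgebra is the setoid of terms modulo _∼_, the
  -- least congruence containing the relations _≐_ and the axioms of a Lie
  -- superalgebra.
  module Presented {r} (P : Presentation r) where
    open Presentation P public

    Elt : Set c
    Elt = Term Generator

    HasParity : Parity → Elt → Set c
    HasParity = Homogeneous ℙ.+-0-commutativeMonoid parity

    infix 4 _∼_
    data _∼_ : Rel Elt (c ⊔ ℓ₁ ⊔ r) where
      relation  : ∀ {x y} → x ≐ y → x ∼ y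

      ∼-refl    : ∀ {x} → x ∼ x
      ∼-sym     : ∀ {x y} → x ∼ y → y ∼ x
      ∼-trans   : ∀ {x y z} → x ∼ y → y ∼ z → x ∼ z
      +-cong′   : ∀ {x x′ y y′} → x ∼ x′ → y ∼ y′ → x +ᵗ y ∼ x′ +ᵗ y′
      *-cong′   : ∀ {s t x y} → s ≈ t → x ∼ y → s *ᵗ x ∼ t *ᵗ y
      [,]-cong  : ∀ {x x′ y y′} → x ∼ x′ → y ∼ y′ → [ x , y ] ∼ [ x′ , y′ ]

      +-assoc′  : ∀ x y z → (x +ᵗ y) +ᵗ z ∼ x +ᵗ (y +ᵗ z)
      +-comm′   : ∀ x y → x +ᵗ y ∼ y +ᵗ x
      +-idˡ     : ∀ x → 0ᵗ +ᵗ x ∼ x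
      *-distˡ   : ∀ t x y → t *ᵗ (x +ᵗ y) ∼ t *ᵗ x +ᵗ t *ᵗ y
      *-distʳ   : ∀ x s t → (s + t) *ᵗ x ∼ s *ᵗ x +ᵗ t *ᵗ x
      *-assoc′  : ∀ s t x → (s * t) *ᵗ x ∼ s *ᵗ (t *ᵗ x)
      *-idˡ     : ∀ x → 1# *ᵗ x ∼ x
      *-zeroˡ′  : ∀ x → 0# *ᵗ x ∼ 0ᵗ

      [,]-+ˡ    : ∀ x y z → [ x +ᵗ y , z ] ∼ [ x , z ] +ᵗ [ y , z ]
      [,]-+ʳ    : ∀ x y z → [ x , y +ᵗ z ] ∼ [ x , y ] +ᵗ [ x , z ]
      [,]-*ˡ    : ∀ t x y → [ t *ᵗ x , y ] ∼ t *ᵗ [ x , y ]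
      [,]-*ʳ    : ∀ t x y → [ x , t *ᵗ y ] ∼ t *ᵗ [ x , y ]

      skew      : ∀ {p q x y} → HasParity p x → HasParity q y →
                  [ x , y ] ∼ (- sgn (p ℙ.* q)) *ᵗ [ y , x ]
      jacobi    : ∀ {p q s x y z} →
                  HasParity p x → HasParity q y → HasParity s z →
                  [ x , [ y , z ] ] ∼
                  [ [ x , y ] , z ] +ᵗ sgn (p ℙ.* q) *ᵗ [ y , [ x , z ] ]

    *-zeroʳ′ : ∀ t → t *ᵗ 0ᵗ ∼ 0ᵗ
    *-zeroʳ′ t =
      ∼-trans (*-cong′ refl (∼-sym (*-zeroˡ′ 0ᵗ)))
      (∼-trans (∼-sym (*-assoc′ t 0# 0ᵗ))
      (∼-trans (*-cong′ (CommutativeRing.zeroʳ commutativeRing t) ∼-refl)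
               (*-zeroˡ′ 0ᵗ)))

    -ᵗ_ : Elt → Elt
    -ᵗ x = (- 1#) *ᵗ x

    -ᵗ-inverseˡ : ∀ x → -ᵗ x +ᵗ x ∼ 0ᵗ
    -ᵗ-inverseˡ x =
      ∼-trans (+-cong′ ∼-refl (∼-sym (*-idˡ x)))
      (∼-trans (∼-sym (*-distʳ x (- 1#) 1#))
      (∼-trans (*-cong′ (CommutativeRing.-‿inverseˡ commutativeRing 1#) ∼-refl)
               (*-zeroˡ′ x)))

    whole : LeftModule ring c (c ⊔ ℓ₁ ⊔ r)
    whole = record
      { Carrierᴹ = Elt
      ; _≈ᴹ_     = _∼_
      ; _+ᴹ_     = _+ᵗ_
      ; _*ₗ_     = _*ᵗ_
      ; 0ᴹ       = 0ᵗ
      ; -ᴹ_      = -ᵗ_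
      ; isLeftModule = record
        { isLeftSemimodule = record
          { +ᴹ-isCommutativeMonoid = record
            { isMonoid = record
              { isSemigroup = record
                { isMagma = record
                  { isEquivalence = record
                    { refl = ∼-refl ; sym = ∼-sym ; trans = ∼-trans }
                  ; ∙-cong = +-cong′
                  }
                ; assoc = +-assoc′
                }
              ; identity = +-idˡ , λ x → ∼-trans (+-comm′ x 0ᵗ) (+-idˡ x)
              }
            ; comm = +-comm′
            }
          ; isPreleftSemimodule = record
            { *ₗ-cong      = *-cong′
            ; *ₗ-zeroˡ     = *-zeroˡ′
            ; *ₗ-distribʳ  = *-distʳ
            ; *ₗ-identityˡ = *-idˡ
            ; *ₗ-assoc     = *-assoc′
            ; *ₗ-zeroʳ     = *-zeroʳ′
            ; *ₗ-distribˡ  = *-distˡ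
            }
          }
        ; -ᴹ‿cong    = *-cong′ refl
        ; -ᴹ‿inverse =
            -ᵗ-inverseˡ , λ x → ∼-trans (+-comm′ x (-ᵗ x)) (-ᵗ-inverseˡ x)
        }
      }

    module Subspace {w} (W : Pred Elt w)
                    (0∈ : W 0ᵗ)
                    (+∈ : ∀ {x y} → W x → W y → W (x +ᵗ y))
                    (*∈ : ∀ t {x} → W x → W (t *ᵗ x)) where

      rawLeftModule : RawLeftModule Carrier (c ⊔ w) (c ⊔ ℓ₁ ⊔ r)
      rawLeftModule = record
        { Carrierᴹ = Σ Elt W
        ; _≈ᴹ_     = λ x y → proj₁ x ∼ proj₁ y
        ; _+ᴹ_     = λ { (x , Wx) (y , Wy) → x +ᵗ y , +∈ Wx Wy }
        ; _*ₗ_     = λ { t (x , Wx) → t *ᵗ x , *∈ t Wx }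
        ; 0ᴹ       = 0ᵗ , 0∈
        ; -ᴹ_      = λ { (x , Wx) → -ᵗ x , *∈ (- 1#) Wx }
        }

      proj₁-isMonomorphism :
        LeftModuleMorphisms.IsLeftModuleMonomorphism
          rawLeftModule (LeftModule.rawLeftModule whole) proj₁
      proj₁-isMonomorphism = record
        { isLeftModuleHomomorphism = record
          { +ᴹ-isGroupHomomorphism = record
            { isMonoidHomomorphism = record
              { isMagmaHomomorphism = record
                { isRelHomomorphism = record { cong = λ x∼y → x∼y }
                ; homo = λ _ _ → ∼-refl
                }
              ; ε-homo = ∼-refl
              }
            ; ⁻¹-homo = λ _ → ∼-refl
            }
          ; *ₗ-homo = λ _ _ → ∼-refl
          }
        ; injective = λ x∼y → x∼y
        }

      leftModule : LeftModule ring (c ⊔ w) (c ⊔ ℓ₁ ⊔ r)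
      leftModule = record
        { isLeftModule =
            LeftModuleMonomorphism.isLeftModule proj₁-isMonomorphism
              (Ring.isRing ring) (LeftModule.isLeftModule whole)
        }

    module Graded {a ℓ} (G : CommutativeMonoid a ℓ)
                  (deg : Generator → CommutativeMonoid.Carrier G) where
      open CommutativeMonoid G using () renaming (Carrier to Degree)

      Component : Degree → Pred Elt (c ⊔ a ⊔ ℓ ⊔ ℓ₁ ⊔ r)
      Component g x = ∃ λ y → Homogeneous G deg g y × x ∼ y

      component : Degree → LeftModule ring (c ⊔ a ⊔ ℓ ⊔ ℓ₁ ⊔ r) (c ⊔ ℓ₁ ⊔ r)
      component g = Subspace.leftModule (Component g)
        (0ᵗ , 0ᵗ , ∼-refl)
        (λ { (x , hx , x∼) (y , hy , y∼) → x +ᵗ y , hx +ᵗ hy , +-cong′ x∼ y∼ })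
        (λ { t (x , hx , x∼) → t *ᵗ x , t *ᵗ hx , *-cong′ refl x∼ })

    data Subalgebra {s} (S : Pred Elt s) : Pred Elt (c ⊔ ℓ₁ ⊔ r ⊔ s) where
      incl  : ∀ {x} → S x → Subalgebra S x
      resp  : ∀ {x y} → x ∼ y → Subalgebra S x → Subalgebra S y
      0∈    : Subalgebra S 0ᵗ
      +∈    : ∀ {x y} → Subalgebra S x → Subalgebra S y → Subalgebra S (x +ᵗ y)
      *∈    : ∀ t {x} → Subalgebra S x → Subalgebra S (t *ᵗ x)
      [,]∈  : ∀ {x y} → Subalgebra S x → Subalgebra S y →
              Subalgebra S [ x , y ]

    data Ideal {s} (S : Pred Elt s) : Pred Elt (c ⊔ ℓ₁ ⊔ r ⊔ s) where
      incl  : ∀ {x} → S x → Ideal S x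
      resp  : ∀ {x y} → x ∼ y → Ideal S x → Ideal S y
      0∈    : Ideal S 0ᵗ
      +∈    : ∀ {x y} → Ideal S x → Ideal S y → Ideal S (x +ᵗ y)
      *∈    : ∀ t {x} → Ideal S x → Ideal S (t *ᵗ x)
      [,]∈ˡ : ∀ {x} y → Ideal S x → Ideal S [ x , y ]
      [,]∈ʳ : ∀ x {y} → Ideal S y → Ideal S [ x , y ]

  module _ {r₁ r₂} (P : Presentation r₁) (Q : Presentation r₂) where
    private
      module P = Presented P
      module Q = Presented Q
    open LeftModuleMorphisms
      (LeftModule.rawLeftModule P.whole) (LeftModule.rawLeftModule Q.whole)

    record IsSuperHomomorphism (f : P.Elt → Q.Elt) :
                               Set (c ⊔ ℓ₁ ⊔ r₁ ⊔ r₂) where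
      field
        isLeftModuleHomomorphism : IsLeftModuleHomomorphism f
        [,]-homo    : ∀ x y → f [ x , y ] Q.∼ [ f x , f y ]
        parity-homo : ∀ p x →
          P.Graded.Component ℙ.+-0-commutativeMonoid P.parity p x →
          Q.Graded.Component ℙ.+-0-commutativeMonoid Q.parity p (f x)

  mapᵗ-homogeneous :
    ∀ {X Y : Set} {a b ℓ ℓ′}
    {G : CommutativeMonoid a ℓ} {H : CommutativeMonoid b ℓ′} →
    let module G = CommutativeMonoid G
        module H = CommutativeMonoid H in
    {degX : X → G.Carrier} {degY : Y → H.Carrier}
    (θ : G.Carrier → H.Carrier) →
    (∀ {g h} → g G.≈ h → θ g H.≈ θ h) →
    (∀ g h → θ (g G.∙ h) H.≈ θ g H.∙ θ h) →
    (f : X → Y) → (∀ x → θ (degX x) H.≈ degY (f x)) →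
    ∀ {g x} → Homogeneous G degX g x → Homogeneous H degY (θ g) (mapᵗ f x)
  mapᵗ-homogeneous {H = H} θ θ-cong θ-∙ f θ-deg = go
    where
    go : ∀ {g x} → Homogeneous _ _ g x → Homogeneous H _ (θ g) (mapᵗ f x)
    go (gen p)         = gen (CommutativeMonoid.trans H (θ-cong p) (θ-deg _))
    go 0ᵗ              = 0ᵗ
    go (p +ᵗ q)        = go p +ᵗ go q
    go (t *ᵗ p)        = t *ᵗ go p
    go ([_,_] p q {e}) =
      [_,_] (go p) (go q) {CommutativeMonoid.trans H (θ-cong e) (θ-∙ _ _)}

  module _ {r₁ r₂} {P : Presentation r₁} {Q : Presentation r₂} where
    private
      module P = Presented P
      module Q = Presented Q

    mapᵗ-cong : (f : P.Generator → Q.Generator) →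
                (∀ x → P.parity x ≡ Q.parity (f x)) →
                (∀ {x y} → x P.≐ y → mapᵗ f x Q.∼ mapᵗ f y) →
                ∀ {x y} → x P.∼ y → mapᵗ f x Q.∼ mapᵗ f y
    mapᵗ-cong f f-parity f-≐ = go
      where
      par : ∀ {p x} → P.HasParity p x → Q.HasParity p (mapᵗ f x)
      par = mapᵗ-homogeneous (λ p → p) (λ e → e) (λ _ _ → ≡.refl) f f-parity

      go : ∀ {x y} → x P.∼ y → mapᵗ f x Q.∼ mapᵗ f y
      go (P.relation e)    = f-≐ e
      go P.∼-refl          = Q.∼-refl
      go (P.∼-sym e)       = Q.∼-sym (go e)
      go (P.∼-trans d e)   = Q.∼-trans (go d) (go e)
      go (P.+-cong′ d e)   = Q.+-cong′ (go d) (go e)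
      go (P.*-cong′ s≈t e) = Q.*-cong′ s≈t (go e)
      go (P.[,]-cong d e)  = Q.[,]-cong (go d) (go e)
      go (P.+-assoc′ _ _ _) = Q.+-assoc′ _ _ _
      go (P.+-comm′ _ _)   = Q.+-comm′ _ _
      go (P.+-idˡ _)       = Q.+-idˡ _
      go (P.*-distˡ _ _ _) = Q.*-distˡ _ _ _
      go (P.*-distʳ _ _ _) = Q.*-distʳ _ _ _
      go (P.*-assoc′ _ _ _) = Q.*-assoc′ _ _ _
      go (P.*-idˡ _)       = Q.*-idˡ _
      go (P.*-zeroˡ′ _)    = Q.*-zeroˡ′ _
      go (P.[,]-+ˡ _ _ _)  = Q.[,]-+ˡ _ _ _
      go (P.[,]-+ʳ _ _ _)  = Q.[,]-+ʳ _ _ _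
      go (P.[,]-*ˡ _ _ _)  = Q.[,]-*ˡ _ _ _
      go (P.[,]-*ʳ _ _ _)  = Q.[,]-*ʳ _ _ _
      go (P.skew hx hy)    = Q.skew (par hx) (par hy)
      go (P.jacobi hx hy hz) = Q.jacobi (par hx) (par hy) (par hz)

  module _ {I : Set} {ℓ} (Adjacent : Rel I ℓ) (parity : I → Parity) where

    data PartialCommutation : Rel (Term I) (c ⊔ ℓ) where
      commute : ∀ {i j} → i ≢ j → ¬ Adjacent i j →
                PartialCommutation [ gen i , gen j ] 0ᵗ

    freePartiallyCommutative : Presentation (c ⊔ ℓ)
    freePartiallyCommutative = record
      { Generator = I ; parity = parity ; _≐_ = PartialCommutation }

  record BKMSupermatrix (s : IndexSet) : Set (c ⊔ ℓ₁ ⊔ ℓ₂ ⊔ ℓ₃ ⊔ lsuc 0ℓ) where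
    field
      a  : ⟦ s ⟧ → ⟦ s ⟧ → Carrier
      Ψ  : Pred ⟦ s ⟧ 0ℓ
      Ψ? : Decidable Ψ

    Iʳᵉ : Pred ⟦ s ⟧ ℓ₁
    Iʳᵉ i = a i i ≈ 2 · 1#

    Ψʳᵉ : Pred ⟦ s ⟧ ℓ₁
    Ψʳᵉ i = Ψ i × Iʳᵉ i

    Ψ₀ : Pred ⟦ s ⟧ ℓ₁
    Ψ₀ i = Ψ i × a i i ≈ 0#

    field
      diagonal       : ∀ i → Iʳᵉ i ⊎ a i i ≤ 0#
      offDiagonal    : ∀ i j → i ≢ j → a i j ≤ 0#
      zeroPattern    : ∀ i j → a i j ≈ 0# ⇔ a j i ≈ 0#
      integral       : ∀ i j → Iʳᵉ i → ∃ λ z → a i j ≈ fromℤ z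
      evenIntegral   : ∀ i j → Ψʳᵉ i → ∃ λ z → a i j ≈ 2 · fromℤ z
      symmetrizable  : ∃ λ (d : ⟦ s ⟧ → Carrier) →
                       (∀ i → 0# ≤ d i × d i # 0#) ×
                       (∀ i j → d i * a i j ≈ d j * a j i)

  module BKM {s : IndexSet} (A : BKMSupermatrix s) where
    open BKMSupermatrix A public

    I : Set
    I = ⟦ s ⟧

    parityOf : I → Parity
    parityOf i = if does (Ψ? i) then 1ℙ else 0ℙ

    -- Exponents are read off from a i j, which is a non-positive (even)
    -- integer here:  a i j = - m  gives  1 - a i j = suc m,  and
    -- a i j = - 2 m  gives  1 - a i j / 2 = suc m.
    --
    -- For i ∈ Ψʳᵉ the extra relation is (ad [eᵢ,eᵢ])^(1 - a i j / 2) eⱼ = 0.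
    -- With eᵢ in place of [eᵢ,eᵢ] (see HalvedSerreElement) it would be
    -- inconsistent with the rest of the presentation: if a i j = -2, applying
    -- ad fᵢ to [eᵢ,[eᵢ,eⱼ]] gives 2[eᵢ,eⱼ], and applying it again gives -4 eⱼ,
    -- so that eⱼ = 0 in 𝔤; likewise for every a i j ≠ 0.
    -- HalvedSerreElement is only used to generate ideals of the free partially
    -- commutative algebra, where it is harmless.
    data SerreElement : Pred (Term I) (c ⊔ ℓ₁) where
      real    : ∀ {i j} m → Iʳᵉ i → i ≢ j → a i j ≈ - (m · 1#) →
                SerreElement (ad gen i ^ suc m $ gen j)
      oddReal : ∀ {i j} m → Ψʳᵉ i → i ≢ j → a i j ≈ - (2 · (m · 1#)) →
                SerreElement (ad [ gen i , gen i ] ^ suc m $ gen j)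
      null    : ∀ {i} → Ψ₀ i → SerreElement (ad gen i ^ 1 $ gen i)

    data HalvedSerreElement : Pred (Term I) (c ⊔ ℓ₁) where
      halved  : ∀ {i j} m → Ψʳᵉ i → i ≢ j → a i j ≈ - (2 · (m · 1#)) →
                HalvedSerreElement (ad gen i ^ suc m $ gen j)

    data ChevalleyGenerator : Set where
      e f h : I → ChevalleyGenerator

    chevalleyParity : ChevalleyGenerator → Parity
    chevalleyParity (e i) = parityOf i
    chevalleyParity (f i) = parityOf i
    chevalleyParity (h i) = 0ℙ

    infix 4 _≐ᴮ_
    data _≐ᴮ_ : Rel (Term ChevalleyGenerator) (c ⊔ ℓ₁) where
      hh     : ∀ i j → [ gen (h i) , gen (h j) ] ≐ᴮ 0ᵗ
      he     : ∀ i j → [ gen (h i) , gen (e j) ] ≐ᴮ a i j *ᵗ gen (e j)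
      hf     : ∀ i j → [ gen (h i) , gen (f j) ] ≐ᴮ (- a i j) *ᵗ gen (f j)
      ef-≡   : ∀ i → [ gen (e i) , gen (f i) ] ≐ᴮ gen (h i)
      ef-≢   : ∀ {i j} → i ≢ j → [ gen (e i) , gen (f j) ] ≐ᴮ 0ᵗ
      serreᵉ : ∀ {x} → SerreElement x → mapᵗ e x ≐ᴮ 0ᵗ
      serreᶠ : ∀ {x} → SerreElement x → mapᵗ f x ≐ᴮ 0ᵗ
      ee     : ∀ {i j} → a i j ≈ 0# → [ gen (e i) , gen (e j) ] ≐ᴮ 0ᵗ
      ff     : ∀ {i j} → a i j ≈ 0# → [ gen (f i) , gen (f j) ] ≐ᴮ 0ᵗ

    𝔤-presentation : Presentation (c ⊔ ℓ₁)
    𝔤-presentation = record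
      { Generator = ChevalleyGenerator
      ; parity    = chevalleyParity
      ; _≐_       = _≐ᴮ_
      }

    module 𝔤 = Presented 𝔤-presentation

    rootDegree : ChevalleyGenerator → CommutativeMonoid.Carrier (rootLattice I)
    rootDegree (e i) = single I ℤ.+-0-commutativeMonoid (index-≟ s) i (+ 1)
    rootDegree (f i) = single I ℤ.+-0-commutativeMonoid (index-≟ s) i -[1+ 0 ]
    rootDegree (h i) = CommutativeMonoid.ε (rootLattice I)

    module 𝔤-grading = 𝔤.Graded (rootLattice I) rootDegree

    𝔫₊ : Pred 𝔤.Elt (c ⊔ ℓ₁)
    𝔫₊ = 𝔤.Subalgebra (λ x → ∃ λ i → x ≡ gen (e i))

    QuasiDynkinAdjacent : Rel I ℓ₂
    QuasiDynkinAdjacent i j = i ≢ j × a i j # 0#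

    LS-presentation : Presentation (c ⊔ ℓ₂)
    LS-presentation = freePartiallyCommutative QuasiDynkinAdjacent parityOf

    module LS = Presented LS-presentation

    multidegree : I → CommutativeMonoid.Carrier ℤ₊[ I ]
    multidegree i = single I ℕ.+-0-commutativeMonoid (index-≟ s) i 1

    module LS-grading = LS.Graded ℤ₊[ I ] multidegree

    φ : LS.Elt → 𝔤.Elt
    φ = mapᵗ e

    φ-cong : ∀ {x y} → x LS.∼ y → φ x 𝔤.∼ φ y
    φ-cong = mapᵗ-cong e (λ _ → ≡.refl) λ where
      (commute i≢j ¬adj) →
        𝔤.relation (ee (proj₁ (tight _ _) λ aij#0 → ¬adj (i≢j , aij#0)))

    φ-grade : ∀ k {x} → LS-grading.Component k x →
              𝔤-grading.Component (η k) (φ x)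
    φ-grade k (y , hy , x∼y) =
      φ y ,
      mapᵗ-homogeneous {G = ℤ₊[ I ]} {H = rootLattice I} η
        (λ p i → ≡.cong +_ (p i)) (λ _ _ _ → ≡.refl) e deg-e hy ,
      φ-cong x∼y
      where
      deg-e : ∀ i j → + at (multidegree i) j ≡ at (rootDegree (e i)) j
      deg-e i j with index-≟ s i j
      ... | yes _ = ≡.refl
      ... | no  _ = ≡.refl

    φ-restricted : ∀ k → LeftModule.Carrierᴹ (LS-grading.component k) →
                   LeftModule.Carrierᴹ (𝔤-grading.component (η k))
    φ-restricted k (x , x∈) = φ x , φ-grade k x∈

    IsLinearIsomorphismInDegree : CommutativeMonoid.Carrier ℤ₊[ I ] →
                                  Set (c ⊔ ℓ₁ ⊔ ℓ₂)
    IsLinearIsomorphismInDegree k =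
      LeftModuleMorphisms.IsLeftModuleIsomorphism
        (LeftModule.rawLeftModule (LS-grading.component k))
        (LeftModule.rawLeftModule (𝔤-grading.component (η k)))
        (φ-restricted k)

{-# OPTIONS --safe #-}

-- Let 𝔤̂ be given by the generators of 𝔤 and the relations among them other
-- than the Serre and commutation relations.  Coinduction from the trivial
-- module N of its lower triangular part makes the functions g from words in I
-- to N a 𝔤̂-module, with (eᵢ g)(w) = g(i w) and (fᵢ g)([]) = 0.  By the
-- classical computation, the Serre and commutation elements in the fᵢ commute
-- with all eⱼ in 𝔤̂; as they kill values at the empty word, they act by 0.
-- Dually those in the eᵢ commute with all fⱼ, so the functions on which all
-- their translates vanish form a 𝔤̂-submodule, which is then a 𝔤-module.
--
-- Now let N = LS.  If kᵢ ≠ 0 and d is the derivation of LS with [x,d] = lᵢ x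
-- for x of degree 𝐥, the 𝔫₊-equivariant map from LS ⋊ d to the functions on
-- words sends d to some Φ, and x Φ has value kᵢ x at the empty word if x has
-- degree 𝐤.  Cutting Φ off at the words of degree ≤ 𝐤 does not affect this
-- value, and puts Φ into the submodule: each Serre element either is some
-- [eᵢ,eⱼ] with aᵢⱼ = 0, which is 0 in LS, or has degree ≥ 2 in some i with
-- kᵢ ≤ 1.  Hence x vanishes in LS_𝐤 as soon as it does in 𝔤, or modulo the
-- Serre elements.  That LS_𝐤 maps onto the root space of 𝔤 is the triangular
-- decomposition.

module Submission where

open import Defs
open import Level using (Level; _⊔_; 0ℓ)
open import Data.Bool.Base using (if_then_else_)
open import Data.Empty using (⊥-elim)
open import Data.Fin.Base using (Fin; zero; suc)
open import Data.Fin.Patterns using (0F; 1F; 2F; 3F; 4F; 5F)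
open import Data.Integer.Base as ℤ using (ℤ; +_; -[1+_])
import Data.Integer.Properties as ℤ
open import Data.List.Base using (List; []; _∷_; _++_)
open import Data.List.Membership.Propositional using (_∈_)
open import Data.List.Relation.Unary.All as All using (All; all?)
open import Data.List.Relation.Unary.Any using (here; there)
open import Data.Nat.Base as ℕ using (ℕ; zero; suc; _≤_; z≤n; s≤s)
import Data.Nat.Properties as ℕ
import Data.Nat.Solver as ℕ
open import Data.Parity.Base as ℙ using (Parity; 0ℙ; 1ℙ)
import Data.Parity.Properties as ℙ
open import Data.Product.Base using (∃; _×_; _,_; proj₁; proj₂)
open import Data.Sum.Base using (_⊎_; inj₁; inj₂)
open import Data.Unit.Polymorphic.Base using (⊤; tt)
open import Data.Vec.Base as Vec using (Vec; []; _∷_)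
open import Data.Vec.Functional using (Vector)
open import Function.Base using (_∘_)
open import Function.Bundles using (_⇔_; mk⇔; Equivalence)
open import Relation.Binary.Core using (Rel)
open import Relation.Binary.Definitions using (tri<; tri≈; tri>)
open import Relation.Binary.PropositionalEquality as ≡ using (_≡_; _≢_)
open import Relation.Nullary using (¬_; Dec; yes; no; does)
open import Relation.Nullary.Decidable using (map′)
open import Relation.Unary using (Pred; _∪_)
open import Algebra.Bundles using (AbelianGroup; CommutativeMonoid; CommutativeRing; Ring)
open import Algebra.Module.Bundles using (LeftModule)
open import Algebra.Module.Morphism.Structures using (module LeftModuleMorphisms)
import Algebra.Apartness.Properties.HeytingCommutativeRing as HeytingProperties
import Algebra.Properties.CommutativeMonoid.Mult as CommutativeMonoidMult
import Algebra.Properties.CommutativeSemigroup as CommutativeSemigroupProperties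
import Algebra.Properties.Group as GroupProperties
import Algebra.Properties.Monoid.Mult as MonoidMult
import Algebra.Properties.Ring as RingProperties
import Relation.Binary.Reasoning.Setoid as SetoidReasoning

-- The relations of 𝔤 mix the `eᵢ` with the `fᵢ` and `hᵢ`, so a term in the `eᵢ` alone could vanish
-- in 𝔤 for reasons invisible in LS. Injectivity therefore calls for a 𝔤-module that still sees LS.
-- Coinduction yields one for any `N`, without prior knowledge of 𝔫₊ or of a basis of LS. The
-- adjoint module of LS would not be faithful: without edges and odd vertices LS is abelian. The
-- derivation d repairs this, because it multiplies degree 𝐤 by `kᵢ`, which is invertible in
-- characteristic 0. The uncut Φ would not do either: a Serre element is in general nonzero in LS
-- and then moves Φ. The bound `kᵢ ≤ 1` enters exactly here, since cutting off at 𝐤 removes every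
-- word in which such a letter `i` occurs twice. Signs need extra care: skew symmetry and the Jacobi
-- identity are axioms for terms of definite parity only, while an arbitrary term mixes parities.
-- Hence operators are attached to a term together with a parity, and terms are split into even and
-- odd parts where needed.

-- Identities between signed sums in a module.

data SignedTerm (n : ℕ) : Set where
  var  : Fin n → SignedTerm n
  _⊕_  : SignedTerm n → SignedTerm n → SignedTerm n
  -- For a known parity `p`, the scalars `sgn p` and `- sgn p` compute to `1#`, `- 1#` or
  -- `- (- 1#)`. Keeping the three apart lets `⟪_⟫` match such goals by computation.
  keep : SignedTerm n → SignedTerm n
  flip : SignedTerm n → SignedTerm n
  flip² : SignedTerm n → SignedTerm n

infixl 6 _⊕_

-- Decides identities between combinations with coefficients ±1: the normal
-- form of a coefficient m - n is the pair (m , n) with min m n = 0.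
module SignedSolver {r ℓr m ℓm : Level} {R : Ring r ℓr} (M : LeftModule R m ℓm) where
  open Ring R using (1#; -_; _*_)
  open RingProperties R using (-‿involutive; -1*x≈-x)
  open LeftModule M
  open CommutativeMonoidMult +ᴹ-commutativeMonoid using () renaming (_×_ to _·_; ×-homo-+ to ·-homo-+; ×-congʳ to ·-congʳ)
  open CommutativeSemigroupProperties (CommutativeMonoid.commutativeSemigroup +ᴹ-commutativeMonoid) using (interchange)
  open SetoidReasoning ≈ᴹ-setoid

  private
    neg : Carrierᴹ → Carrierᴹ
    neg v = (- 1#) *ₗ v

    neg-neg : ∀ v → neg (neg v) ≈ᴹ v
    neg-neg v = begin
      (- 1#) *ₗ ((- 1#) *ₗ v) ≈⟨ *ₗ-assoc _ _ _ ⟨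
      ((- 1#) * (- 1#)) *ₗ v  ≈⟨ *ₗ-congʳ (Ring.trans R (-1*x≈-x _) (-‿involutive 1#)) ⟩
      1# *ₗ v                 ≈⟨ *ₗ-identityˡ v ⟩
      v                       ∎

    neg-inverseʳ : ∀ v → v +ᴹ neg v ≈ᴹ 0ᴹ
    neg-inverseʳ v = begin
      v +ᴹ neg v       ≈⟨ +ᴹ-congʳ (*ₗ-identityˡ v) ⟨
      1# *ₗ v +ᴹ neg v ≈⟨ *ₗ-distribʳ _ _ _ ⟨
      (1# R.+ (- 1#)) *ₗ v ≈⟨ *ₗ-congʳ (Ring.-‿inverseʳ R 1#) ⟩
      R.0# *ₗ v          ≈⟨ *ₗ-zeroˡ v ⟩
      0ᴹ               ∎
      where module R = Ring R

    neg-· : ∀ n v → neg (n · v) ≈ᴹ n · neg v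
    neg-· zero    v = *ₗ-zeroʳ _
    neg-· (suc n) v = ≈ᴹ-trans (*ₗ-distribˡ _ _ _) (+ᴹ-congˡ (neg-· n v))

    Coefficient : Set
    Coefficient = ℕ × ℕ

    _•_ : Coefficient → Carrierᴹ → Carrierᴹ
    (m , n) • v = m · v +ᴹ n · neg v

    reduce : ℕ → ℕ → Coefficient
    reduce (suc m) (suc n) = reduce m n
    reduce m       n       = m , n

    reduce-correct : ∀ m n v → reduce m n • v ≈ᴹ (m , n) • v
    reduce-correct zero    zero    v = ≈ᴹ-refl
    reduce-correct zero    (suc n) v = ≈ᴹ-refl
    reduce-correct (suc m) zero    v = ≈ᴹ-refl
    reduce-correct (suc m) (suc n) v = begin
      reduce m n • v                            ≈⟨ reduce-correct m n v ⟩
      m · v +ᴹ n · neg v                        ≈⟨ +ᴹ-identityˡ _ ⟨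
      0ᴹ +ᴹ (m · v +ᴹ n · neg v)                ≈⟨ +ᴹ-congʳ (neg-inverseʳ v) ⟨
      (v +ᴹ neg v) +ᴹ (m · v +ᴹ n · neg v)      ≈⟨ interchange _ _ _ _ ⟩
      (v +ᴹ m · v) +ᴹ (neg v +ᴹ n · neg v)      ∎

    add : Coefficient → Coefficient → Coefficient
    add (m , n) (m′ , n′) = reduce (m ℕ.+ m′) (n ℕ.+ n′)

    add-correct : ∀ c d v → add c d • v ≈ᴹ c • v +ᴹ d • v
    add-correct (m , n) (m′ , n′) v = begin
      reduce (m ℕ.+ m′) (n ℕ.+ n′) • v              ≈⟨ reduce-correct (m ℕ.+ m′) (n ℕ.+ n′) v ⟩
      (m ℕ.+ m′) · v +ᴹ (n ℕ.+ n′) · neg v          ≈⟨ +ᴹ-cong (·-homo-+ v m m′) (·-homo-+ (neg v) n n′) ⟩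
      (m · v +ᴹ m′ · v) +ᴹ (n · neg v +ᴹ n′ · neg v) ≈⟨ interchange _ _ _ _ ⟩
      (m · v +ᴹ n · neg v) +ᴹ (m′ · v +ᴹ n′ · neg v) ∎

    swap : Coefficient → Coefficient
    swap (m , n) = n , m

    swap-correct : ∀ c v → swap c • v ≈ᴹ neg (c • v)
    swap-correct (m , n) v = begin
      n · v +ᴹ m · neg v             ≈⟨ +ᴹ-comm _ _ ⟩
      m · neg v +ᴹ n · v             ≈⟨ +ᴹ-congˡ (·-congʳ n (neg-neg v)) ⟨
      m · neg v +ᴹ n · neg (neg v)   ≈⟨ +ᴹ-cong (neg-· m v) (neg-· n (neg v)) ⟨
      neg (m · v) +ᴹ neg (n · neg v) ≈⟨ *ₗ-distribˡ _ _ _ ⟨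
      neg (m · v +ᴹ n · neg v)       ∎

    value : ∀ {n} → Vec Coefficient n → Vec Carrierᴹ n → Carrierᴹ
    value []       []      = 0ᴹ
    value (c ∷ cs) (v ∷ ρ) = c • v +ᴹ value cs ρ

    zeros : ∀ n → Vec Coefficient n
    zeros n = Vec.replicate n (0 , 0)

    value-zeros : ∀ {n} (ρ : Vec Carrierᴹ n) → value (zeros n) ρ ≈ᴹ 0ᴹ
    value-zeros []      = ≈ᴹ-refl
    value-zeros (v ∷ ρ) = begin
      (0ᴹ +ᴹ 0ᴹ) +ᴹ value (zeros _) ρ ≈⟨ +ᴹ-cong (+ᴹ-identityˡ 0ᴹ) (value-zeros ρ) ⟩
      0ᴹ +ᴹ 0ᴹ                        ≈⟨ +ᴹ-identityˡ 0ᴹ ⟩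
      0ᴹ                              ∎

    unit : ∀ {n} → Fin n → Vec Coefficient n
    unit zero    = (1 , 0) ∷ zeros _
    unit (suc i) = (0 , 0) ∷ unit i

    value-unit : ∀ {n} (i : Fin n) ρ → value (unit i) ρ ≈ᴹ Vec.lookup ρ i
    value-unit zero    (v ∷ ρ) = begin
      ((v +ᴹ 0ᴹ) +ᴹ 0ᴹ) +ᴹ value (zeros _) ρ ≈⟨ +ᴹ-cong (+ᴹ-identityʳ _) (value-zeros ρ) ⟩
      (v +ᴹ 0ᴹ) +ᴹ 0ᴹ                        ≈⟨ +ᴹ-identityʳ _ ⟩
      v +ᴹ 0ᴹ                                ≈⟨ +ᴹ-identityʳ _ ⟩
      v                                      ∎
    value-unit (suc i) (v ∷ ρ) = begin
      (0ᴹ +ᴹ 0ᴹ) +ᴹ value (unit i) ρ ≈⟨ +ᴹ-cong (+ᴹ-identityˡ 0ᴹ) (value-unit i ρ) ⟩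
      0ᴹ +ᴹ Vec.lookup ρ i           ≈⟨ +ᴹ-identityˡ _ ⟩
      Vec.lookup ρ i                 ∎

    value-add : ∀ {n} (cs ds : Vec Coefficient n) ρ →
                value (Vec.zipWith add cs ds) ρ ≈ᴹ value cs ρ +ᴹ value ds ρ
    value-add []       []       []      = ≈ᴹ-sym (+ᴹ-identityˡ 0ᴹ)
    value-add (c ∷ cs) (d ∷ ds) (v ∷ ρ) =
      ≈ᴹ-trans (+ᴹ-cong (add-correct c d v) (value-add cs ds ρ)) (interchange _ _ _ _)

    value-swap : ∀ {n} (cs : Vec Coefficient n) ρ →
                 value (Vec.map swap cs) ρ ≈ᴹ neg (value cs ρ)
    value-swap []       []      = ≈ᴹ-sym (*ₗ-zeroʳ _)
    value-swap (c ∷ cs) (v ∷ ρ) =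
      ≈ᴹ-trans (+ᴹ-cong (swap-correct c v) (value-swap cs ρ)) (≈ᴹ-sym (*ₗ-distribˡ _ _ _))

  ⟪_⟫ : ∀ {n} → SignedTerm n → Vec Carrierᴹ n → Carrierᴹ
  ⟪ var i   ⟫ ρ = Vec.lookup ρ i
  ⟪ s ⊕ t   ⟫ ρ = ⟪ s ⟫ ρ +ᴹ ⟪ t ⟫ ρ
  ⟪ keep s  ⟫ ρ = 1# *ₗ ⟪ s ⟫ ρ
  ⟪ flip s  ⟫ ρ = (- 1#) *ₗ ⟪ s ⟫ ρ
  ⟪ flip² s ⟫ ρ = (- (- 1#)) *ₗ ⟪ s ⟫ ρ

  normalise : ∀ {n} → SignedTerm n → Vec (ℕ × ℕ) n
  normalise (var i)   = unit i
  normalise (s ⊕ t)   = Vec.zipWith add (normalise s) (normalise t)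
  normalise (keep s)  = normalise s
  normalise (flip s)  = Vec.map swap (normalise s)
  normalise (flip² s) = normalise s

  private
    normalise-correct : ∀ {n} (s : SignedTerm n) ρ → value (normalise s) ρ ≈ᴹ ⟪ s ⟫ ρ
    normalise-correct (var i)  ρ = value-unit i ρ
    normalise-correct (s ⊕ t)  ρ =
      ≈ᴹ-trans (value-add (normalise s) (normalise t) ρ)
               (+ᴹ-cong (normalise-correct s ρ) (normalise-correct t ρ))
    normalise-correct (keep s) ρ =
      ≈ᴹ-trans (normalise-correct s ρ) (≈ᴹ-sym (*ₗ-identityˡ _))
    normalise-correct (flip s) ρ =
      ≈ᴹ-trans (value-swap (normalise s) ρ) (*ₗ-congˡ (normalise-correct s ρ))
    normalise-correct (flip² s) ρ = begin
      value (normalise s) ρ   ≈⟨ normalise-correct s ρ ⟩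
      ⟪ s ⟫ ρ                 ≈⟨ *ₗ-identityˡ _ ⟨
      1# *ₗ ⟪ s ⟫ ρ           ≈⟨ *ₗ-congʳ (-‿involutive 1#) ⟨
      (- (- 1#)) *ₗ ⟪ s ⟫ ρ   ∎

  solve : ∀ {n} (s t : SignedTerm n) ρ → normalise s ≡ normalise t → ⟪ s ⟫ ρ ≈ᴹ ⟪ t ⟫ ρ
  solve s t ρ eq = begin
    ⟪ s ⟫ ρ                ≈⟨ normalise-correct s ρ ⟨
    value (normalise s) ρ  ≡⟨ ≡.cong (λ cs → value cs ρ) eq ⟩
    value (normalise t) ρ  ≈⟨ normalise-correct t ρ ⟩
    ⟪ t ⟫ ρ                ∎

-- Terms acting on a module through supercommutators.

module Action {c ℓ₁ ℓ₂ ℓ₃ m ℓm} (𝕂 : ScalarField c ℓ₁ ℓ₂ ℓ₃)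
              (M : LeftModule (ScalarField.ring 𝕂) m ℓm) where
  open ScalarField 𝕂 using (Carrier; 1#; 0#; -_; _*_; sgn; *-comm)
  open LeftModule M
  open SignedSolver M
  open SetoidReasoning ≈ᴹ-setoid

  record IsLinear (A : Carrierᴹ → Carrierᴹ) : Set (c ⊔ m ⊔ ℓm) where
    field
      cong   : ∀ {g h} → g ≈ᴹ h → A g ≈ᴹ A h
      homo-+ : ∀ g h → A (g +ᴹ h) ≈ᴹ A g +ᴹ A h
      homo-* : ∀ t g → A (t *ₗ g) ≈ᴹ t *ₗ A g

    homo-0 : A 0ᴹ ≈ᴹ 0ᴹ
    homo-0 = begin
      A 0ᴹ           ≈⟨ cong (*ₗ-zeroˡ 0ᴹ) ⟨
      A (0# *ₗ 0ᴹ)   ≈⟨ homo-* 0# 0ᴹ ⟩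
      0# *ₗ A 0ᴹ     ≈⟨ *ₗ-zeroˡ _ ⟩
      0ᴹ             ∎

    homo-combination : ∀ t g h → A (g +ᴹ t *ₗ h) ≈ᴹ A g +ᴹ t *ₗ A h
    homo-combination t g h = ≈ᴹ-trans (homo-+ _ _) (+ᴹ-congˡ (homo-* _ _))

  open IsLinear

  *ₗ-commute : ∀ s t g → s *ₗ (t *ₗ g) ≈ᴹ t *ₗ (s *ₗ g)
  *ₗ-commute s t g = begin
    s *ₗ (t *ₗ g) ≈⟨ *ₗ-assoc s t g ⟨
    (s * t) *ₗ g  ≈⟨ *ₗ-congʳ (*-comm s t) ⟩
    (t * s) *ₗ g  ≈⟨ *ₗ-assoc t s g ⟩
    t *ₗ (s *ₗ g) ∎

  supercommutator : Parity → Parity → (A B : Carrierᴹ → Carrierᴹ) → Carrierᴹ → Carrierᴹ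
  supercommutator p q A B g = A (B g) +ᴹ (- sgn (p ℙ.* q)) *ₗ B (A g)

  +ᴹ-zeros : ∀ {g h} → g ≈ᴹ 0ᴹ → h ≈ᴹ 0ᴹ → g +ᴹ h ≈ᴹ 0ᴹ
  +ᴹ-zeros g≈0 h≈0 = ≈ᴹ-trans (+ᴹ-cong g≈0 h≈0) (+ᴹ-identityˡ 0ᴹ)

  *ₗ-zero : ∀ t {g} → g ≈ᴹ 0ᴹ → t *ₗ g ≈ᴹ 0ᴹ
  *ₗ-zero t g≈0 = ≈ᴹ-trans (*ₗ-congˡ g≈0) (*ₗ-zeroʳ t)

  sign-cancel : ∀ p {g} → (- sgn p) *ₗ g ≈ᴹ 0ᴹ → g ≈ᴹ 0ᴹ
  sign-cancel p {g} e = begin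
    g                                ≈⟨ *ₗ-identityˡ g ⟨
    1# *ₗ g                          ≈⟨ square p ⟩
    (- sgn p) *ₗ ((- sgn p) *ₗ g)    ≈⟨ *ₗ-zero _ e ⟩
    0ᴹ                               ∎
    where
    square : ∀ p → 1# *ₗ g ≈ᴹ (- sgn p) *ₗ ((- sgn p) *ₗ g)
    square 0ℙ = solve (keep (var 0F)) (flip (flip (var 0F))) (g ∷ []) ≡.refl
    square 1ℙ = solve (keep (var 0F)) (flip² (flip² (var 0F))) (g ∷ []) ≡.refl

  private
    interchange : ∀ a b c d → (a +ᴹ b) +ᴹ (c +ᴹ d) ≈ᴹ (a +ᴹ c) +ᴹ (b +ᴹ d)
    interchange a b c d =
      solve ((var 0F ⊕ var 1F) ⊕ (var 2F ⊕ var 3F)) ((var 0F ⊕ var 2F) ⊕ (var 1F ⊕ var 3F))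
            (a ∷ b ∷ c ∷ d ∷ []) ≡.refl

    isLinear-0 : IsLinear (λ _ → 0ᴹ)
    isLinear-0 = record
      { cong   = λ _ → ≈ᴹ-refl
      ; homo-+ = λ _ _ → ≈ᴹ-sym (+ᴹ-identityˡ 0ᴹ)
      ; homo-* = λ t _ → ≈ᴹ-sym (*ₗ-zeroʳ t)
      }

    isLinear-+ : ∀ {A B} → IsLinear A → IsLinear B → IsLinear (λ g → A g +ᴹ B g)
    isLinear-+ a b = record
      { cong   = λ e → +ᴹ-cong (cong a e) (cong b e)
      ; homo-+ = λ g h → ≈ᴹ-trans (+ᴹ-cong (homo-+ a g h) (homo-+ b g h)) (interchange _ _ _ _)
      ; homo-* = λ t g → ≈ᴹ-trans (+ᴹ-cong (homo-* a t g) (homo-* b t g)) (≈ᴹ-sym (*ₗ-distribˡ _ _ _))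
      }

    isLinear-* : ∀ s {A} → IsLinear A → IsLinear (λ g → s *ₗ A g)
    isLinear-* s a = record
      { cong   = λ e → *ₗ-congˡ (cong a e)
      ; homo-+ = λ g h → ≈ᴹ-trans (*ₗ-congˡ (homo-+ a g h)) (*ₗ-distribˡ _ _ _)
      ; homo-* = λ t g → ≈ᴹ-trans (*ₗ-congˡ (homo-* a t g)) (*ₗ-commute s t _)
      }

    isLinear-∘ : ∀ {A B} → IsLinear A → IsLinear B → IsLinear (A ∘ B)
    isLinear-∘ a b = record
      { cong   = λ e → cong a (cong b e)
      ; homo-+ = λ g h → ≈ᴹ-trans (cong a (homo-+ b g h)) (homo-+ a _ _)
      ; homo-* = λ t g → ≈ᴹ-trans (cong a (homo-* b t g)) (homo-* a t _)
      }

  isLinear-supercommutator : ∀ p q {A B} → IsLinear A → IsLinear B →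
                             IsLinear (supercommutator p q A B)
  isLinear-supercommutator p q a b =
    isLinear-+ (isLinear-∘ a b) (isLinear-* _ (isLinear-∘ b a))

  supercommutator-cong : ∀ p q {A A′ B B′} → IsLinear A → IsLinear B →
    (∀ g → A g ≈ᴹ A′ g) → (∀ g → B g ≈ᴹ B′ g) →
    ∀ g → supercommutator p q A B g ≈ᴹ supercommutator p q A′ B′ g
  supercommutator-cong p q a b A≈ B≈ g =
    +ᴹ-cong (≈ᴹ-trans (cong a (B≈ g)) (A≈ _))
            (*ₗ-congˡ (≈ᴹ-trans (cong b (A≈ g)) (B≈ _)))

  private
    sign -sign : ∀ {n} → Parity → SignedTerm n → SignedTerm n
    sign  0ℙ = keep
    sign  1ℙ = flip
    -sign 0ℙ = flip
    -sign 1ℙ = flip²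

  supercommutator-skew : ∀ p q A B g →
    supercommutator p q A B g ≈ᴹ (- sgn (p ℙ.* q)) *ₗ supercommutator q p B A g
  supercommutator-skew p q A B g = go p q
    where
    go : ∀ p q → supercommutator p q A B g ≈ᴹ (- sgn (p ℙ.* q)) *ₗ supercommutator q p B A g
    by : ∀ p q → _
    by p q = solve (var 0F ⊕ -sign (p ℙ.* q) (var {2} 1F))
                   (-sign (p ℙ.* q) (var 1F ⊕ -sign (q ℙ.* p) (var 0F)))
                   (A (B g) ∷ B (A g) ∷ [])
    go 0ℙ 0ℙ = by 0ℙ 0ℙ ≡.refl
    go 0ℙ 1ℙ = by 0ℙ 1ℙ ≡.refl
    go 1ℙ 0ℙ = by 1ℙ 0ℙ ≡.refl
    go 1ℙ 1ℙ = by 1ℙ 1ℙ ≡.refl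

  -- Linearity expands both sides into signed sums of the six products of `A`, `B`, `C`. For each of
  -- the eight choices of parities the signs are concrete and the solver compares the coefficients.
  supercommutator-jacobi : ∀ p q s {A B C} → IsLinear A → IsLinear B → IsLinear C → ∀ g →
    supercommutator p (q ℙ.+ s) A (supercommutator q s B C) g ≈ᴹ
    supercommutator (p ℙ.+ q) s (supercommutator p q A B) C g +ᴹ
    sgn (p ℙ.* q) *ₗ supercommutator q (p ℙ.+ s) B (supercommutator p s A C) g
  supercommutator-jacobi p q s {A} {B} {C} a b c g = begin
    supercommutator p (q ℙ.+ s) A (supercommutator q s B C) g
      ≈⟨ +ᴹ-congʳ (homo-combination a _ _ _) ⟩
    (A (B (C g)) +ᴹ σ q s *ₗ A (C (B g))) +ᴹ
    σ p (q ℙ.+ s) *ₗ (B (C (A g)) +ᴹ σ q s *ₗ C (B (A g)))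
      ≈⟨ identity p q s ⟩
    ((A (B (C g)) +ᴹ σ p q *ₗ B (A (C g))) +ᴹ
     σ (p ℙ.+ q) s *ₗ (C (A (B g)) +ᴹ σ p q *ₗ C (B (A g)))) +ᴹ
    sgn (p ℙ.* q) *ₗ
    ((B (A (C g)) +ᴹ σ p s *ₗ B (C (A g))) +ᴹ
     σ q (p ℙ.+ s) *ₗ (A (C (B g)) +ᴹ σ p s *ₗ C (A (B g))))
      ≈⟨ +ᴹ-cong (+ᴹ-congˡ (*ₗ-congˡ (homo-combination c _ _ _)))
                 (*ₗ-congˡ (+ᴹ-congʳ (homo-combination b _ _ _))) ⟨
    supercommutator (p ℙ.+ q) s (supercommutator p q A B) C g +ᴹ
    sgn (p ℙ.* q) *ₗ supercommutator q (p ℙ.+ s) B (supercommutator p s A C) g ∎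
    where
    σ : Parity → Parity → Carrier
    σ p q = - sgn (p ℙ.* q)

    abc acb bca cba bac cab : Carrierᴹ
    abc = A (B (C g))
    acb = A (C (B g))
    bca = B (C (A g))
    cba = C (B (A g))
    bac = B (A (C g))
    cab = C (A (B g))

    by : ∀ p q s → _
    by p q s = solve
      ((var {6} 0F ⊕ σ′ q s (var 1F)) ⊕ σ′ p (q ℙ.+ s) (var 2F ⊕ σ′ q s (var 3F)))
      (((var 0F ⊕ σ′ p q (var 4F)) ⊕ σ′ (p ℙ.+ q) s (var 5F ⊕ σ′ p q (var 3F))) ⊕
       sign (p ℙ.* q)
       ((var 4F ⊕ σ′ p s (var 2F)) ⊕ σ′ q (p ℙ.+ s) (var 1F ⊕ σ′ p s (var 5F))))
      (abc ∷ acb ∷ bca ∷ cba ∷ bac ∷ cab ∷ [])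
      where
      σ′ : ∀ {n} → Parity → Parity → SignedTerm n → SignedTerm n
      σ′ p q = -sign (p ℙ.* q)

    identity : ∀ p q s →
      (abc +ᴹ σ q s *ₗ acb) +ᴹ σ p (q ℙ.+ s) *ₗ (bca +ᴹ σ q s *ₗ cba) ≈ᴹ
      ((abc +ᴹ σ p q *ₗ bac) +ᴹ σ (p ℙ.+ q) s *ₗ (cab +ᴹ σ p q *ₗ cba)) +ᴹ
      sgn (p ℙ.* q) *ₗ
      ((bac +ᴹ σ p s *ₗ bca) +ᴹ σ q (p ℙ.+ s) *ₗ (acb +ᴹ σ p s *ₗ cab))
    identity 0ℙ 0ℙ 0ℙ = by 0ℙ 0ℙ 0ℙ ≡.refl
    identity 0ℙ 0ℙ 1ℙ = by 0ℙ 0ℙ 1ℙ ≡.refl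
    identity 0ℙ 1ℙ 0ℙ = by 0ℙ 1ℙ 0ℙ ≡.refl
    identity 0ℙ 1ℙ 1ℙ = by 0ℙ 1ℙ 1ℙ ≡.refl
    identity 1ℙ 0ℙ 0ℙ = by 1ℙ 0ℙ 0ℙ ≡.refl
    identity 1ℙ 0ℙ 1ℙ = by 1ℙ 0ℙ 1ℙ ≡.refl
    identity 1ℙ 1ℙ 0ℙ = by 1ℙ 1ℙ 0ℙ ≡.refl
    identity 1ℙ 1ℙ 1ℙ = by 1ℙ 1ℙ 1ℙ ≡.refl

  -- A term need not be homogeneous, so it acts through its even and its odd
  -- part:  act p x  is the action of the component of x of parity p.
  module _ {X : Set} (parity : X → Parity) (op : X → Carrierᴹ → Carrierᴹ) where

    act : Parity → Term 𝕂 X → Carrierᴹ → Carrierᴹ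
    act p (gen x)   g = if does (parity x ℙ.≟ p) then op x g else 0ᴹ
    act p 0ᵗ        g = 0ᴹ
    act p (x +ᵗ y)  g = act p x g +ᴹ act p y g
    act p (t *ᵗ x)  g = t *ₗ act p x g
    act p [ x , y ] g =
      supercommutator 0ℙ p (act 0ℙ x) (act p y) g +ᴹ
      supercommutator 1ℙ (p ℙ.⁻¹) (act 1ℙ x) (act (p ℙ.⁻¹) y) g

  module _ {X : Set} (parity : X → Parity) {op : X → Carrierᴹ → Carrierᴹ}
           (op-linear : ∀ x → IsLinear (op x)) where

    private
      ρ : Parity → Term 𝕂 X → Carrierᴹ → Carrierᴹ
      ρ = act parity op

      HasParity : Parity → Term 𝕂 X → Set c
      HasParity = Homogeneous 𝕂 ℙ.+-0-commutativeMonoid parity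

    act-linear : ∀ p x → IsLinear (ρ p x)
    act-linear p (gen x) with parity x ℙ.≟ p
    ... | yes _ = op-linear x
    ... | no  _ = isLinear-0
    act-linear p 0ᵗ        = isLinear-0
    act-linear p (x +ᵗ y)  = isLinear-+ (act-linear p x) (act-linear p y)
    act-linear p (t *ᵗ x)  = isLinear-* t (act-linear p x)
    act-linear p [ x , y ] =
      isLinear-+ (isLinear-supercommutator 0ℙ p (act-linear 0ℙ x) (act-linear p y))
                 (isLinear-supercommutator 1ℙ (p ℙ.⁻¹) (act-linear 1ℙ x) (act-linear (p ℙ.⁻¹) y))

    act-gen : ∀ x g → ρ (parity x) (gen x) g ≡ op x g
    act-gen x g with parity x ℙ.≟ parity x
    ... | yes _ = ≡.refl
    ... | no  q = ⊥-elim (q ≡.refl)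

    private
      commutator-0ˡ : ∀ {p q x y} g → (∀ h → ρ p x h ≈ᴹ 0ᴹ) →
                      supercommutator p q (ρ p x) (ρ q y) g ≈ᴹ 0ᴹ
      commutator-0ˡ {q = q} {y = y} g z =
        +ᴹ-zeros (z _) (*ₗ-zero _ (≈ᴹ-trans (cong (act-linear q y) (z g)) (homo-0 (act-linear q y))))

      commutator-0ʳ : ∀ {p q x y} g → (∀ h → ρ q y h ≈ᴹ 0ᴹ) →
                      supercommutator p q (ρ p x) (ρ q y) g ≈ᴹ 0ᴹ
      commutator-0ʳ {p} {x = x} g z =
        +ᴹ-zeros (≈ᴹ-trans (cong (act-linear p x) (z g)) (homo-0 (act-linear p x))) (*ₗ-zero _ (z _))

    -- In a bracket, the summand that uses the wrong parity of `x` dies through `x`. In the other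
    -- summand the mismatch of the total parity passes to `y`.
    act-vanishes : ∀ {p x} → HasParity p x → ∀ {q} → q ≢ p → ∀ g → ρ q x g ≈ᴹ 0ᴹ
    act-vanishes (gen {x = x} p≡) {q} q≢p g with parity x ℙ.≟ q
    ... | yes e = ⊥-elim (q≢p (≡.sym (≡.trans p≡ e)))
    ... | no  _ = ≈ᴹ-refl
    act-vanishes 0ᵗ        q≢p g = ≈ᴹ-refl
    act-vanishes (a +ᵗ b)  q≢p g = +ᴹ-zeros (act-vanishes a q≢p g) (act-vanishes b q≢p g)
    act-vanishes (t *ᵗ a)  q≢p g = *ₗ-zero t (act-vanishes a q≢p g)
    act-vanishes ([_,_] {r} {s} {x = x} {y = y} a b {≡.refl}) {q} q≢p g =
      +ᴹ-zeros (even r a q≢p) (odd r a q≢p)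
      where
      even : ∀ r → HasParity r x → q ≢ r ℙ.+ s → supercommutator 0ℙ q (ρ 0ℙ x) (ρ q y) g ≈ᴹ 0ᴹ
      even 0ℙ _ q≢ = commutator-0ʳ {x = x} {y = y} g (act-vanishes b q≢)
      even 1ℙ a _  = commutator-0ˡ {x = x} {y = y} g (act-vanishes a λ ())
      odd : ∀ r → HasParity r x → q ≢ r ℙ.+ s →
            supercommutator 1ℙ (q ℙ.⁻¹) (ρ 1ℙ x) (ρ (q ℙ.⁻¹) y) g ≈ᴹ 0ᴹ
      odd 0ℙ a _  = commutator-0ˡ {x = x} {y = y} g (act-vanishes a λ ())
      odd 1ℙ _ q≢ = commutator-0ʳ {x = x} {y = y} g (act-vanishes b λ q⁻¹≡s →
        q≢ (≡.trans (≡.sym (ℙ.⁻¹-involutive q)) (≡.cong ℙ._⁻¹ q⁻¹≡s)))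

    act-bracket : ∀ {p q r x y} → HasParity p x → HasParity q y → r ≡ p ℙ.+ q → ∀ g →
                  ρ r [ x , y ] g ≈ᴹ supercommutator p q (ρ p x) (ρ q y) g
    act-bracket {0ℙ} {q} {x = x} {y} a b ≡.refl g =
      ≈ᴹ-trans (+ᴹ-congˡ (commutator-0ˡ {x = x} {y = y} g (act-vanishes a λ ()))) (+ᴹ-identityʳ _)
    act-bracket {1ℙ} {q} {x = x} {y} a b ≡.refl g = begin
      supercommutator 0ℙ (q ℙ.⁻¹) (ρ 0ℙ x) (ρ (q ℙ.⁻¹) y) g +ᴹ
      supercommutator 1ℙ (q ℙ.⁻¹ ℙ.⁻¹) (ρ 1ℙ x) (ρ (q ℙ.⁻¹ ℙ.⁻¹) y) g
        ≈⟨ +ᴹ-congʳ (commutator-0ˡ {x = x} {y = y} g (act-vanishes a λ ())) ⟩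
      0ᴹ +ᴹ supercommutator 1ℙ (q ℙ.⁻¹ ℙ.⁻¹) (ρ 1ℙ x) (ρ (q ℙ.⁻¹ ℙ.⁻¹) y) g
        ≈⟨ +ᴹ-identityˡ _ ⟩
      supercommutator 1ℙ (q ℙ.⁻¹ ℙ.⁻¹) (ρ 1ℙ x) (ρ (q ℙ.⁻¹ ℙ.⁻¹) y) g
        ≡⟨ ≡.cong (λ s → supercommutator 1ℙ s (ρ 1ℙ x) (ρ s y) g) (ℙ.⁻¹-involutive q) ⟩
      supercommutator 1ℙ q (ρ 1ℙ x) (ρ q y) g ∎

    -- A relation has to hold in both parity components, but by `act-vanishes` only the component of
    -- parity `parity x + parity y` has content.
    act-relation : ∀ {x y z} → HasParity (parity x ℙ.+ parity y) z → ∀ {g} →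
      supercommutator (parity x) (parity y) (op x) (op y) g ≈ᴹ ρ (parity x ℙ.+ parity y) z g →
      ∀ p → ρ p [ gen x , gen y ] g ≈ᴹ ρ p z g
    act-relation {x} {y} {z} hz {g} e p with p ℙ.≟ parity x ℙ.+ parity y
    ... | no p≢ = ≈ᴹ-trans (act-vanishes ([_,_] (gen ≡.refl) (gen ≡.refl) {≡.refl}) p≢ g)
                           (≈ᴹ-sym (act-vanishes hz p≢ g))
    ... | yes ≡.refl = begin
      ρ (parity x ℙ.+ parity y) [ gen x , gen y ] g
        ≈⟨ act-bracket (gen ≡.refl) (gen ≡.refl) ≡.refl g ⟩
      supercommutator (parity x) (parity y) (ρ (parity x) (gen x)) (ρ (parity y) (gen y)) g
        ≈⟨ supercommutator-cong (parity x) (parity y)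
             (act-linear (parity x) (gen x)) (act-linear (parity y) (gen y))
             (λ h → ≈ᴹ-reflexive (act-gen x h)) (λ h → ≈ᴹ-reflexive (act-gen y h)) g ⟩
      supercommutator (parity x) (parity y) (op x) (op y) g
        ≈⟨ e ⟩
      ρ (parity x ℙ.+ parity y) z g ∎

  module _ {X Y : Set} (f : X → Y) {parity : Y → Parity} {op : Y → Carrierᴹ → Carrierᴹ} where

    act-mapᵗ : ∀ p x g → act parity op p (mapᵗ 𝕂 f x) g ≡ act (parity ∘ f) (op ∘ f) p x g
    act-mapᵗ p (gen x)  g = ≡.refl
    act-mapᵗ p 0ᵗ       g = ≡.refl
    act-mapᵗ p (x +ᵗ y) g = ≡.cong₂ _+ᴹ_ (act-mapᵗ p x g) (act-mapᵗ p y g)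
    act-mapᵗ p (t *ᵗ x) g = ≡.cong (t *ₗ_) (act-mapᵗ p x g)
    act-mapᵗ p [ x , y ] g =
      ≡.cong₂ _+ᴹ_
        (≡.cong₂ (λ u v → u +ᴹ (- sgn (0ℙ ℙ.* p)) *ₗ v) (nested 0ℙ x p y) (nested p y 0ℙ x))
        (≡.cong₂ (λ u v → u +ᴹ (- sgn (1ℙ ℙ.* (p ℙ.⁻¹))) *ₗ v)
                 (nested 1ℙ x (p ℙ.⁻¹) y) (nested (p ℙ.⁻¹) y 1ℙ x))
      where
      nested : ∀ q x r y → act parity op q (mapᵗ 𝕂 f x) (act parity op r (mapᵗ 𝕂 f y) g) ≡
                           act (parity ∘ f) (op ∘ f) q x (act (parity ∘ f) (op ∘ f) r y g)
      nested q x r y = ≡.trans (act-mapᵗ q x _) (≡.cong (act (parity ∘ f) (op ∘ f) q x) (act-mapᵗ r y g))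

  -- The relations are required on a subspace `W` only: the Serre relations in the `eᵢ` fail on the
  -- whole coinduced module and hold on a submodule.
  module Soundness {r w} (P : Presentation 𝕂 r)
    {op : Presentation.Generator P → Carrierᴹ → Carrierᴹ}
    (op-linear : ∀ x → IsLinear (op x))
    (W : Pred Carrierᴹ w) (0∈ : W 0ᴹ)
    (+∈ : ∀ {g h} → W g → W h → W (g +ᴹ h))
    (*∈ : ∀ t {g} → W g → W (t *ₗ g))
    (op∈ : ∀ x {g} → W g → W (op x g))
    (respects : ∀ {x y} → Presentation._≐_ P x y → ∀ p {g} → W g →
                act (Presentation.parity P) op p x g ≈ᴹ act (Presentation.parity P) op p y g)
    where
    open Presented 𝕂 P hiding (0∈; +∈; *∈)

    private
      ρ : Parity → Elt → Carrierᴹ → Carrierᴹ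
      ρ = act parity op

      lin : ∀ p x → IsLinear (ρ p x)
      lin = act-linear parity op-linear

    act∈ : ∀ p x {g} → W g → W (ρ p x g)
    act∈ p (gen x) g∈ with parity x ℙ.≟ p
    ... | yes _ = op∈ x g∈
    ... | no  _ = 0∈
    act∈ p 0ᵗ        g∈ = 0∈
    act∈ p (x +ᵗ y)  g∈ = +∈ (act∈ p x g∈) (act∈ p y g∈)
    act∈ p (t *ᵗ x)  g∈ = *∈ t (act∈ p x g∈)
    act∈ p [ x , y ] g∈ =
      +∈ (+∈ (act∈ 0ℙ x (act∈ p y g∈)) (*∈ _ (act∈ p y (act∈ 0ℙ x g∈))))
         (+∈ (act∈ 1ℙ x (act∈ (p ℙ.⁻¹) y g∈)) (*∈ _ (act∈ (p ℙ.⁻¹) y (act∈ 1ℙ x g∈))))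

    private
      bracket : ∀ {p q x y} → HasParity p x → HasParity q y → ∀ g →
                ρ (p ℙ.+ q) [ x , y ] g ≈ᴹ supercommutator p q (ρ p x) (ρ q y) g
      bracket a b = act-bracket parity op-linear a b ≡.refl

      act-skew : ∀ {p q x y} → HasParity p x → HasParity q y → ∀ s g →
                 ρ s [ x , y ] g ≈ᴹ (- sgn (p ℙ.* q)) *ₗ ρ s [ y , x ] g
      act-skew {p} {q} {x} {y} hx hy s g with s ℙ.≟ p ℙ.+ q
      ... | yes ≡.refl = begin
        ρ (p ℙ.+ q) [ x , y ] g
          ≈⟨ bracket hx hy g ⟩
        supercommutator p q (ρ p x) (ρ q y) g
          ≈⟨ supercommutator-skew p q (ρ p x) (ρ q y) g ⟩
        (- sgn (p ℙ.* q)) *ₗ supercommutator q p (ρ q y) (ρ p x) g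
          ≈⟨ *ₗ-congˡ (act-bracket parity op-linear hy hx (ℙ.+-comm p q) g) ⟨
        (- sgn (p ℙ.* q)) *ₗ ρ (p ℙ.+ q) [ y , x ] g ∎
      ... | no s≢ =
        ≈ᴹ-trans (act-vanishes parity op-linear ([_,_] hx hy {≡.refl}) s≢ g)
                 (≈ᴹ-sym (*ₗ-zero _ (act-vanishes parity op-linear ([_,_] hy hx {ℙ.+-comm p q}) s≢ g)))

      act-jacobi : ∀ {p q s x y z} → HasParity p x → HasParity q y → HasParity s z → ∀ t g →
                   ρ t [ x , [ y , z ] ] g ≈ᴹ
                   ρ t [ [ x , y ] , z ] g +ᴹ sgn (p ℙ.* q) *ₗ ρ t [ y , [ x , z ] ] g
      act-jacobi {p} {q} {s} {x} {y} {z} hx hy hz t g with t ℙ.≟ p ℙ.+ (q ℙ.+ s)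
      ... | yes ≡.refl = begin
        ρ (p ℙ.+ (q ℙ.+ s)) [ x , [ y , z ] ] g
          ≈⟨ bracket hx ([_,_] hy hz {≡.refl}) g ⟩
        supercommutator p (q ℙ.+ s) (ρ p x) (ρ (q ℙ.+ s) [ y , z ]) g
          ≈⟨ supercommutator-cong p (q ℙ.+ s) (lin p x) (lin (q ℙ.+ s) [ y , z ])
               (λ _ → ≈ᴹ-refl) (bracket hy hz) g ⟩
        supercommutator p (q ℙ.+ s) (ρ p x) (supercommutator q s (ρ q y) (ρ s z)) g
          ≈⟨ supercommutator-jacobi p q s (lin p x) (lin q y) (lin s z) g ⟩
        supercommutator (p ℙ.+ q) s (supercommutator p q (ρ p x) (ρ q y)) (ρ s z) g +ᴹ
        sgn (p ℙ.* q) *ₗ supercommutator q (p ℙ.+ s) (ρ q y) (supercommutator p s (ρ p x) (ρ s z)) g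
          ≈⟨ +ᴹ-cong (supercommutator-cong (p ℙ.+ q) s (lin (p ℙ.+ q) [ x , y ]) (lin s z)
                        (bracket hx hy) (λ _ → ≈ᴹ-refl) g)
                     (*ₗ-congˡ (supercommutator-cong q (p ℙ.+ s) (lin q y) (lin (p ℙ.+ s) [ x , z ])
                        (λ _ → ≈ᴹ-refl) (bracket hx hz) g)) ⟨
        supercommutator (p ℙ.+ q) s (ρ (p ℙ.+ q) [ x , y ]) (ρ s z) g +ᴹ
        sgn (p ℙ.* q) *ₗ supercommutator q (p ℙ.+ s) (ρ q y) (ρ (p ℙ.+ s) [ x , z ]) g
          ≈⟨ +ᴹ-cong (act-bracket parity op-linear ([_,_] hx hy {≡.refl}) hz (≡.sym (ℙ.+-assoc p q s)) g)
                     (*ₗ-congˡ (act-bracket parity op-linear hy ([_,_] hx hz {≡.refl}) swapped g)) ⟨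
        ρ (p ℙ.+ (q ℙ.+ s)) [ [ x , y ] , z ] g +ᴹ
        sgn (p ℙ.* q) *ₗ ρ (p ℙ.+ (q ℙ.+ s)) [ y , [ x , z ] ] g ∎
        where
        swapped : p ℙ.+ (q ℙ.+ s) ≡ q ℙ.+ (p ℙ.+ s)
        swapped = ≡.trans (≡.sym (ℙ.+-assoc p q s))
                    (≡.trans (≡.cong (ℙ._+ s) (ℙ.+-comm p q)) (ℙ.+-assoc q p s))
      ... | no t≢ =
        ≈ᴹ-trans (act-vanishes parity op-linear ([_,_] hx ([_,_] hy hz {≡.refl}) {≡.refl}) t≢ g)
          (≈ᴹ-sym (+ᴹ-zeros
            (act-vanishes parity op-linear ([_,_] ([_,_] hx hy {≡.refl}) hz {≡.sym (ℙ.+-assoc p q s)}) t≢ g)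
            (*ₗ-zero _ (act-vanishes parity op-linear ([_,_] hy ([_,_] hx hz {≡.refl}) {swapped}) t≢ g))))
        where
        swapped : p ℙ.+ (q ℙ.+ s) ≡ q ℙ.+ (p ℙ.+ s)
        swapped = ≡.trans (≡.sym (ℙ.+-assoc p q s))
                    (≡.trans (≡.cong (ℙ._+ s) (ℙ.+-comm p q)) (ℙ.+-assoc q p s))

      supercommutator-+ˡ : ∀ p q (A A′ : Carrierᴹ → Carrierᴹ) {B} → IsLinear B → ∀ g →
        supercommutator p q (λ h → A h +ᴹ A′ h) B g ≈ᴹ
        supercommutator p q A B g +ᴹ supercommutator p q A′ B g
      supercommutator-+ˡ p q A A′ b g =
        ≈ᴹ-trans (+ᴹ-congˡ (≈ᴹ-trans (*ₗ-congˡ (homo-+ b _ _)) (*ₗ-distribˡ _ _ _)))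
                 (interchange _ _ _ _)

      supercommutator-+ʳ : ∀ p q {A} (B B′ : Carrierᴹ → Carrierᴹ) → IsLinear A → ∀ g →
        supercommutator p q A (λ h → B h +ᴹ B′ h) g ≈ᴹ
        supercommutator p q A B g +ᴹ supercommutator p q A B′ g
      supercommutator-+ʳ p q B B′ a g =
        ≈ᴹ-trans (+ᴹ-cong (homo-+ a _ _) (*ₗ-distribˡ _ _ _)) (interchange _ _ _ _)

      supercommutator-*ˡ : ∀ p q t (A : Carrierᴹ → Carrierᴹ) {B} → IsLinear B → ∀ g →
        supercommutator p q (λ h → t *ₗ A h) B g ≈ᴹ t *ₗ supercommutator p q A B g
      supercommutator-*ˡ p q t A b g =
        ≈ᴹ-trans (+ᴹ-congˡ (≈ᴹ-trans (*ₗ-congˡ (homo-* b _ _)) (*ₗ-commute _ _ _)))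
                 (≈ᴹ-sym (*ₗ-distribˡ _ _ _))

      supercommutator-*ʳ : ∀ p q t {A} (B : Carrierᴹ → Carrierᴹ) → IsLinear A → ∀ g →
        supercommutator p q A (λ h → t *ₗ B h) g ≈ᴹ t *ₗ supercommutator p q A B g
      supercommutator-*ʳ p q t B a g =
        ≈ᴹ-trans (+ᴹ-cong (homo-* a _ _) (*ₗ-commute _ _ _)) (≈ᴹ-sym (*ₗ-distribˡ _ _ _))

      two : ∀ {a b c d e f} → a ≈ᴹ c +ᴹ d → b ≈ᴹ e +ᴹ f → a +ᴹ b ≈ᴹ (c +ᴹ e) +ᴹ (d +ᴹ f)
      two e₁ e₂ = ≈ᴹ-trans (+ᴹ-cong e₁ e₂) (interchange _ _ _ _)

      scaled : ∀ {t a b c d} → a ≈ᴹ t *ₗ c → b ≈ᴹ t *ₗ d → a +ᴹ b ≈ᴹ t *ₗ (c +ᴹ d)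
      scaled e₁ e₂ = ≈ᴹ-trans (+ᴹ-cong e₁ e₂) (≈ᴹ-sym (*ₗ-distribˡ _ _ _))

    act-sound : ∀ {x y} → x ∼ y → ∀ p {g} → W g → ρ p x g ≈ᴹ ρ p y g
    act-sound (relation e)  p g∈ = respects e p g∈
    act-sound ∼-refl        p g∈ = ≈ᴹ-refl
    act-sound (∼-sym e)     p g∈ = ≈ᴹ-sym (act-sound e p g∈)
    act-sound (∼-trans d e) p g∈ = ≈ᴹ-trans (act-sound d p g∈) (act-sound e p g∈)
    act-sound (+-cong′ d e) p g∈ = +ᴹ-cong (act-sound d p g∈) (act-sound e p g∈)
    act-sound (*-cong′ s≈t e) p g∈ = *ₗ-cong s≈t (act-sound e p g∈)
    act-sound ([,]-cong {x} {x′} {y} {y′} d e) p {g} g∈ =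
      +ᴹ-cong (commutators 0ℙ p) (commutators 1ℙ (p ℙ.⁻¹))
      where
      commutators : ∀ q r → supercommutator q r (ρ q x) (ρ r y) g ≈ᴹ
                            supercommutator q r (ρ q x′) (ρ r y′) g
      commutators q r =
        -- The equation for the outer factor is applied to a vector already moved by the inner one.
        -- This is where stability of `W` under the action is used.
        +ᴹ-cong (≈ᴹ-trans (cong (lin q x) (act-sound e r g∈)) (act-sound d q (act∈ r y′ g∈)))
          (*ₗ-congˡ (≈ᴹ-trans (cong (lin r y) (act-sound d q g∈)) (act-sound e r (act∈ q x′ g∈))))
    act-sound (+-assoc′ x y z) p g∈ = +ᴹ-assoc _ _ _
    act-sound (+-comm′ x y)    p g∈ = +ᴹ-comm _ _
    act-sound (+-idˡ x)        p g∈ = +ᴹ-identityˡ _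
    act-sound (*-distˡ t x y)  p g∈ = *ₗ-distribˡ _ _ _
    act-sound (*-distʳ x s t)  p g∈ = *ₗ-distribʳ _ _ _
    act-sound (*-assoc′ s t x) p g∈ = *ₗ-assoc _ _ _
    act-sound (*-idˡ x)        p g∈ = *ₗ-identityˡ _
    act-sound (*-zeroˡ′ x)     p g∈ = *ₗ-zeroˡ _
    act-sound ([,]-+ˡ x y z)   p {g} g∈ =
      two (supercommutator-+ˡ 0ℙ p (ρ 0ℙ x) (ρ 0ℙ y) (lin p z) g)
          (supercommutator-+ˡ 1ℙ (p ℙ.⁻¹) (ρ 1ℙ x) (ρ 1ℙ y) (lin (p ℙ.⁻¹) z) g)
    act-sound ([,]-+ʳ x y z)   p {g} g∈ =
      two (supercommutator-+ʳ 0ℙ p (ρ p y) (ρ p z) (lin 0ℙ x) g)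
          (supercommutator-+ʳ 1ℙ (p ℙ.⁻¹) (ρ (p ℙ.⁻¹) y) (ρ (p ℙ.⁻¹) z) (lin 1ℙ x) g)
    act-sound ([,]-*ˡ t x y)   p {g} g∈ =
      scaled (supercommutator-*ˡ 0ℙ p t (ρ 0ℙ x) (lin p y) g)
             (supercommutator-*ˡ 1ℙ (p ℙ.⁻¹) t (ρ 1ℙ x) (lin (p ℙ.⁻¹) y) g)
    act-sound ([,]-*ʳ t x y)   p {g} g∈ =
      scaled (supercommutator-*ʳ 0ℙ p t (ρ p y) (lin 0ℙ x) g)
             (supercommutator-*ʳ 1ℙ (p ℙ.⁻¹) t (ρ (p ℙ.⁻¹) y) (lin 1ℙ x) g)
    act-sound (skew hx hy)      p {g} g∈ = act-skew hx hy p g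
    act-sound (jacobi hx hy hz) p {g} g∈ = act-jacobi hx hy hz p g

-- Natural numbers in the field and the coefficients of Serre chains.

module Scalars {c ℓ₁ ℓ₂ ℓ₃} (𝕂 : ScalarField c ℓ₁ ℓ₂ ℓ₃) where
  open ScalarField 𝕂 hiding (ring; zeroˡ; zeroʳ)
  open CommutativeRing commutativeRing using (ring; zeroʳ; +-monoid; +-group; +-commutativeSemigroup)
  open MonoidMult +-monoid using () renaming (×-homo-+ to ·-homo-+; ×-assocˡ to ·-assocˡ)
  open CommutativeSemigroupProperties +-commutativeSemigroup using (interchange)
  open GroupProperties +-group using (∙-cancelʳ)
  open RingProperties ring using (-1*x≈-x; -‿involutive; -‿+-comm)
  open HeytingProperties heytingCommutativeRing using (x-0≈x)
  open SetoidReasoning setoid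

  nat : ℕ → Carrier
  nat n = n · 1#

  nat-+ : ∀ m n → nat (m ℕ.+ n) ≈ nat m + nat n
  nat-+ = ·-homo-+ 1#

  private
    nat-<-absurd : ∀ {m n} → m ℕ.< n → ¬ nat m ≈ nat n
    nat-<-absurd {m} m<n eq with ℕ.m≤n⇒∃[o]m+o≡n m<n
    ... | o , ≡.refl = #-irrefl (∙-cancelʳ (nat m) _ _ (begin
      nat (suc o) + nat m   ≈⟨ nat-+ (suc o) m ⟨
      nat (suc o ℕ.+ m)     ≡⟨ ≡.cong (nat ∘ suc) (ℕ.+-comm o m) ⟩
      nat (suc m ℕ.+ o)     ≈⟨ eq ⟨
      nat m                 ≈⟨ +-identityˡ _ ⟨
      0# + nat m            ∎)) (charZero o)

  nat-injective : ∀ {m n} → nat m ≈ nat n → m ≡ n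
  nat-injective {m} {n} eq with ℕ.<-cmp m n
  ... | tri≈ _ m≡n _ = m≡n
  ... | tri< m<n _ _ = ⊥-elim (nat-<-absurd m<n eq)
  ... | tri> _ _ n<m = ⊥-elim (nat-<-absurd n<m (sym eq))

  invert : ∀ {t} → t # 0# → ∃ λ u → u * t ≈ 1#
  invert t#0 with #⇒invertible t#0
  ... | u , u*t≈1 , _ = u , trans (*-congˡ (sym (x-0≈x _))) u*t≈1

  2·nat : ∀ n → 2 · nat n ≈ nat (n ℕ.* 2)
  2·nat n = trans (·-assocˡ 1# 2 n) (reflexive (≡.cong nat (ℕ.*-comm 2 n)))

  -‿injective : ∀ {x y} → - x ≈ - y → x ≈ y
  -‿injective {x} {y} e = trans (sym (-‿involutive x)) (trans (-‿cong e) (-‿involutive y))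

  even-multiple : ∀ {a m z} → a ≈ - nat m → a ≈ 2 · fromℤ z → ∃ λ r → m ≡ r ℕ.* 2
  -- Here `- m = 2 n` with `n` natural, so `m + 2 n = 0`; characteristic 0 leaves only `m = 0`.
  even-multiple {a} {m} {+ n} a≈ a≈′ = 0 , ℕ.m+n≡0⇒m≡0 m (nat-injective {m ℕ.+ n ℕ.* 2} {0} (begin
    nat (m ℕ.+ n ℕ.* 2)   ≈⟨ nat-+ m (n ℕ.* 2) ⟩
    nat m + nat (n ℕ.* 2) ≈⟨ +-congˡ (2·nat n) ⟨
    nat m + 2 · nat n     ≈⟨ +-congˡ a≈′ ⟨
    nat m + a             ≈⟨ +-congˡ a≈ ⟩
    nat m + - nat m       ≈⟨ -‿inverseʳ _ ⟩
    0#                    ∎))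
  even-multiple {a} {m} { -[1+ n ]} a≈ a≈′ = suc n , nat-injective (-‿injective (begin
    - nat m                              ≈⟨ a≈ ⟨
    a                                    ≈⟨ a≈′ ⟩
    2 · - nat (suc n)                    ≈⟨ +-congˡ (+-identityʳ _) ⟩
    - nat (suc n) + - nat (suc n)        ≈⟨ -‿+-comm _ _ ⟩
    - (nat (suc n) + nat (suc n))        ≈⟨ -‿cong (+-congˡ (+-identityʳ _)) ⟨
    - (2 · nat (suc n))                  ≈⟨ -‿cong (2·nat (suc n)) ⟩
    - nat (suc n ℕ.* 2)                  ∎))

  -- With b = a_ii and w = - a_ij, these are the scalars in
  -- [hᵢ , (ad fᵢ)ⁿ fⱼ] = weight n (ad fᵢ)ⁿ fⱼ and
  -- [eᵢ , (ad fᵢ)ⁿ⁺¹ fⱼ] = descent (n + 1) (ad fᵢ)ⁿ fⱼ, for i of parity p.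
  module SerreScalars (p : Parity) (b w : Carrier) where
    weight : ℕ → Carrier
    weight zero    = w
    weight (suc n) = - b + weight n

    descent : ℕ → Carrier
    descent zero    = 0#
    descent (suc n) = weight n + sgn p * descent n

    module _ {m} (b≈2 : b ≈ nat 2) (w≈m : w ≈ nat m) where
      private
        -b+2≈0 : - b + nat 2 ≈ 0#
        -b+2≈0 = trans (+-congˡ (sym b≈2)) (-‿inverseˡ b)

        cancel : ∀ n {x} → x + nat n ≈ nat n → x ≈ 0#
        cancel n e = ∙-cancelʳ (nat n) _ _ (trans e (sym (+-identityˡ _)))

        weight-value : ∀ n → weight n + nat (n ℕ.* 2) ≈ nat m
        weight-value zero    = trans (+-identityʳ _) w≈m
        weight-value (suc n) = begin
          (- b + weight n) + nat (2 ℕ.+ n ℕ.* 2)        ≈⟨ +-congˡ (nat-+ 2 (n ℕ.* 2)) ⟩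
          (- b + weight n) + (nat 2 + nat (n ℕ.* 2))    ≈⟨ interchange _ _ _ _ ⟩
          (- b + nat 2) + (weight n + nat (n ℕ.* 2))    ≈⟨ +-cong -b+2≈0 (weight-value n) ⟩
          0# + nat m                                    ≈⟨ +-identityˡ _ ⟩
          nat m                                         ∎

      descent-even : p ≡ 0ℙ → descent (suc m) ≈ 0#
      descent-even ≡.refl = cancel (suc m ℕ.* suc m) (go (suc m))
        where
        square : ∀ n → suc n ℕ.* suc n ≡ n ℕ.* 2 ℕ.+ (n ℕ.* n ℕ.+ 1)
        square = solve 1 (λ n → (con 1 :+ n) :* (con 1 :+ n) := n :* con 2 :+ (n :* n :+ con 1)) ≡.refl
          where open ℕ.+-*-Solver

        shuffle : ∀ n → m ℕ.+ (n ℕ.* suc m ℕ.+ 1) ≡ suc n ℕ.* suc m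
        shuffle = solve 2 (λ m n → m :+ (n :* (con 1 :+ m) :+ con 1) := (con 1 :+ n) :* (con 1 :+ m)) ≡.refl m
          where open ℕ.+-*-Solver

        -- descent n = n (m + 1) - n², with the subtraction moved to the other side.
        go : ∀ n → descent n + nat (n ℕ.* n) ≈ nat (n ℕ.* suc m)
        go zero    = +-identityˡ _
        go (suc n) = begin
          (weight n + 1# * descent n) + nat (suc n ℕ.* suc n)
            ≈⟨ +-cong (+-congˡ (*-identityˡ _)) (reflexive (≡.cong nat (square n))) ⟩
          (weight n + descent n) + nat (n ℕ.* 2 ℕ.+ (n ℕ.* n ℕ.+ 1))
            ≈⟨ +-congˡ (nat-+ (n ℕ.* 2) (n ℕ.* n ℕ.+ 1)) ⟩
          (weight n + descent n) + (nat (n ℕ.* 2) + nat (n ℕ.* n ℕ.+ 1))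
            ≈⟨ interchange _ _ _ _ ⟩
          (weight n + nat (n ℕ.* 2)) + (descent n + nat (n ℕ.* n ℕ.+ 1))
            ≈⟨ +-cong (weight-value n) (+-congˡ (nat-+ (n ℕ.* n) 1)) ⟩
          nat m + (descent n + (nat (n ℕ.* n) + nat 1))
            ≈⟨ +-congˡ (+-assoc _ _ _) ⟨
          nat m + ((descent n + nat (n ℕ.* n)) + nat 1)
            ≈⟨ +-congˡ (+-congʳ (go n)) ⟩
          nat m + (nat (n ℕ.* suc m) + nat 1)
            ≈⟨ +-congˡ (nat-+ (n ℕ.* suc m) 1) ⟨
          nat m + nat (n ℕ.* suc m ℕ.+ 1)
            ≈⟨ nat-+ m _ ⟨
          nat (m ℕ.+ (n ℕ.* suc m ℕ.+ 1))
            ≡⟨ ≡.cong nat (shuffle n) ⟩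
          nat (suc n ℕ.* suc m) ∎

      -- The case of `osp(1|2)`: the alternating sign cancels the weights in pairs, so two steps
      -- change `descent` by `- b = - 2`. Starting from `descent 1 = m`, the odd steps reach 0 at
      -- step `m + 1` because `m` is even.
      descent-odd : p ≡ 1ℙ → (∃ λ r → m ≡ r ℕ.* 2) → descent (suc m) ≈ 0#
      descent-odd ≡.refl (r , ≡.refl) = cancel (r ℕ.* 2) (go r)
        where
        two-steps : ∀ n → descent (2 ℕ.+ n) ≈ - b + descent n
        two-steps n = begin
          (- b + weight n) + - 1# * (weight n + - 1# * descent n)
            ≈⟨ +-congˡ (trans (-1*x≈-x _) (sym (-‿+-comm _ _))) ⟩
          (- b + weight n) + (- weight n + - (- 1# * descent n))
            ≈⟨ +-congˡ (+-congˡ (trans (-‿cong (-1*x≈-x _)) (-‿involutive _))) ⟩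
          (- b + weight n) + (- weight n + descent n)
            ≈⟨ +-assoc _ _ _ ⟩
          - b + (weight n + (- weight n + descent n))
            ≈⟨ +-congˡ (+-assoc _ _ _) ⟨
          - b + ((weight n + - weight n) + descent n)
            ≈⟨ +-congˡ (trans (+-congʳ (-‿inverseʳ _)) (+-identityˡ _)) ⟩
          - b + descent n ∎

        -- descent (2k + 1) = m - 2k
        go : ∀ k → descent (suc (k ℕ.* 2)) + nat (k ℕ.* 2) ≈ nat m
        go zero    = begin
          (w + - 1# * 0#) + 0# ≈⟨ +-identityʳ _ ⟩
          w + - 1# * 0#        ≈⟨ +-congˡ (zeroʳ _) ⟩
          w + 0#               ≈⟨ +-identityʳ _ ⟩
          w                    ≈⟨ w≈m ⟩
          nat m                ∎
        go (suc k) = begin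
          descent (2 ℕ.+ suc (k ℕ.* 2)) + nat (2 ℕ.+ k ℕ.* 2)
            ≈⟨ +-cong (two-steps (suc (k ℕ.* 2))) (nat-+ 2 (k ℕ.* 2)) ⟩
          (- b + descent (suc (k ℕ.* 2))) + (nat 2 + nat (k ℕ.* 2))
            ≈⟨ interchange _ _ _ _ ⟩
          (- b + nat 2) + (descent (suc (k ℕ.* 2)) + nat (k ℕ.* 2))
            ≈⟨ +-cong -b+2≈0 (go k) ⟩
          0# + nat m
            ≈⟨ +-identityˡ _ ⟩
          nat m ∎

-- Identities in a presented Lie superalgebra.

module LieCalculus {c ℓ₁ ℓ₂ ℓ₃ r} (𝕂 : ScalarField c ℓ₁ ℓ₂ ℓ₃) (P : Presentation 𝕂 r) where
  open ScalarField 𝕂 hiding (zeroˡ; zeroʳ; ring)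
  open Scalars 𝕂
  open Presented 𝕂 P
  open LeftModule whole using (≈ᴹ-setoid)
  open Action 𝕂 whole using (*ₗ-commute; *ₗ-zero; +ᴹ-zeros) public
  open SetoidReasoning ≈ᴹ-setoid

  +-idʳ : ∀ x → x +ᵗ 0ᵗ ∼ x
  +-idʳ x = ∼-trans (+-comm′ x 0ᵗ) (+-idˡ x)

  *-zero-scalar : ∀ {t} x → t ≈ 0# → t *ᵗ x ∼ 0ᵗ
  *-zero-scalar x t≈0 = ∼-trans (*-cong′ t≈0 ∼-refl) (*-zeroˡ′ x)

  *-cancel : ∀ {t x} → t # 0# → t *ᵗ x ∼ 0ᵗ → x ∼ 0ᵗ
  *-cancel {t} {x} t#0 tx∼0 with invert t#0
  ... | u , u*t≈1 = begin
    x              ≈⟨ *-idˡ x ⟨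
    1# *ᵗ x        ≈⟨ *-cong′ (sym u*t≈1) ∼-refl ⟩
    (u * t) *ᵗ x   ≈⟨ *-assoc′ u t x ⟩
    u *ᵗ (t *ᵗ x)  ≈⟨ *ₗ-zero u tx∼0 ⟩
    0ᵗ             ∎

  nat-*-suc : ∀ n x → nat (suc n) *ᵗ x ∼ x +ᵗ nat n *ᵗ x
  nat-*-suc n x = ∼-trans (*-distʳ x 1# (nat n)) (+-cong′ (*-idˡ x) ∼-refl)

  neg-inverseʳ : ∀ x → x +ᵗ -ᵗ x ∼ 0ᵗ
  neg-inverseʳ x = ∼-trans (+-comm′ x (-ᵗ x)) (-ᵗ-inverseˡ x)

  move : ∀ {x y z} → x ∼ y +ᵗ -ᵗ z → x +ᵗ z ∼ y
  move {x} {y} {z} e = begin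
    x +ᵗ z              ≈⟨ +-cong′ e ∼-refl ⟩
    (y +ᵗ -ᵗ z) +ᵗ z    ≈⟨ +-assoc′ y (-ᵗ z) z ⟩
    y +ᵗ (-ᵗ z +ᵗ z)    ≈⟨ +-cong′ ∼-refl (-ᵗ-inverseˡ z) ⟩
    y +ᵗ 0ᵗ             ≈⟨ +-idʳ y ⟩
    y                   ∎

  subtract-zero : ∀ {x y} → x +ᵗ -ᵗ y ∼ 0ᵗ → x ∼ y
  subtract-zero {x} {y} e = begin
    x                   ≈⟨ +-idʳ x ⟨
    x +ᵗ 0ᵗ             ≈⟨ +-cong′ ∼-refl (-ᵗ-inverseˡ y) ⟨
    x +ᵗ (-ᵗ y +ᵗ y)    ≈⟨ +-assoc′ x (-ᵗ y) y ⟨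
    (x +ᵗ -ᵗ y) +ᵗ y    ≈⟨ +-cong′ e ∼-refl ⟩
    0ᵗ +ᵗ y             ≈⟨ +-idˡ y ⟩
    y                   ∎

  -- The Jacobi identity in the form in which `act` treats brackets: `ad` of a bracket is the
  -- supercommutator of the two `ad`s.
  jacobi′ : ∀ {p q r x y z} → HasParity p x → HasParity q y → HasParity r z →
    [ x , [ y , z ] ] +ᵗ (- sgn (p ℙ.* q)) *ᵗ [ y , [ x , z ] ] ∼ [ [ x , y ] , z ]
  jacobi′ {p} {q} {x = x} {y} {z} hx hy hz = begin
    [ x , [ y , z ] ] +ᵗ (- σ) *ᵗ v             ≈⟨ +-cong′ (jacobi hx hy hz) ∼-refl ⟩
    ([ [ x , y ] , z ] +ᵗ σ *ᵗ v) +ᵗ (- σ) *ᵗ v ≈⟨ +-assoc′ _ _ _ ⟩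
    [ [ x , y ] , z ] +ᵗ (σ *ᵗ v +ᵗ (- σ) *ᵗ v) ≈⟨ +-cong′ ∼-refl (*-distʳ v σ (- σ)) ⟨
    [ [ x , y ] , z ] +ᵗ (σ + - σ) *ᵗ v         ≈⟨ +-cong′ ∼-refl (*-cong′ (-‿inverseʳ σ) ∼-refl) ⟩
    [ [ x , y ] , z ] +ᵗ 0# *ᵗ v                ≈⟨ +-cong′ ∼-refl (*-zeroˡ′ v) ⟩
    [ [ x , y ] , z ] +ᵗ 0ᵗ                     ≈⟨ +-idʳ _ ⟩
    [ [ x , y ] , z ]                           ∎
    where
    σ : Carrier
    σ = sgn (p ℙ.* q)
    v : Elt
    v = [ y , [ x , z ] ]

  [,]-0ˡ : ∀ {x} y → x ∼ 0ᵗ → [ x , y ] ∼ 0ᵗ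
  [,]-0ˡ {x} y x∼0 = begin
    [ x , y ]         ≈⟨ [,]-cong (∼-trans x∼0 (∼-sym (*-zeroˡ′ 0ᵗ))) ∼-refl ⟩
    [ 0# *ᵗ 0ᵗ , y ]  ≈⟨ [,]-*ˡ 0# 0ᵗ y ⟩
    0# *ᵗ [ 0ᵗ , y ]  ≈⟨ *-zeroˡ′ _ ⟩
    0ᵗ                ∎

  [,]-0ʳ : ∀ x {y} → y ∼ 0ᵗ → [ x , y ] ∼ 0ᵗ
  [,]-0ʳ x {y} y∼0 = begin
    [ x , y ]         ≈⟨ [,]-cong ∼-refl (∼-trans y∼0 (∼-sym (*-zeroˡ′ 0ᵗ))) ⟩
    [ x , 0# *ᵗ 0ᵗ ]  ≈⟨ [,]-*ʳ 0# x 0ᵗ ⟩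
    0# *ᵗ [ x , 0ᵗ ]  ≈⟨ *-zeroˡ′ _ ⟩
    0ᵗ                ∎

  ad-cong : ∀ x n {y z} → y ∼ z → (ad_^_$_ 𝕂 x n y) ∼ (ad_^_$_ 𝕂 x n z)
  ad-cong x zero    e = e
  ad-cong x (suc n) e = [,]-cong ∼-refl (ad-cong x n e)

  ad-* : ∀ x n t y → (ad_^_$_ 𝕂 x n (t *ᵗ y)) ∼ t *ᵗ (ad_^_$_ 𝕂 x n y)
  ad-* x zero    t y = ∼-refl
  ad-* x (suc n) t y = ∼-trans ([,]-cong ∼-refl (ad-* x n t y)) ([,]-*ʳ t x _)

  ad-0 : ∀ x n {y} → y ∼ 0ᵗ → (ad_^_$_ 𝕂 x n y) ∼ 0ᵗ
  ad-0 x zero    e = e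
  ad-0 x (suc n) e = [,]-0ʳ x (ad-0 x n e)

  ad-parity : ∀ {p q x y} → HasParity p x → HasParity q y → ∀ n →
              ∃ λ s → HasParity s (ad_^_$_ 𝕂 x n y)
  ad-parity hx hy zero    = _ , hy
  ad-parity hx hy (suc n) = _ , [_,_] hx (proj₂ (ad-parity hx hy n)) {≡.refl}

  -- Skew symmetry makes the square its own negative, and 2 is invertible.
  even-square : ∀ {x} → HasParity 0ℙ x → [ x , x ] ∼ 0ᵗ
  even-square {x} hx = *-cancel (charZero 1) (begin
    nat 2 *ᵗ s                   ≈⟨ nat-*-suc 1 s ⟩
    s +ᵗ nat 1 *ᵗ s              ≈⟨ +-cong′ ∼-refl (nat-*-suc 0 s) ⟩
    s +ᵗ (s +ᵗ 0# *ᵗ s)          ≈⟨ +-cong′ ∼-refl (+-cong′ ∼-refl (*-zeroˡ′ s)) ⟩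
    s +ᵗ (s +ᵗ 0ᵗ)               ≈⟨ +-cong′ (skew hx hx) (+-idʳ s) ⟩
    -ᵗ s +ᵗ s                    ≈⟨ -ᵗ-inverseˡ s ⟩
    0ᵗ                           ∎)
    where
    s : Elt
    s = [ x , x ]

  odd-square : ∀ {s x y} → HasParity 1ℙ x → HasParity s y →
               [ [ x , x ] , y ] ∼ [ x , [ x , y ] ] +ᵗ [ x , [ x , y ] ]
  odd-square {x = x} {y} hx hy = ∼-sym (move (jacobi hx hx hy))

  -- With `s = [x,[x,x]]`, Jacobi gives `[[x,x],x] = 2 s` and skew symmetry gives `[[x,x],x] = - s`.
  -- Hence `3 s = 0`.
  odd-cube : ∀ {x} → HasParity 1ℙ x → [ x , [ x , x ] ] ∼ 0ᵗ
  odd-cube {x} hx = *-cancel (charZero 2) (begin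
    nat 3 *ᵗ s                          ≈⟨ nat-*-suc 2 s ⟩
    s +ᵗ nat 2 *ᵗ s                     ≈⟨ +-cong′ ∼-refl (nat-*-suc 1 s) ⟩
    s +ᵗ (s +ᵗ nat 1 *ᵗ s)              ≈⟨ +-cong′ ∼-refl (+-cong′ ∼-refl (nat-*-suc 0 s)) ⟩
    s +ᵗ (s +ᵗ (s +ᵗ 0# *ᵗ s))          ≈⟨ +-cong′ ∼-refl (+-cong′ ∼-refl (+-cong′ ∼-refl (*-zeroˡ′ s))) ⟩
    s +ᵗ (s +ᵗ (s +ᵗ 0ᵗ))               ≈⟨ +-cong′ ∼-refl (+-cong′ ∼-refl (+-idʳ s)) ⟩
    s +ᵗ (s +ᵗ s)                       ≈⟨ +-cong′ ∼-refl (odd-square hx hx) ⟨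
    s +ᵗ [ [ x , x ] , x ]              ≈⟨ +-cong′ ∼-refl (skew ([_,_] hx hx {≡.refl}) hx) ⟩
    s +ᵗ -ᵗ s                           ≈⟨ neg-inverseʳ s ⟩
    0ᵗ                                  ∎)
    where
    s : Elt
    s = [ x , [ x , x ] ]

  -- For odd `x` the operator `ad [x,x]` is twice the square of `ad x`, so the witness is `2ⁿ`.
  ad-square : ∀ {q x y} → HasParity 1ℙ x → HasParity q y → ∀ n →
              ∃ λ t → (ad_^_$_ 𝕂 [ x , x ] n y) ∼ t *ᵗ (ad_^_$_ 𝕂 x (n ℕ.* 2) y)
  ad-square {x = x} {y} hx hy zero    = 1# , ∼-sym (*-idˡ y)
  ad-square {x = x} {y} hx hy (suc n) with ad-square hx hy n
  ... | t , e = t * nat 2 , (begin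
    [ [ x , x ] , (ad_^_$_ 𝕂 [ x , x ] n y) ]          ≈⟨ [,]-cong ∼-refl e ⟩
    [ [ x , x ] , t *ᵗ z ]                            ≈⟨ [,]-*ʳ t _ z ⟩
    t *ᵗ [ [ x , x ] , z ]                            ≈⟨ *-cong′ refl (odd-square hx (proj₂ (ad-parity hx hy (n ℕ.* 2)))) ⟩
    t *ᵗ (w +ᵗ w)                                     ≈⟨ *-cong′ refl (+-cong′ ∼-refl (+-idʳ w)) ⟨
    t *ᵗ (w +ᵗ (w +ᵗ 0ᵗ))                             ≈⟨ *-cong′ refl (+-cong′ ∼-refl (+-cong′ ∼-refl (*-zeroˡ′ w))) ⟨
    t *ᵗ (w +ᵗ (w +ᵗ 0# *ᵗ w))                        ≈⟨ *-cong′ refl (+-cong′ ∼-refl (nat-*-suc 0 w)) ⟨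
    t *ᵗ (w +ᵗ nat 1 *ᵗ w)                            ≈⟨ *-cong′ refl (nat-*-suc 1 w) ⟨
    t *ᵗ (nat 2 *ᵗ w)                                 ≈⟨ *-assoc′ t _ w ⟨
    (t * nat 2) *ᵗ w                                  ∎)
    where
    z w : Elt
    z = ad_^_$_ 𝕂 x (n ℕ.* 2) y
    w = [ x , [ x , z ] ]

-- Monomials, relators, degrees and words.

module _ {c ℓ₁ ℓ₂ ℓ₃} (𝕂 : ScalarField c ℓ₁ ℓ₂ ℓ₃) where

  -- Monomials have a definite parity and, once mapped to the `eᵢ` or `fᵢ`, are eigenvectors of
  -- every `hₗ`. All relators and all words are of this kind.
  data Monomial {X : Set} : Pred (Term 𝕂 X) c where
    gen   : ∀ x → Monomial (gen x)
    [_,_] : ∀ {x y} → Monomial x → Monomial y → Monomial [ x , y ]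

  ad-monomial : ∀ {X} {x y : Term 𝕂 X} → Monomial x → Monomial y → ∀ n → Monomial (ad_^_$_ 𝕂 x n y)
  ad-monomial mx my zero    = my
  ad-monomial mx my (suc n) = [ mx , ad-monomial mx my n ]

  mapᵗ-ad : ∀ {X Y} (f : X → Y) x n y →
            mapᵗ 𝕂 f (ad_^_$_ 𝕂 x n y) ≡ ad_^_$_ 𝕂 (mapᵗ 𝕂 f x) n (mapᵗ 𝕂 f y)
  mapᵗ-ad f x zero    y = ≡.refl
  mapᵗ-ad f x (suc n) y = ≡.cong [ mapᵗ 𝕂 f x ,_] (mapᵗ-ad f x n y)

module _ {c ℓ₁ ℓ₂ ℓ₃} {𝕂 : ScalarField c ℓ₁ ℓ₂ ℓ₃} {s : IndexSet} (A : BKMSupermatrix 𝕂 s) where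
  open ScalarField 𝕂
  open BKM 𝕂 A using (I; a; Iʳᵉ; Ψ₀)

  -- The Serre elements of type oddReal are left out, since they lie in the
  -- ideal generated by the others: (ad [eᵢ,eᵢ])ⁿ = 2ⁿ (ad eᵢ)²ⁿ.
  data CoreRelator : Pred (Term 𝕂 I) (c ⊔ ℓ₁) where
    real    : ∀ {i j} m → Iʳᵉ i → i ≢ j → a i j ≈ - (m · 1#) →
              CoreRelator (ad_^_$_ 𝕂 (gen i) (suc m) (gen j))
    null    : ∀ {i} → Ψ₀ i → CoreRelator [ gen i , gen i ]
    commute : ∀ {i j} → i ≢ j → a i j ≈ 0# → CoreRelator [ gen i , gen j ]

  relator-monomial : ∀ {x} → CoreRelator x → Monomial 𝕂 x
  relator-monomial (real m _ _ _) = ad-monomial 𝕂 (gen _) (gen _) (suc m)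
  relator-monomial (null _)       = [ gen _ , gen _ ]
  relator-monomial (commute _ _)  = [ gen _ , gen _ ]

module Multidegree {c ℓ₁ ℓ₂ ℓ₃} {𝕂 : ScalarField c ℓ₁ ℓ₂ ℓ₃} {s : IndexSet} (A : BKMSupermatrix 𝕂 s) where
  open BKM 𝕂 A using (I; multidegree)

  δ : I → I → ℕ
  δ i j = at (multidegree j) i

  δ-≡ : ∀ i → δ i i ≡ 1
  δ-≡ i with index-≟ s i i
  ... | yes _ = ≡.refl
  ... | no i≢i = ⊥-elim (i≢i ≡.refl)

  count : I → List I → ℕ
  count i []      = 0
  count i (j ∷ w) = δ i j ℕ.+ count i w

  DegreeIn : I → ℕ → Term 𝕂 I → Set c
  DegreeIn i = Homogeneous 𝕂 ℕ.+-0-commutativeMonoid (δ i)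

  coordinate : ∀ i {k x} → Homogeneous 𝕂 ℤ₊[ I ] multidegree k x → DegreeIn i (at k i) x
  coordinate i (gen eq)           = gen (eq i)
  coordinate i 0ᵗ                 = 0ᵗ
  coordinate i (x +ᵗ y)           = coordinate i x +ᵗ coordinate i y
  coordinate i (t *ᵗ x)           = t *ᵗ coordinate i x
  coordinate i ([_,_] x y {eq})   = [_,_] (coordinate i x) (coordinate i y) {eq i}

  Bounded : (I → ℕ) → List I → Set
  Bounded k w = ∀ i → count i w ≤ k i

  private
    count-zero : ∀ i w → count i w ≡ 0 ⊎ i ∈ w
    count-zero i []      = inj₁ ≡.refl
    count-zero i (j ∷ w) with index-≟ s j i
    ... | yes ≡.refl = inj₂ (here ≡.refl)
    ... | no _ with count-zero i w
    ...   | inj₁ eq = inj₁ eq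
    ...   | inj₂ i∈ = inj₂ (there i∈)

  -- The index set may be infinite, but an index that does not occur in `w` has count 0. Testing the
  -- letters of `w` is enough.
  bounded? : ∀ k w → Dec (Bounded k w)
  bounded? k w = map′ everywhere (λ bounded → All.universal bounded w) (all? (λ i → count i w ℕ.≤? k i) w)
    where
    everywhere : All (λ i → count i w ≤ k i) w → Bounded k w
    everywhere bounded i with count-zero i w
    ... | inj₁ eq = ≡.subst (_≤ k i) (≡.sym eq) z≤n
    ... | inj₂ i∈ = All.lookup bounded i∈

  count-swap : ∀ i u {j l} w → count i (u ++ j ∷ l ∷ w) ≡ count i (u ++ l ∷ j ∷ w)
  count-swap i []      {j} {l} w = begin
    δ i j ℕ.+ (δ i l ℕ.+ count i w) ≡⟨ ℕ.+-assoc (δ i j) _ _ ⟨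
    (δ i j ℕ.+ δ i l) ℕ.+ count i w ≡⟨ ≡.cong (ℕ._+ count i w) (ℕ.+-comm (δ i j) (δ i l)) ⟩
    (δ i l ℕ.+ δ i j) ℕ.+ count i w ≡⟨ ℕ.+-assoc (δ i l) _ _ ⟩
    δ i l ℕ.+ (δ i j ℕ.+ count i w) ∎
    where open ≡.≡-Reasoning
  count-swap i (m ∷ u) w = ≡.cong (δ i m ℕ.+_) (count-swap i u w)

  count-++ : ∀ i u w → count i w ≤ count i (u ++ w)
  count-++ i []      w = ℕ.≤-refl
  count-++ i (j ∷ u) w = ℕ.≤-trans (count-++ i u w) (ℕ.m≤n+m _ (δ i j))

module Span {c ℓ₁ ℓ₂ ℓ₃ r} (𝕂 : ScalarField c ℓ₁ ℓ₂ ℓ₃) (P : Presentation 𝕂 r) where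
  open Presented 𝕂 P hiding (0∈; +∈; *∈)
  open LieCalculus 𝕂 P

  data Spanned {b} (B : Pred Elt b) : Pred Elt (c ⊔ ℓ₁ ⊔ r ⊔ b) where
    incl : ∀ {x} → B x → Spanned B x
    0∈   : Spanned B 0ᵗ
    +∈   : ∀ {x y} → Spanned B x → Spanned B y → Spanned B (x +ᵗ y)
    *∈   : ∀ t {x} → Spanned B x → Spanned B (t *ᵗ x)
    resp : ∀ {x y} → x ∼ y → Spanned B x → Spanned B y

  zero∈ : ∀ {b} {B : Pred Elt b} {x} → x ∼ 0ᵗ → Spanned B x
  zero∈ x∼0 = resp (∼-sym x∼0) 0∈

  span-bracket : ∀ {b b′} {B : Pred Elt b} {B′ : Pred Elt b′} x →
                 (∀ {y} → B y → Spanned B′ [ x , y ]) → ∀ {y} → Spanned B y → Spanned B′ [ x , y ]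
  span-bracket x f (incl y∈)      = f y∈
  span-bracket x f 0∈             = zero∈ ([,]-0ʳ x ∼-refl)
  span-bracket x f (+∈ y∈ z∈)     = resp (∼-sym ([,]-+ʳ x _ _)) (+∈ (span-bracket x f y∈) (span-bracket x f z∈))
  span-bracket x f (*∈ t y∈)      = resp (∼-sym ([,]-*ʳ t x _)) (*∈ t (span-bracket x f y∈))
  span-bracket x f (resp y∼z y∈)  = resp ([,]-cong ∼-refl y∼z) (span-bracket x f y∈)

  span-bind : ∀ {b b′} {B : Pred Elt b} {B′ : Pred Elt b′} →
              (∀ {y} → B y → Spanned B′ y) → ∀ {y} → Spanned B y → Spanned B′ y
  span-bind f (incl y∈)     = f y∈
  span-bind f 0∈            = 0∈
  span-bind f (+∈ y∈ z∈)    = +∈ (span-bind f y∈) (span-bind f z∈)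
  span-bind f (*∈ t y∈)     = *∈ t (span-bind f y∈)
  span-bind f (resp y∼z y∈) = resp y∼z (span-bind f y∈)

module Words {c ℓ₁ ℓ₂ ℓ₃} {𝕂 : ScalarField c ℓ₁ ℓ₂ ℓ₃} {s : IndexSet} (A : BKMSupermatrix 𝕂 s) where
  open BKM 𝕂 A using (I; multidegree)
  open CommutativeMonoid ℤ₊[ I ] using (_∙_) renaming (Carrier to Degree)

  -- Right-normed brackets with innermost letter `i`. They suffice for spanning, since by Jacobi
  -- bracketing with a term reduces to repeated bracketing with generators.
  word : I → List I → Term 𝕂 I
  word i []      = gen i
  word i (j ∷ w) = [ gen j , word i w ]

  wordDegree : I → List I → Degree
  wordDegree i []      = multidegree i
  wordDegree i (j ∷ w) = multidegree j ∙ wordDegree i w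

  word-monomial : ∀ i w → Monomial 𝕂 (word i w)
  word-monomial i []      = gen i
  word-monomial i (j ∷ w) = [ gen j , word-monomial i w ]

  word-homogeneous : ∀ {k} i w → (∀ l → at k l ≡ at (wordDegree i w) l) →
                     Homogeneous 𝕂 ℤ₊[ I ] multidegree k (word i w)
  word-homogeneous i []      k≡ = gen k≡
  word-homogeneous i (j ∷ w) k≡ = [_,_] {g = multidegree j} {wordDegree i w} (gen λ _ → ≡.refl) (word-homogeneous i w λ _ → ≡.refl) {k≡}

-- Relators and words under a Chevalley triple.

private
  +-cancels : ∀ b d → b ℤ.+ (ℤ.- b ℤ.+ d) ≡ d
  +-cancels b d = ≡.trans (≡.sym (ℤ.+-assoc b (ℤ.- b) d))
    (≡.trans (≡.cong (ℤ._+ d) (ℤ.+-inverseʳ b)) (ℤ.+-identityˡ d))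

  +-transposes : ∀ b g n d → b ℤ.+ g ≡ n ℤ.+ d → g ≡ n ℤ.+ (ℤ.- b ℤ.+ d)
  +-transposes b g n d eq = ∙-cancelˡ b _ _ (begin
    b ℤ.+ g                        ≡⟨ eq ⟩
    n ℤ.+ d                        ≡⟨ ≡.cong (λ z → n ℤ.+ z) (+-cancels b d) ⟨
    n ℤ.+ (b ℤ.+ (ℤ.- b ℤ.+ d))    ≡⟨ ℤ.+-assoc n b _ ⟨
    (n ℤ.+ b) ℤ.+ (ℤ.- b ℤ.+ d)    ≡⟨ ≡.cong (ℤ._+ (ℤ.- b ℤ.+ d)) (ℤ.+-comm n b) ⟩
    (b ℤ.+ n) ℤ.+ (ℤ.- b ℤ.+ d)    ≡⟨ ℤ.+-assoc b n _ ⟩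
    b ℤ.+ (n ℤ.+ (ℤ.- b ℤ.+ d))    ∎)
    where
    open ≡.≡-Reasoning
    open GroupProperties (AbelianGroup.group ℤ.+-0-abelianGroup) using (∙-cancelˡ)

-- The raising elements `X` and the Cartan elements `K` are terms, because the instance for 𝔫₊ takes
-- sign multiples of the `fᵢ` and `hᵢ`. The `y` are generators, so that terms over `I` can be
-- transported along `mapᵗ`.
module ChevalleyCalculus
  {c ℓ₁ ℓ₂ ℓ₃ r} (𝕂 : ScalarField c ℓ₁ ℓ₂ ℓ₃) {s : IndexSet} (A : BKMSupermatrix 𝕂 s)
  (P : Presentation 𝕂 r)
  (X : ⟦ s ⟧ → Presented.Elt 𝕂 P)
  (y : ⟦ s ⟧ → Presentation.Generator P)
  (K : ⟦ s ⟧ → Presented.Elt 𝕂 P)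
  (X-parity : ∀ i → Presented.HasParity 𝕂 P (BKM.parityOf 𝕂 A i) (X i))
  (y-parity : ∀ i → Presentation.parity P (y i) ≡ BKM.parityOf 𝕂 A i)
  (K-parity : ∀ i → Presented.HasParity 𝕂 P 0ℙ (K i))
  (XY-≡ : ∀ i → Presented._∼_ 𝕂 P [ X i , gen (y i) ] (K i))
  (XY-≢ : ∀ {i j} → i ≢ j → Presented._∼_ 𝕂 P [ X i , gen (y j) ] 0ᵗ)
  (KY : ∀ i j → Presented._∼_ 𝕂 P [ K i , gen (y j) ]
                  (ScalarField.-_ 𝕂 (BKMSupermatrix.a A i j) *ᵗ gen (y j)))
  where
  open ScalarField 𝕂 hiding (zeroˡ; zeroʳ; ring)
  open CommutativeRing commutativeRing using (ring)
  open RingProperties ring using (-0#≈0#; -‿involutive; -1*x≈-x)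
  open Scalars 𝕂
  open BKM 𝕂 A using (I; a; Ψ; Ψ?; Iʳᵉ; parityOf; zeroPattern; evenIntegral)
  open Presented 𝕂 P
  open LieCalculus 𝕂 P
  open LeftModule whole using (≈ᴹ-setoid)
  open SetoidReasoning ≈ᴹ-setoid

  Y : I → Elt
  Y i = gen (y i)

  Y-parity : ∀ i → HasParity (parityOf i) (Y i)
  Y-parity i = gen (≡.sym (y-parity i))

  infix 8 adY_^_$_
  adY_^_$_ : I → ℕ → Elt → Elt
  adY i ^ n $ z = ad_^_$_ 𝕂 (Y i) n z

  image-parity : ∀ {x} → Monomial 𝕂 x → ∃ λ p → HasParity p (mapᵗ 𝕂 y x)
  image-parity (gen i)   = _ , Y-parity i
  image-parity [ mx , my ] with image-parity mx | image-parity my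
  ... | _ , hx | _ , hy = _ , [_,_] hx hy {≡.refl}

  K-bracket : ∀ l {p q u v κ μ} → HasParity p u → HasParity q v →
              [ K l , u ] ∼ κ *ᵗ u → [ K l , v ] ∼ μ *ᵗ v →
              [ K l , [ u , v ] ] ∼ (κ + μ) *ᵗ [ u , v ]
  K-bracket l {u = u} {v} {κ} {μ} hu hv eu ev = begin
    [ K l , [ u , v ] ]                              ≈⟨ jacobi (K-parity l) hu hv ⟩
    [ [ K l , u ] , v ] +ᵗ 1# *ᵗ [ u , [ K l , v ] ] ≈⟨ +-cong′ ([,]-cong eu ∼-refl) (*-idˡ _) ⟩
    [ κ *ᵗ u , v ] +ᵗ [ u , [ K l , v ] ]            ≈⟨ +-cong′ ([,]-*ˡ κ u v) (∼-trans ([,]-cong ∼-refl ev) ([,]-*ʳ μ u v)) ⟩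
    κ *ᵗ [ u , v ] +ᵗ μ *ᵗ [ u , v ]                 ≈⟨ *-distʳ _ κ μ ⟨
    (κ + μ) *ᵗ [ u , v ]                             ∎

  K-eigen : ∀ l {x} → Monomial 𝕂 x → ∃ λ κ → [ K l , mapᵗ 𝕂 y x ] ∼ κ *ᵗ mapᵗ 𝕂 y x
  K-eigen l (gen i)     = - a l i , KY l i
  K-eigen l [ mx , my ] =
    _ , K-bracket l (proj₂ (image-parity mx)) (proj₂ (image-parity my))
                    (proj₂ (K-eigen l mx)) (proj₂ (K-eigen l my))

  Y-K : ∀ i l → [ Y i , K l ] ∼ a l i *ᵗ Y i
  Y-K i l = begin
    [ Y i , K l ]                        ≈⟨ skew (Y-parity i) (K-parity l) ⟩
    (- sgn (parityOf i ℙ.* 0ℙ)) *ᵗ [ K l , Y i ]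
      ≡⟨ ≡.cong (λ p → (- sgn p) *ᵗ [ K l , Y i ]) (ℙ.*-zeroʳ (parityOf i)) ⟩
    (- 1#) *ᵗ [ K l , Y i ]              ≈⟨ *-cong′ refl (KY l i) ⟩
    (- 1#) *ᵗ ((- a l i) *ᵗ Y i)         ≈⟨ *-assoc′ _ _ _ ⟨
    ((- 1#) * (- a l i)) *ᵗ Y i          ≈⟨ *-cong′ (trans (-1*x≈-x _) (-‿involutive _)) ∼-refl ⟩
    a l i *ᵗ Y i                         ∎

  X-bracket-≢ : ∀ {l i q z} → l ≢ i → HasParity q z →
    [ X l , [ Y i , z ] ] ∼ sgn (parityOf l ℙ.* parityOf i) *ᵗ [ Y i , [ X l , z ] ]
  X-bracket-≢ {z = z} l≢i hz =
    ∼-trans (jacobi (X-parity _) (Y-parity _) hz)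
      (∼-trans (+-cong′ ([,]-0ˡ z (XY-≢ l≢i)) ∼-refl) (+-idˡ _))

  X-bracket-≡ : ∀ {i q z} → HasParity q z →
    [ X i , [ Y i , z ] ] ∼ [ K i , z ] +ᵗ sgn (parityOf i) *ᵗ [ Y i , [ X i , z ] ]
  X-bracket-≡ {i} {z = z} hz =
    ∼-trans (jacobi (X-parity i) (Y-parity i) hz)
      (+-cong′ ([,]-cong (XY-≡ i) ∼-refl)
               (*-cong′ (reflexive (≡.cong sgn (ℙ.*-idem (parityOf i)))) ∼-refl))

  -- For `l ≢ i` the elements `X l` and `Y i` supercommute, so `X l` moves through every `ad Y i` at
  -- the cost of a sign; `t` collects these signs.
  X-ad-≢ : ∀ {l i q z} → l ≢ i → HasParity q z → ∀ n →
           ∃ λ t → [ X l , adY i ^ n $ z ] ∼ t *ᵗ (adY i ^ n $ [ X l , z ])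
  X-ad-≢ l≢i hz zero = 1# , ∼-sym (*-idˡ _)
  X-ad-≢ {l} {i} l≢i hz (suc n) with X-ad-≢ {l} {i} l≢i hz n
  ... | t , e = sgn (parityOf l ℙ.* parityOf i) * t , ∼-trans
    (X-bracket-≢ l≢i (proj₂ (ad-parity (Y-parity i) hz n)))
    (∼-trans (*-cong′ refl (∼-trans ([,]-cong ∼-refl e) ([,]-*ʳ t _ _))) (∼-sym (*-assoc′ _ t _)))

  X-ad-≢-vanishes : ∀ {l i q z} → l ≢ i → HasParity q z → ∀ n →
    (adY i ^ n $ [ X l , z ]) ∼ 0ᵗ → [ X l , adY i ^ n $ z ] ∼ 0ᵗ
  X-ad-≢-vanishes l≢i hz n e =
    ∼-trans (proj₂ (X-ad-≢ l≢i hz n)) (*ₗ-zero _ e)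

  module _ (i j : I) where
    open SerreScalars (parityOf i) (a i i) (- a i j)

    private
      chain-parity : ∀ n → ∃ λ p → HasParity p (adY i ^ n $ Y j)
      chain-parity = ad-parity (Y-parity i) (Y-parity j)

    K-chain : ∀ n → [ K i , adY i ^ n $ Y j ] ∼ weight n *ᵗ (adY i ^ n $ Y j)
    K-chain zero    = KY i j
    K-chain (suc n) = K-bracket i (Y-parity i) (proj₂ (chain-parity n)) (KY i i) (K-chain n)

    -- Moving `X i` past the outermost `Y i` leaves `K i`, which contributes the weight of the
    -- remaining chain, plus a signed copy of the previous step. This is the recursion that defines
    -- `descent`.
    X-chain : i ≢ j → ∀ n → [ X i , adY i ^ suc n $ Y j ] ∼ descent (suc n) *ᵗ (adY i ^ n $ Y j)
    X-chain i≢j n = begin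
      [ X i , adY i ^ suc n $ Y j ]
        ≈⟨ X-bracket-≡ (proj₂ (chain-parity n)) ⟩
      [ K i , adY i ^ n $ Y j ] +ᵗ sgn p *ᵗ [ Y i , [ X i , adY i ^ n $ Y j ] ]
        ≈⟨ +-cong′ (K-chain n) (*-cong′ refl (lower n)) ⟩
      weight n *ᵗ (adY i ^ n $ Y j) +ᵗ sgn p *ᵗ (descent n *ᵗ (adY i ^ n $ Y j))
        ≈⟨ +-cong′ ∼-refl (*-assoc′ _ _ _) ⟨
      weight n *ᵗ (adY i ^ n $ Y j) +ᵗ (sgn p * descent n) *ᵗ (adY i ^ n $ Y j)
        ≈⟨ *-distʳ _ _ _ ⟨
      descent (suc n) *ᵗ (adY i ^ n $ Y j) ∎
      where
      p : Parity
      p = parityOf i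

      lower : ∀ n → [ Y i , [ X i , adY i ^ n $ Y j ] ] ∼ descent n *ᵗ (adY i ^ n $ Y j)
      lower zero    = ∼-trans ([,]-0ʳ _ (XY-≢ i≢j)) (∼-sym (*-zeroˡ′ _))
      lower (suc n) = ∼-trans ([,]-cong ∼-refl (X-chain i≢j n)) ([,]-*ʳ _ _ _)

  private
    parity-even : ∀ {i} → parityOf i ≡ 0ℙ → HasParity 0ℙ (Y i)
    parity-even {i} e = ≡.subst (λ p → HasParity p (Y i)) e (Y-parity i)

    parity-odd : ∀ {i} → parityOf i ≡ 1ℙ → HasParity 1ℙ (Y i)
    parity-odd {i} e = ≡.subst (λ p → HasParity p (Y i)) e (Y-parity i)

    odd-index : ∀ {i} → parityOf i ≡ 1ℙ → Ψ i
    odd-index {i} e with Ψ? i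
    ... | yes ψ = ψ
    ... | no  _ with () ← e

    even-or-odd : ∀ i {t} {T : Set t} → (parityOf i ≡ 0ℙ → T) → (parityOf i ≡ 1ℙ → T) → T
    even-or-odd i even odd with parityOf i
    ... | 0ℙ = even ≡.refl
    ... | 1ℙ = odd ≡.refl

  half-multiple : ∀ {i j m} → Ψ i → Iʳᵉ i → a i j ≈ - nat m → ∃ λ r → m ≡ r ℕ.* 2
  half-multiple {i} {j} ψ re a≈ with evenIntegral i j (ψ , re)
  ... | z , a≈′ = even-multiple {z = z} a≈ a≈′

  descent-vanishes : ∀ {i j m} → Iʳᵉ i → a i j ≈ - nat m →
    SerreScalars.descent (parityOf i) (a i i) (- a i j) (suc m) ≈ 0#
  descent-vanishes {i} {j} {m} re a≈ =
    even-or-odd i (λ even → descent-even {m = m} re w≈m even)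
                  (λ odd → descent-odd {m = m} re w≈m odd (half-multiple {m = m} (odd-index odd) re a≈))
    where
    open SerreScalars (parityOf i) (a i i) (- a i j)
    w≈m : - a i j ≈ nat m
    w≈m = trans (-‿cong a≈) (-‿involutive _)

  -- For even `i` already `[Yᵢ,Yᵢ]` is 0. For odd `i` the entry `a i j` is an even integer, so the
  -- nonzero exponent is at least 2 and the vanishing cube `[Yᵢ,[Yᵢ,Yᵢ]]` occurs inside.
  ad-square-vanishes : ∀ {i j m} → Iʳᵉ i → a i j ≈ - nat (suc m) → (adY i ^ suc m $ Y i) ∼ 0ᵗ
  ad-square-vanishes {i} {j} {m} re a≈ = even-or-odd i even odd
    where
    even : parityOf i ≡ 0ℙ → (adY i ^ suc m $ Y i) ∼ 0ᵗ
    even e = go m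
      where
      go : ∀ m → (adY i ^ suc m $ Y i) ∼ 0ᵗ
      go zero    = even-square (parity-even e)
      go (suc m) = [,]-0ʳ _ (go m)

    odd : parityOf i ≡ 1ℙ → (adY i ^ suc m $ Y i) ∼ 0ᵗ
    odd e with half-multiple {m = suc m} (odd-index e) re a≈
    ... | suc r , ≡.refl = go (r ℕ.* 2)
      where
      go : ∀ m → (adY i ^ suc (suc m) $ Y i) ∼ 0ᵗ
      go zero    = odd-cube (parity-odd e)
      go (suc m) = [,]-0ʳ _ (go m)

  -- The first `ad Y i` turns `K j` into `a j i` times `Y i`. If `m = 0` this scalar is 0 by the
  -- symmetry of the zero pattern; otherwise the remaining powers kill `Y i`.
  ad-K-vanishes : ∀ {i j m} → Iʳᵉ i → a i j ≈ - nat m → (adY i ^ suc m $ K j) ∼ 0ᵗ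
  ad-K-vanishes {i} {j} {zero} re a≈ =
    ∼-trans (Y-K i j) (*-zero-scalar _ (Equivalence.to (zeroPattern i j) (trans a≈ -0#≈0#)))
  ad-K-vanishes {i} {j} {suc m} re a≈ = begin
    (adY i ^ suc (suc m) $ K j)         ≈⟨ last (suc m) ⟩
    (adY i ^ suc m $ [ Y i , K j ])     ≈⟨ ad-cong (Y i) (suc m) (Y-K i j) ⟩
    (adY i ^ suc m $ (a j i *ᵗ Y i))    ≈⟨ ad-* (Y i) (suc m) _ _ ⟩
    a j i *ᵗ (adY i ^ suc m $ Y i)      ≈⟨ *ₗ-zero _ (ad-square-vanishes re a≈) ⟩
    0ᵗ                                  ∎
    where
    last : ∀ n → (adY i ^ suc n $ K j) ∼ (adY i ^ n $ [ Y i , K j ])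
    last zero    = ∼-refl
    last (suc n) = [,]-cong ∼-refl (last n)

  -- For a real relator there are three cases: `l = i` is the vanishing of `descent`; `l = j`
  -- replaces `Y j` by `K j`; any other `X l` supercommutes with all letters.
  X-relator : ∀ l {x} → CoreRelator A x → [ X l , mapᵗ 𝕂 y x ] ∼ 0ᵗ
  X-relator l (real {i} {j} m re i≢j a≈) =
    ≡.subst (λ z → [ X l , z ] ∼ 0ᵗ) (≡.sym (mapᵗ-ad 𝕂 y (gen i) (suc m) (gen j)))
            (vanishes-at l)
    where
    vanishes-at : ∀ l → [ X l , adY i ^ suc m $ Y j ] ∼ 0ᵗ
    vanishes-at l with index-≟ s l i
    ... | yes ≡.refl = ∼-trans (X-chain i j i≢j m) (*-zero-scalar _ (descent-vanishes {m = m} re a≈))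
    ... | no l≢i = X-ad-≢-vanishes l≢i (Y-parity j) (suc m) inner
      where
      inner : (adY i ^ suc m $ [ X l , Y j ]) ∼ 0ᵗ
      inner with index-≟ s l j
      ... | yes ≡.refl = ∼-trans (ad-cong (Y i) (suc m) (XY-≡ l)) (ad-K-vanishes re a≈)
      ... | no l≢j = ad-0 (Y i) (suc m) (XY-≢ l≢j)
  X-relator l (null {i} (ψ , a≈0)) with index-≟ s l i
  -- `[Xᵢ,[Yᵢ,Yᵢ]]` is `[Kᵢ,Yᵢ] ± [Yᵢ,Kᵢ]`, and both summands are multiples of `a i i = 0`.
  ... | yes ≡.refl = ∼-trans (X-bracket-≡ (Y-parity i)) (+ᴹ-zeros
    (∼-trans (KY i i) (*-zero-scalar _ (trans (-‿cong a≈0) -0#≈0#)))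
    (*ₗ-zero _ (∼-trans ([,]-cong ∼-refl (XY-≡ i)) (∼-trans (Y-K i i) (*-zero-scalar _ a≈0)))))
  ... | no l≢i = X-ad-≢-vanishes l≢i (Y-parity i) 1 ([,]-0ʳ _ (XY-≢ l≢i))
  X-relator l (commute {i} {j} i≢j a≈0) with index-≟ s l i
  ... | yes ≡.refl = ∼-trans (X-bracket-≡ (Y-parity j)) (+ᴹ-zeros
    (∼-trans (KY i j) (*-zero-scalar _ (trans (-‿cong a≈0) -0#≈0#)))
    (*ₗ-zero _ ([,]-0ʳ _ (XY-≢ i≢j))))
  ... | no l≢i = X-ad-≢-vanishes l≢i (Y-parity j) 1 inner
    where
    inner : [ Y i , [ X l , Y j ] ] ∼ 0ᵗ
    inner with index-≟ s l j
    ... | yes ≡.refl = ∼-trans ([,]-cong ∼-refl (XY-≡ l))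
                         (∼-trans (Y-K i l) (*-zero-scalar _ (Equivalence.to (zeroPattern i l) a≈0)))
    ... | no l≢j = [,]-0ʳ _ (XY-≢ l≢j)

  -- `ε` gives the sign of the degrees: `n ↦ - n` when the `Y` are the `fᵢ`, and `n ↦ n` when they
  -- are the `eᵢ`.
  module Lowering (ε : ℕ → ℤ) (ε-+ : ∀ m n → ε (m ℕ.+ n) ≡ ε m ℤ.+ ε n) where
    open Span 𝕂 P
    open Multidegree A using (δ)
    open Words A
    open GroupProperties (AbelianGroup.group ℤ.+-0-abelianGroup) using (∙-cancelˡ)

    data Borel (γ : I → ℤ) : Pred Elt c where
      nilpotent : ∀ i w → (∀ j → γ j ≡ ε (at (wordDegree i w) j)) → Borel γ (mapᵗ 𝕂 y (word i w))
      cartan    : ∀ i → (∀ j → γ j ≡ + 0) → Borel γ (K i)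

    private
      append : ∀ {γ γ′} l → (∀ j → γ′ j ≡ ε (δ j l) ℤ.+ γ j) → ∀ {x} → Borel γ x → Spanned (Borel γ′) [ Y l , x ]
      append l γ′≡ (nilpotent i w γ≡) = incl (nilpotent i (l ∷ w) λ j →
        ≡.trans (γ′≡ j) (≡.trans (≡.cong (λ d → ε (δ j l) ℤ.+ d) (γ≡ j)) (≡.sym (ε-+ (δ j l) _))))
      append l γ′≡ (cartan i γ≡0)    = resp (∼-sym (Y-K l i)) (*∈ _ (incl (nilpotent l [] λ j →
        ≡.trans (γ′≡ j) (≡.trans (≡.cong (λ d → ε (δ j l) ℤ.+ d) (γ≡0 j)) (ℤ.+-identityʳ _)))))

      lower-tail : ∀ {γ} l i m w → (∀ j → ε (δ j l) ℤ.+ γ j ≡ ε (δ j m ℕ.+ at (wordDegree i w) j)) →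
                   Spanned (Borel γ) [ Y m , [ X l , mapᵗ 𝕂 y (word i w) ] ]

    -- `X l` either passes the outermost letter or meets it and produces `K l`, of which every word
    -- is an eigenvector. The degree equation says that `γ` is the degree of the word minus that of
    -- `Y l`, written without subtraction.
    lower : ∀ {γ} l i w → (∀ j → ε (δ j l) ℤ.+ γ j ≡ ε (at (wordDegree i w) j)) →
            Spanned (Borel γ) [ X l , mapᵗ 𝕂 y (word i w) ]
    lower {γ} l i [] γ≡ with index-≟ s l i
    ... | no l≢i     = zero∈ (XY-≢ l≢i)
    ... | yes ≡.refl = resp (∼-sym (XY-≡ l)) (incl (cartan l λ j →
      ∙-cancelˡ (ε (δ j l)) _ _ (≡.trans (γ≡ j) (≡.sym (ℤ.+-identityʳ _)))))
    lower {γ} l i (m ∷ w) γ≡ with index-≟ s l m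
    ... | no l≢m     =
      resp (∼-sym (X-bracket-≢ l≢m (proj₂ (image-parity (word-monomial i w))))) (*∈ _ (lower-tail l i m w γ≡))
    ... | yes ≡.refl =
      resp (∼-sym (X-bracket-≡ (proj₂ (image-parity (word-monomial i w)))))
        (+∈ (resp (∼-sym (proj₂ (K-eigen l (word-monomial i w)))) (*∈ _ (incl (nilpotent i w λ j →
              ∙-cancelˡ (ε (δ j l)) _ _ (≡.trans (γ≡ j) (ε-+ (δ j l) _))))))
            (*∈ _ (lower-tail l i l w γ≡)))

    lower-tail {γ} l i m w γ≡ = span-bracket (Y m) (append m γ≡γ′) (lower l i w γ′≡)
      where
      -- The degree of the tail once `X l` has acted on it; prefixing `Y m` then leads back to `γ`.
      γ′ : I → ℤ
      γ′ j = ℤ.- ε (δ j l) ℤ.+ ε (at (wordDegree i w) j)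

      γ′≡ : ∀ j → ε (δ j l) ℤ.+ γ′ j ≡ ε (at (wordDegree i w) j)
      γ′≡ j = +-cancels (ε (δ j l)) _

      γ≡γ′ : ∀ j → γ j ≡ ε (δ j m) ℤ.+ γ′ j
      γ≡γ′ j = +-transposes (ε (δ j l)) (γ j) (ε (δ j m)) _ (≡.trans (γ≡ j) (ε-+ (δ j m) _))

-- Even and odd parts of a term.

module ParitySplitting {c ℓ₁ ℓ₂ ℓ₃ r a ℓ} (𝕂 : ScalarField c ℓ₁ ℓ₂ ℓ₃) (P : Presentation 𝕂 r)
         (G : CommutativeMonoid a ℓ) (deg : Presentation.Generator P → CommutativeMonoid.Carrier G) where
  open Presented 𝕂 P
  open LieCalculus 𝕂 P
  open LeftModule whole using (≈ᴹ-setoid)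
  open SetoidReasoning ≈ᴹ-setoid
  open CommutativeSemigroupProperties
    (CommutativeMonoid.commutativeSemigroup (LeftModule.+ᴹ-commutativeMonoid whole)) using (interchange)

  -- A term that is homogeneous for a root or multidegree may still mix parities syntactically. Its
  -- parts keep the degree and admit `skew` and `jacobi`.
  part : Parity → Elt → Elt
  part p (gen x)   = if does (parity x ℙ.≟ p) then gen x else 0ᵗ
  part p 0ᵗ        = 0ᵗ
  part p (x +ᵗ y)  = part p x +ᵗ part p y
  part p (t *ᵗ x)  = t *ᵗ part p x
  part p [ x , y ] = [ part 0ℙ x , part p y ] +ᵗ [ part 1ℙ x , part (p ℙ.⁻¹) y ]

  part-parity : ∀ p x → HasParity p (part p x)
  part-parity p (gen x) with parity x ℙ.≟ p
  ... | yes eq = gen (≡.sym eq)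
  ... | no  _  = 0ᵗ
  part-parity p 0ᵗ        = 0ᵗ
  part-parity p (x +ᵗ y)  = part-parity p x +ᵗ part-parity p y
  part-parity p (t *ᵗ x)  = t *ᵗ part-parity p x
  part-parity p [ x , y ] =
    [_,_] (part-parity 0ℙ x) (part-parity p y) {≡.refl} +ᵗ
    [_,_] (part-parity 1ℙ x) (part-parity (p ℙ.⁻¹) y) {≡.sym (ℙ.⁻¹-involutive p)}

  part-homogeneous : ∀ p {g x} → Homogeneous 𝕂 G deg g x → Homogeneous 𝕂 G deg g (part p x)
  part-homogeneous p (gen {x = x} eq) with parity x ℙ.≟ p
  ... | yes _ = gen eq
  ... | no  _ = 0ᵗ
  part-homogeneous p 0ᵗ        = 0ᵗ
  part-homogeneous p (x +ᵗ y)  = part-homogeneous p x +ᵗ part-homogeneous p y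
  part-homogeneous p (t *ᵗ x)  = t *ᵗ part-homogeneous p x
  part-homogeneous p ([_,_] x y {eq}) =
    [_,_] (part-homogeneous 0ℙ x) (part-homogeneous p y) {eq} +ᵗ
    [_,_] (part-homogeneous 1ℙ x) (part-homogeneous (p ℙ.⁻¹) y) {eq}

  part-sum : ∀ x → x ∼ part 0ℙ x +ᵗ part 1ℙ x
  part-sum (gen x) with parity x
  ... | 0ℙ = ∼-sym (+-idʳ _)
  ... | 1ℙ = ∼-sym (+-idˡ _)
  part-sum 0ᵗ        = ∼-sym (+-idˡ 0ᵗ)
  part-sum (x +ᵗ y)  = ∼-trans (+-cong′ (part-sum x) (part-sum y)) (interchange _ _ _ _)
  part-sum (t *ᵗ x)  = ∼-trans (*-cong′ (ScalarField.refl 𝕂) (part-sum x)) (*-distˡ t _ _)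
  part-sum [ x , y ] = begin
    [ x , y ]
      ≈⟨ [,]-cong (part-sum x) (part-sum y) ⟩
    [ x₀ +ᵗ x₁ , y₀ +ᵗ y₁ ]
      ≈⟨ [,]-+ˡ x₀ x₁ _ ⟩
    [ x₀ , y₀ +ᵗ y₁ ] +ᵗ [ x₁ , y₀ +ᵗ y₁ ]
      ≈⟨ +-cong′ ([,]-+ʳ x₀ y₀ y₁) (∼-trans ([,]-+ʳ x₁ y₀ y₁) (+-comm′ _ _)) ⟩
    ([ x₀ , y₀ ] +ᵗ [ x₀ , y₁ ]) +ᵗ ([ x₁ , y₁ ] +ᵗ [ x₁ , y₀ ])
      ≈⟨ interchange _ _ _ _ ⟩
    ([ x₀ , y₀ ] +ᵗ [ x₁ , y₁ ]) +ᵗ ([ x₀ , y₁ ] +ᵗ [ x₁ , y₀ ]) ∎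
    where
    x₀ x₁ y₀ y₁ : Elt
    x₀ = part 0ℙ x
    x₁ = part 1ℙ x
    y₀ = part 0ℙ y
    y₁ = part 1ℙ y

-- Functions on words as a module over the algebra without Serre relations.

functionModule : ∀ {r ℓr m ℓm} {R : Ring r ℓr} → Set → LeftModule R m ℓm → LeftModule R m ℓm
functionModule S N = record
  { Carrierᴹ = S → Carrierᴹ
  ; _≈ᴹ_     = λ g h → ∀ w → g w ≈ᴹ h w
  ; _+ᴹ_     = λ g h w → g w +ᴹ h w
  ; _*ₗ_     = λ t g w → t *ₗ g w
  ; 0ᴹ       = λ _ → 0ᴹ
  ; -ᴹ_      = λ g w → -ᴹ g w
  ; isLeftModule = record
    { isLeftSemimodule = record
      { +ᴹ-isCommutativeMonoid = record
        { isMonoid = record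
          { isSemigroup = record
            { isMagma = record
              { isEquivalence = record
                { refl  = λ _ → ≈ᴹ-refl
                ; sym   = λ p w → ≈ᴹ-sym (p w)
                ; trans = λ p q w → ≈ᴹ-trans (p w) (q w)
                }
              ; ∙-cong = λ p q w → +ᴹ-cong (p w) (q w)
              }
            ; assoc = λ _ _ _ _ → +ᴹ-assoc _ _ _
            }
          ; identity = (λ _ _ → +ᴹ-identityˡ _) , (λ _ _ → +ᴹ-identityʳ _)
          }
        ; comm = λ _ _ _ → +ᴹ-comm _ _
        }
      ; isPreleftSemimodule = record
        { *ₗ-cong      = λ e p w → *ₗ-cong e (p w)
        ; *ₗ-zeroˡ     = λ _ _ → *ₗ-zeroˡ _
        ; *ₗ-distribʳ  = λ _ _ _ _ → *ₗ-distribʳ _ _ _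
        ; *ₗ-identityˡ = λ _ _ → *ₗ-identityˡ _
        ; *ₗ-assoc     = λ _ _ _ _ → *ₗ-assoc _ _ _
        ; *ₗ-zeroʳ     = λ _ _ → *ₗ-zeroʳ _
        ; *ₗ-distribˡ  = λ _ _ _ _ → *ₗ-distribˡ _ _ _
        }
      }
    ; -ᴹ‿cong    = λ p w → -ᴹ‿cong (p w)
    ; -ᴹ‿inverse = (λ _ _ → -ᴹ‿inverseˡ _) , (λ _ _ → -ᴹ‿inverseʳ _)
    }
  }
  where open LeftModule N

module _ {c ℓ₁ ℓ₂ ℓ₃} {𝕂 : ScalarField c ℓ₁ ℓ₂ ℓ₃} {s : IndexSet} (A : BKMSupermatrix 𝕂 s) where
  open ScalarField 𝕂 hiding (zeroˡ; zeroʳ; ring)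
  open CommutativeRing commutativeRing using (ring)
  open RingProperties ring using (-‿involutive; -1*x≈-x)
  open BKM 𝕂 A using (a; parityOf; ChevalleyGenerator; e; f; h; chevalleyParity)

  data SerreFreeRelation : Rel (Term 𝕂 ChevalleyGenerator) c where
    hh   : ∀ i j → SerreFreeRelation [ gen (h i) , gen (h j) ] 0ᵗ
    he   : ∀ i j → SerreFreeRelation [ gen (h i) , gen (e j) ] (a i j *ᵗ gen (e j))
    hf   : ∀ i j → SerreFreeRelation [ gen (h i) , gen (f j) ] ((- a i j) *ᵗ gen (f j))
    ef-≡ : ∀ i → SerreFreeRelation [ gen (e i) , gen (f i) ] (gen (h i))
    ef-≢ : ∀ {i j} → i ≢ j → SerreFreeRelation [ gen (e i) , gen (f j) ] 0ᵗ

  serreFree : Presentation 𝕂 c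
  serreFree = record
    { Generator = ChevalleyGenerator
    ; parity    = chevalleyParity
    ; _≐_       = SerreFreeRelation
    }

  -- Both 𝔫₋ and 𝔫₊ are governed by the same relations, as (f , e , h) can be
  -- replaced by (e , (-1)^p f , -h).
  module Chevalley± {r} (_≐_ : Rel (Term 𝕂 ChevalleyGenerator) r)
    (serreFree⇒ : ∀ {x y} → SerreFreeRelation x y → x ≐ y) where

    -- With the relations as a parameter, the same computations serve two algebras: 𝔤̂, where they
    -- show how relators act, and 𝔤, where they give the triangular decomposition.
    P : Presentation 𝕂 r
    P = record { Generator = ChevalleyGenerator ; parity = chevalleyParity ; _≐_ = _≐_ }

    open Presented 𝕂 P hiding (_≐_)
    open LieCalculus 𝕂 P
    open LeftModule whole using (≈ᴹ-setoid)
    open SetoidReasoning ≈ᴹ-setoid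

    base : ∀ {x y} → SerreFreeRelation x y → x ∼ y
    base = relation ∘ serreFree⇒

    module Negative = ChevalleyCalculus 𝕂 A P (λ i → gen (e i)) f (λ i → gen (h i))
      (λ _ → gen ≡.refl) (λ _ → ≡.refl) (λ _ → gen ≡.refl)
      (base ∘ ef-≡) (base ∘ ef-≢) (λ i j → base (hf i j))

    private
      -- The origin of the rescaling: `[fᵢ,eᵢ]` is `- hᵢ` for even `i` and `hᵢ` for odd `i`, and the
      -- factor `sgn` makes it `- hᵢ` uniformly.
      sgn-square : ∀ p → sgn p * (- sgn (p ℙ.* p)) ≈ - 1#
      sgn-square 0ℙ = *-identityˡ _
      sgn-square 1ℙ = trans (*-congˡ (-‿involutive 1#)) (*-identityʳ _)

      flip-ef : ∀ i j → [ sgn (parityOf i) *ᵗ gen (f i) , gen (e j) ] ∼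
                (sgn (parityOf i) * (- sgn (parityOf i ℙ.* parityOf j))) *ᵗ [ gen (e j) , gen (f i) ]
      flip-ef i j = begin
        [ sgn (parityOf i) *ᵗ gen (f i) , gen (e j) ]
          ≈⟨ [,]-*ˡ _ _ _ ⟩
        sgn (parityOf i) *ᵗ [ gen (f i) , gen (e j) ]
          ≈⟨ *-cong′ refl (skew (gen ≡.refl) (gen ≡.refl)) ⟩
        sgn (parityOf i) *ᵗ ((- sgn (parityOf i ℙ.* parityOf j)) *ᵗ [ gen (e j) , gen (f i) ])
          ≈⟨ *-assoc′ _ _ _ ⟨
        (sgn (parityOf i) * (- sgn (parityOf i ℙ.* parityOf j))) *ᵗ [ gen (e j) , gen (f i) ] ∎

    module Positive = ChevalleyCalculus 𝕂 A P (λ i → sgn (parityOf i) *ᵗ gen (f i)) e (λ i → -ᵗ gen (h i))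
      (λ _ → _ *ᵗ gen ≡.refl) (λ _ → ≡.refl) (λ _ → _ *ᵗ gen ≡.refl)
      (λ i → ∼-trans (flip-ef i i) (*-cong′ (sgn-square (parityOf i)) (base (ef-≡ i))))
      (λ i≢j → ∼-trans (flip-ef _ _) (*ₗ-zero _ (base (ef-≢ (i≢j ∘ ≡.sym)))))
      (λ i j → begin
        [ -ᵗ gen (h i) , gen (e j) ]     ≈⟨ [,]-*ˡ _ _ _ ⟩
        -ᵗ [ gen (h i) , gen (e j) ]     ≈⟨ *-cong′ refl (base (he i j)) ⟩
        -ᵗ (a i j *ᵗ gen (e j))          ≈⟨ *-assoc′ _ _ _ ⟨
        ((- 1#) * a i j) *ᵗ gen (e j)    ≈⟨ *-cong′ (-1*x≈-x _) ∼-refl ⟩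
        (- a i j) *ᵗ gen (e j)           ∎)

    f-positive : ∀ l {x} → CoreRelator A x → [ gen (f l) , mapᵗ 𝕂 e x ] ∼ 0ᵗ
    f-positive l {x} core = unit (parityOf l) (Positive.X-relator l core)
      where
      z : Elt
      z = [ gen (f l) , mapᵗ 𝕂 e x ]

      unit : ∀ p → [ sgn p *ᵗ gen (f l) , mapᵗ 𝕂 e x ] ∼ 0ᵗ → z ∼ 0ᵗ
      unit 0ℙ eq = ∼-trans (∼-sym (∼-trans ([,]-*ˡ _ _ _) (*-idˡ z))) eq
      unit 1ℙ eq = begin
        z                            ≈⟨ *-idˡ z ⟨
        1# *ᵗ z                      ≈⟨ *-cong′ (trans (-1*x≈-x _) (-‿involutive 1#)) ∼-refl ⟨
        ((- 1#) * (- 1#)) *ᵗ z       ≈⟨ *-assoc′ _ _ _ ⟩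
        -ᵗ (-ᵗ z)                    ≈⟨ *ₗ-zero _ (∼-trans (∼-sym ([,]-*ˡ _ _ _)) eq) ⟩
        0ᵗ                           ∎

    h-positive : ∀ l {x} → Monomial 𝕂 x → ∃ λ κ → [ gen (h l) , mapᵗ 𝕂 e x ] ∼ κ *ᵗ mapᵗ 𝕂 e x
    h-positive l {x} mx with Positive.K-eigen l mx
    ... | κ , eq = (- 1#) * κ , (begin
      z                              ≈⟨ *-idˡ z ⟨
      1# *ᵗ z                        ≈⟨ *-cong′ (trans (-1*x≈-x _) (-‿involutive 1#)) ∼-refl ⟨
      ((- 1#) * (- 1#)) *ᵗ z         ≈⟨ *-assoc′ _ _ _ ⟩
      -ᵗ (-ᵗ z)                      ≈⟨ *-cong′ refl ([,]-*ˡ _ _ _) ⟨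
      -ᵗ [ -ᵗ gen (h l) , mapᵗ 𝕂 e x ] ≈⟨ *-cong′ refl eq ⟩
      -ᵗ (κ *ᵗ mapᵗ 𝕂 e x)           ≈⟨ *-assoc′ _ _ _ ⟨
      ((- 1#) * κ) *ᵗ mapᵗ 𝕂 e x     ∎)
      where
      z : Elt
      z = [ gen (h l) , mapᵗ 𝕂 e x ]

-- Functions on words form the module over serreFree coinduced from the trivial
-- module N of the subalgebra generated by the fᵢ and hᵢ.
module Coinduced {c ℓ₁ ℓ₂ ℓ₃ m ℓm} {𝕂 : ScalarField c ℓ₁ ℓ₂ ℓ₃} {s : IndexSet}
                 (A : BKMSupermatrix 𝕂 s) (N : LeftModule (ScalarField.ring 𝕂) m ℓm) where
  open ScalarField 𝕂 hiding (zeroˡ; zeroʳ; ring)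
  open CommutativeRing commutativeRing using (ring)
  open RingProperties ring using (-‿involutive; -1*x≈-x; -‿+-comm)
  open BKM 𝕂 A using (I; a; parityOf; ChevalleyGenerator; e; f; h; chevalleyParity)
  open LeftModule N using (Carrierᴹ; _≈ᴹ_; _+ᴹ_; _*ₗ_; 0ᴹ; ≈ᴹ-setoid; ≈ᴹ-refl; ≈ᴹ-sym; ≈ᴹ-trans;
    +ᴹ-cong; +ᴹ-congˡ; +ᴹ-congʳ; +ᴹ-identityˡ; +ᴹ-identityʳ; +ᴹ-assoc;
    *ₗ-congˡ; *ₗ-congʳ; *ₗ-zeroʳ; *ₗ-zeroˡ; *ₗ-distribˡ; *ₗ-distribʳ; *ₗ-assoc; *ₗ-identityˡ)
  open SetoidReasoning ≈ᴹ-setoid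

  W : LeftModule (ScalarField.ring 𝕂) m ℓm
  W = functionModule (List I) N

  open LeftModule W using () renaming (Carrierᴹ to Function; _≈ᴹ_ to _≋_)
  open Action 𝕂 W
  open Action 𝕂 N using () renaming (*ₗ-commute to *-commute)
  open IsLinear

  wt : I → List I → Carrier
  wt l []      = 0#
  wt l (i ∷ w) = a l i + wt l w

  -- A function `g` stores at the word `i₁ … iₙ` the value of `e_{iₙ} ⋯ e_{i₁} g` at the empty word,
  -- where `hᵢ g` and `fᵢ g` have value 0. The formulas for `H` and `F` are then forced: they record
  -- what appears when `hᵢ` or `fᵢ` is moved to the left past the `eⱼ`.
  E H F : I → Function → Function
  E i g w = g (i ∷ w)
  H i g w = (- wt i w) *ₗ g w
  F i g []      = 0ᴹ
  F i g (j ∷ w) = sgn (parityOf j ℙ.* parityOf i) *ₗ F i (E j g) w +ᴹ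
                  (if does (index-≟ s j i) then H i g w else 0ᴹ)

  E-linear : ∀ i → IsLinear (E i)
  E-linear i = record
    { cong = λ p w → p (i ∷ w) ; homo-+ = λ _ _ _ → ≈ᴹ-refl ; homo-* = λ _ _ _ → ≈ᴹ-refl }

  H-linear : ∀ i → IsLinear (H i)
  H-linear i = record
    { cong   = λ p w → *ₗ-congˡ (p w)
    ; homo-+ = λ _ _ _ → *ₗ-distribˡ _ _ _
    ; homo-* = λ _ _ _ → *-commute _ _ _
    }

  private
    +-interchange : ∀ x y z w → (x +ᴹ y) +ᴹ (z +ᴹ w) ≈ᴹ (x +ᴹ z) +ᴹ (y +ᴹ w)
    +-interchange = CommutativeSemigroupProperties.interchange
      (CommutativeMonoid.commutativeSemigroup (LeftModule.+ᴹ-commutativeMonoid N))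

    F-cong : ∀ i {g g′} → g ≋ g′ → F i g ≋ F i g′
    F-cong i p []      = ≈ᴹ-refl
    F-cong i p (j ∷ w) = +ᴹ-cong (*ₗ-congˡ (F-cong i (λ v → p (j ∷ v)) w)) diagonal
      where
      diagonal : (if does (index-≟ s j i) then _ else 0ᴹ) ≈ᴹ (if does (index-≟ s j i) then _ else 0ᴹ)
      diagonal with index-≟ s j i
      ... | yes _ = *ₗ-congˡ (p w)
      ... | no  _ = ≈ᴹ-refl

    F-+ : ∀ i g g′ → F i (λ w → g w +ᴹ g′ w) ≋ (λ w → F i g w +ᴹ F i g′ w)
    F-+ i g g′ []      = ≈ᴹ-sym (+ᴹ-identityˡ 0ᴹ)
    F-+ i g g′ (j ∷ w) = ≈ᴹ-trans
      (+ᴹ-cong (≈ᴹ-trans (*ₗ-congˡ (F-+ i (E j g) (E j g′) w)) (*ₗ-distribˡ _ _ _)) diagonal)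
      (+-interchange _ _ _ _)
      where
      diagonal : (if does (index-≟ s j i) then H i (λ w → g w +ᴹ g′ w) w else 0ᴹ) ≈ᴹ
                 (if does (index-≟ s j i) then H i g w else 0ᴹ) +ᴹ
                 (if does (index-≟ s j i) then H i g′ w else 0ᴹ)
      diagonal with index-≟ s j i
      ... | yes _ = *ₗ-distribˡ _ _ _
      ... | no  _ = ≈ᴹ-sym (+ᴹ-identityˡ 0ᴹ)

    F-* : ∀ i t g → F i (λ w → t *ₗ g w) ≋ (λ w → t *ₗ F i g w)
    F-* i t g []      = ≈ᴹ-sym (*ₗ-zeroʳ t)
    F-* i t g (j ∷ w) = ≈ᴹ-trans
      (+ᴹ-cong (≈ᴹ-trans (*ₗ-congˡ (F-* i t (E j g) w)) (*-commute _ _ _)) diagonal)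
      (≈ᴹ-sym (*ₗ-distribˡ _ _ _))
      where
      diagonal : (if does (index-≟ s j i) then H i (λ w → t *ₗ g w) w else 0ᴹ) ≈ᴹ
                 t *ₗ (if does (index-≟ s j i) then H i g w else 0ᴹ)
      diagonal with index-≟ s j i
      ... | yes _ = *-commute _ _ _
      ... | no  _ = ≈ᴹ-sym (*ₗ-zeroʳ t)

  F-linear : ∀ i → IsLinear (F i)
  F-linear i = record { cong = F-cong i ; homo-+ = F-+ i ; homo-* = F-* i }

  -- The relation `hf` in operator form. In the induction each letter `l` shifts `H i` by `- a i l`,
  -- and on the diagonal `l = j` this shift cancels the summand `a i j`.
  FH : ∀ i j g w → F j (H i g) w ≈ᴹ (- wt i w + a i j) *ₗ F j g w
  FH i j g []      = ≈ᴹ-sym (*ₗ-zeroʳ _)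
  FH i j g (l ∷ w) = begin
    σ *ₗ F j (E l (H i g)) w +ᴹ (if does (index-≟ s l j) then H j (H i g) w else 0ᴹ)
      ≈⟨ +ᴹ-cong (*ₗ-congˡ induction) diagonal ⟩
    σ *ₗ (t *ₗ F j (E l g) w) +ᴹ t *ₗ (if does (index-≟ s l j) then H j g w else 0ᴹ)
      ≈⟨ +ᴹ-congʳ (*-commute _ _ _) ⟩
    t *ₗ (σ *ₗ F j (E l g) w) +ᴹ t *ₗ (if does (index-≟ s l j) then H j g w else 0ᴹ)
      ≈⟨ *ₗ-distribˡ _ _ _ ⟨
    t *ₗ F j g (l ∷ w) ∎
    where
    σ t : Carrier
    σ = sgn (parityOf l ℙ.* parityOf j)
    t = - (a i l + wt i w) + a i j

    split : - (a i l + wt i w) ≈ - wt i w + (- a i l)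
    split = trans (sym (-‿+-comm _ _)) (+-comm _ _)

    induction : F j (E l (H i g)) w ≈ᴹ t *ₗ F j (E l g) w
    induction = begin
      F j (E l (H i g)) w
        ≈⟨ F-cong j (λ v → ≈ᴹ-trans (*ₗ-congʳ (trans (sym (-‿+-comm _ _)) (+-comm _ _))) (*ₗ-distribʳ _ _ _)) w ⟩
      F j (λ v → H i (E l g) v +ᴹ (- a i l) *ₗ E l g v) w
        ≈⟨ homo-combination (F-linear j) (- a i l) (H i (E l g)) (E l g) w ⟩
      F j (H i (E l g)) w +ᴹ (- a i l) *ₗ F j (E l g) w
        ≈⟨ +ᴹ-congʳ (FH i j (E l g) w) ⟩
      (- wt i w + a i j) *ₗ F j (E l g) w +ᴹ (- a i l) *ₗ F j (E l g) w
        ≈⟨ *ₗ-distribʳ _ _ _ ⟨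
      ((- wt i w + a i j) + (- a i l)) *ₗ F j (E l g) w
        ≈⟨ *ₗ-congʳ (trans (+-assoc _ _ _) (trans (+-congˡ (+-comm _ _)) (trans (sym (+-assoc _ _ _)) (+-congʳ (sym split))))) ⟩
      t *ₗ F j (E l g) w ∎

    diagonal : (if does (index-≟ s l j) then H j (H i g) w else 0ᴹ) ≈ᴹ
               t *ₗ (if does (index-≟ s l j) then H j g w else 0ᴹ)
    diagonal with index-≟ s l j
    ... | no  _ = ≈ᴹ-sym (*ₗ-zeroʳ t)
    ... | yes ≡.refl = ≈ᴹ-trans (*-commute _ _ _) (*ₗ-congʳ (
      trans (sym (+-identityʳ _)) (trans (+-congˡ (sym (-‿inverseˡ _)))
        (trans (sym (+-assoc _ _ _)) (+-congʳ (sym split))))))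

  op : ChevalleyGenerator → Function → Function
  op (e i) = E i
  op (f i) = F i
  op (h i) = H i

  op-linear : ∀ x → IsLinear (op x)
  op-linear (e i) = E-linear i
  op-linear (f i) = F-linear i
  op-linear (h i) = H-linear i

  ρ : Parity → Term 𝕂 ChevalleyGenerator → Function → Function
  ρ = act chevalleyParity op

  ρ-linear : ∀ p x → IsLinear (ρ p x)
  ρ-linear = act-linear chevalleyParity op-linear

  private
    σ : I → I → Carrier
    σ i j = sgn (parityOf i ℙ.* parityOf j)

    cancel-EF : ∀ i j g w → F j g (i ∷ w) +ᴹ (- σ i j) *ₗ F j (E i g) w ≈ᴹ
                            (if does (index-≟ s i j) then H j g w else 0ᴹ)
    cancel-EF i j g w = begin
      (σ i j *ₗ x +ᴹ d) +ᴹ (- σ i j) *ₗ x     ≈⟨ +ᴹ-congʳ (LeftModule.+ᴹ-comm N _ _) ⟩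
      (d +ᴹ σ i j *ₗ x) +ᴹ (- σ i j) *ₗ x     ≈⟨ +ᴹ-assoc _ _ _ ⟩
      d +ᴹ (σ i j *ₗ x +ᴹ (- σ i j) *ₗ x)     ≈⟨ +ᴹ-congˡ (*ₗ-distribʳ _ _ _) ⟨
      d +ᴹ (σ i j + - σ i j) *ₗ x             ≈⟨ +ᴹ-congˡ (*ₗ-congʳ (-‿inverseʳ _)) ⟩
      d +ᴹ 0# *ₗ x                            ≈⟨ +ᴹ-congˡ (*ₗ-zeroˡ x) ⟩
      d +ᴹ 0ᴹ                                 ≈⟨ +ᴹ-identityʳ d ⟩
      d                                       ∎
      where
      x d : Carrierᴹ
      x = F j (E i g) w
      d = if does (index-≟ s i j) then H j g w else 0ᴹ

  ρ-bracket : ∀ x y z →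
    Homogeneous 𝕂 ℙ.+-0-commutativeMonoid chevalleyParity (chevalleyParity x ℙ.+ chevalleyParity y) z →
    (∀ g → supercommutator (chevalleyParity x) (chevalleyParity y) (op x) (op y) g ≋
           ρ (chevalleyParity x ℙ.+ chevalleyParity y) z g) →
    ∀ p g → ρ p [ gen x , gen y ] g ≋ ρ p z g
  ρ-bracket x y z hz eq p g = act-relation chevalleyParity op-linear {x} {y} {z} hz (eq g) p

  ρ-respects : ∀ {x y} → SerreFreeRelation A x y → ∀ p g → ρ p x g ≋ ρ p y g
  ρ-respects (hh i j) = ρ-bracket (h i) (h j) 0ᵗ 0ᵗ λ g w → begin
    (- wt i w) *ₗ ((- wt j w) *ₗ g w) +ᴹ (- 1#) *ₗ ((- wt j w) *ₗ ((- wt i w) *ₗ g w))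
      ≈⟨ +ᴹ-congˡ (*ₗ-congˡ (*-commute _ _ _)) ⟩
    (- wt i w) *ₗ ((- wt j w) *ₗ g w) +ᴹ (- 1#) *ₗ ((- wt i w) *ₗ ((- wt j w) *ₗ g w))
      ≈⟨ neg-inverseʳ _ ⟩
    0ᴹ ∎
    where
    neg-inverseʳ : ∀ x → x +ᴹ (- 1#) *ₗ x ≈ᴹ 0ᴹ
    neg-inverseʳ x = begin
      x +ᴹ (- 1#) *ₗ x          ≈⟨ +ᴹ-congʳ (*ₗ-identityˡ x) ⟨
      1# *ₗ x +ᴹ (- 1#) *ₗ x    ≈⟨ *ₗ-distribʳ _ _ _ ⟨
      (1# + - 1#) *ₗ x          ≈⟨ *ₗ-congʳ (-‿inverseʳ 1#) ⟩
      0# *ₗ x                   ≈⟨ *ₗ-zeroˡ x ⟩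
      0ᴹ                        ∎
  ρ-respects (he i j) = ρ-bracket (h i) (e j) (a i j *ᵗ gen (e j)) (_ *ᵗ gen ≡.refl) λ g w → begin
    (- wt i w) *ₗ g (j ∷ w) +ᴹ (- 1#) *ₗ ((- (a i j + wt i w)) *ₗ g (j ∷ w))
      ≈⟨ +ᴹ-congˡ (*ₗ-assoc _ _ _) ⟨
    (- wt i w) *ₗ g (j ∷ w) +ᴹ ((- 1#) * (- (a i j + wt i w))) *ₗ g (j ∷ w)
      ≈⟨ *ₗ-distribʳ _ _ _ ⟨
    ((- wt i w) + (- 1#) * (- (a i j + wt i w))) *ₗ g (j ∷ w)
      ≈⟨ *ₗ-congʳ (coefficient (wt i w) (a i j)) ⟩
    a i j *ₗ g (j ∷ w)
      ≡⟨ ≡.cong (λ g′ → a i j *ₗ g′ w) (act-gen chevalleyParity op-linear (e j) g) ⟨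
    a i j *ₗ ρ (parityOf j) (gen (e j)) g w ∎
    where
    coefficient : ∀ x y → - x + (- 1#) * (- (y + x)) ≈ y
    coefficient x y =
      trans (+-congˡ (trans (-1*x≈-x _) (-‿involutive _)))
      (trans (+-congˡ (+-comm _ _))
      (trans (sym (+-assoc _ _ _))
      (trans (+-congʳ (-‿inverseˡ x)) (+-identityˡ y))))
  ρ-respects (hf i j) = ρ-bracket (h i) (f j) ((- a i j) *ᵗ gen (f j)) (_ *ᵗ gen ≡.refl) λ g w → begin
    (- wt i w) *ₗ F j g w +ᴹ (- 1#) *ₗ F j (H i g) w
      ≈⟨ +ᴹ-congˡ (≈ᴹ-trans (*ₗ-congˡ (FH i j g w)) (≈ᴹ-sym (*ₗ-assoc _ _ _))) ⟩
    (- wt i w) *ₗ F j g w +ᴹ ((- 1#) * (- wt i w + a i j)) *ₗ F j g w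
      ≈⟨ *ₗ-distribʳ _ _ _ ⟨
    ((- wt i w) + (- 1#) * (- wt i w + a i j)) *ₗ F j g w
      ≈⟨ *ₗ-congʳ (coefficient (- wt i w) (a i j)) ⟩
    (- a i j) *ₗ F j g w
      ≡⟨ ≡.cong (λ g′ → (- a i j) *ₗ g′ w) (act-gen chevalleyParity op-linear (f j) g) ⟨
    (- a i j) *ₗ ρ (parityOf j) (gen (f j)) g w ∎
    where
    coefficient : ∀ x y → x + (- 1#) * (x + y) ≈ - y
    coefficient x y =
      trans (+-congˡ (trans (-1*x≈-x _) (sym (-‿+-comm _ _))))
      (trans (sym (+-assoc _ _ _))
      (trans (+-congʳ (-‿inverseʳ x)) (+-identityˡ _)))
  ρ-respects (ef-≡ i) = ρ-bracket (e i) (f i) (gen (h i)) (gen (parity-square (parityOf i))) λ g w → begin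
    F i g (i ∷ w) +ᴹ (- σ i i) *ₗ F i (E i g) w
      ≈⟨ cancel-EF i i g w ⟩
    (if does (index-≟ s i i) then H i g w else 0ᴹ)
      ≡⟨ diagonal g w ⟩
    H i g w
      ≡⟨ ≡.cong (λ g′ → g′ w) (act-gen chevalleyParity op-linear (h i) g) ⟨
    ρ 0ℙ (gen (h i)) g w
      ≡⟨ ≡.cong (λ p → ρ p (gen (h i)) g w) (parity-square (parityOf i)) ⟨
    ρ (parityOf i ℙ.+ parityOf i) (gen (h i)) g w ∎
    where
    parity-square : ∀ p → p ℙ.+ p ≡ 0ℙ
    parity-square 0ℙ = ≡.refl
    parity-square 1ℙ = ≡.refl
    diagonal : ∀ g w → (if does (index-≟ s i i) then H i g w else 0ᴹ) ≡ H i g w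
    diagonal g w with index-≟ s i i
    ... | yes _ = ≡.refl
    ... | no i≢i = ⊥-elim (i≢i ≡.refl)
  ρ-respects (ef-≢ {i} {j} i≢j) = ρ-bracket (e i) (f j) 0ᵗ 0ᵗ λ g w → begin
    F j g (i ∷ w) +ᴹ (- σ i j) *ₗ F j (E i g) w
      ≈⟨ cancel-EF i j g w ⟩
    (if does (index-≟ s i j) then H j g w else 0ᴹ)
      ≡⟨ off-diagonal g w ⟩
    0ᴹ ∎
    where
    off-diagonal : ∀ g w → (if does (index-≟ s i j) then H j g w else 0ᴹ) ≡ 0ᴹ
    off-diagonal g w with index-≟ s i j
    ... | yes i≡j = ⊥-elim (i≢j i≡j)
    ... | no _ = ≡.refl

-- The submodule on which the relators act by zero.

module CoinducedAction {c ℓ₁ ℓ₂ ℓ₃ m ℓm} {𝕂 : ScalarField c ℓ₁ ℓ₂ ℓ₃} {s : IndexSet}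
                       (A : BKMSupermatrix 𝕂 s) (N : LeftModule (ScalarField.ring 𝕂) m ℓm) where
  open ScalarField 𝕂 hiding (zeroˡ; zeroʳ; ring)
  open Scalars 𝕂 using (2·nat)
  open BKM 𝕂 A using (I; a; Ψ; Ψ?; parityOf; SerreElement; real; oddReal; null;
                      ChevalleyGenerator; e; f; h; chevalleyParity; 𝔤-presentation;
                      hh; he; hf; ef-≡; ef-≢; serreᵉ; serreᶠ; ee; ff)
  open Coinduced A N
  open LeftModule N using (_≈ᴹ_; _+ᴹ_; _*ₗ_; 0ᴹ) renaming (≈ᴹ-refl to N-refl; ≈ᴹ-trans to N-trans)
  open LeftModule W using () renaming
    ( Carrierᴹ to Function; _≈ᴹ_ to _≋_; ≈ᴹ-refl to ≋-refl; ≈ᴹ-sym to ≋-sym; ≈ᴹ-trans to ≋-trans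
    ; ≈ᴹ-reflexive to ≋-reflexive; _+ᴹ_ to _⊞_; _*ₗ_ to _⊡_; 0ᴹ to 𝟎; +ᴹ-cong to ⊞-cong; +ᴹ-identityˡ to ⊞-identityˡ
    ; +ᴹ-identityʳ to ⊞-identityʳ; +ᴹ-congˡ to ⊞-congˡ; +ᴹ-congʳ to ⊞-congʳ)
  open Action 𝕂 W
  open IsLinear
  open Chevalley± A (SerreFreeRelation A) (λ r → r) using (module Negative; f-positive; h-positive)
  open Presented 𝕂 (serreFree A) using (_∼_; HasParity; Elt)
  open LieCalculus 𝕂 (serreFree A) using (ad-square; even-square)

  private
    module Free = Soundness (serreFree A) op-linear (λ _ → ⊤ {0ℓ}) tt (λ _ _ → tt) (λ _ _ → tt) (λ _ _ → tt)
                            (λ r p {g} _ → ρ-respects r p g)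

  ρ-sound : ∀ {x y} → x ∼ y → ∀ p g → ρ p x g ≋ ρ p y g
  ρ-sound x∼y p g = Free.act-sound x∼y p tt

  ρ-bracketˡ : ∀ z {q θ} → HasParity q θ → ∀ g →
    ρ (chevalleyParity z ℙ.+ q) [ gen z , θ ] g ≋ supercommutator (chevalleyParity z) q (op z) (ρ q θ) g
  ρ-bracketˡ z {q} {θ} hθ g = ≋-trans
    (act-bracket chevalleyParity op-linear {x = gen z} (gen ≡.refl) hθ ≡.refl g)
    (supercommutator-cong (chevalleyParity z) q (ρ-linear (chevalleyParity z) (gen z)) (ρ-linear q θ)
      (λ k → ≋-reflexive (act-gen chevalleyParity op-linear z k)) (λ _ → ≋-refl) g)

  -- The supercommutator of `z` and `θ` applied to `g` is `κ θ g = 0`, and its term `z θ g` is 0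
  -- too. What is left is `θ z g` up to sign.
  killed-by-eigenvector : ∀ z {q θ κ g} → HasParity q θ → [ gen z , θ ] ∼ κ *ᵗ θ →
    (∀ p → ρ p θ g ≋ 𝟎) → ∀ p → ρ p θ (op z g) ≋ 𝟎
  killed-by-eigenvector z {q} {θ} {κ} {g} hθ eigen killed p with p ℙ.≟ q
  ... | no p≢q = act-vanishes chevalleyParity op-linear hθ p≢q (op z g)
  ... | yes ≡.refl = sign-cancel (chevalleyParity z ℙ.* q)
    (≋-trans (≋-sym (⊞-identityˡ _))
    (≋-trans (⊞-congʳ (≋-sym (≋-trans (cong (op-linear z) (killed q)) (homo-0 (op-linear z)))))
    (≋-trans (≋-sym (ρ-bracketˡ z hθ g))
    (≋-trans (ρ-sound eigen r g) (*ₗ-zero κ (killed r))))))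
    where
    r : Parity
    r = chevalleyParity z ℙ.+ q

  private
    f-vanishes-[] : ∀ p x g → ρ p (mapᵗ 𝕂 f x) g [] ≈ᴹ 0ᴹ
    f-vanishes-[] p (gen i) g with parityOf i ℙ.≟ p
    ... | yes _ = N-refl
    ... | no  _ = N-refl
    f-vanishes-[] p 0ᵗ        g = N-refl
    f-vanishes-[] p (x +ᵗ y)  g = Action.+ᴹ-zeros 𝕂 N (f-vanishes-[] p x g) (f-vanishes-[] p y g)
    f-vanishes-[] p (t *ᵗ x)  g = Action.*ₗ-zero 𝕂 N t (f-vanishes-[] p x g)
    f-vanishes-[] p [ x , y ] g =
      zeros (zeros (f-vanishes-[] 0ℙ x _) (zero* (f-vanishes-[] p y _)))
            (zeros (f-vanishes-[] 1ℙ x _) (zero* (f-vanishes-[] (p ℙ.⁻¹) y _)))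
      where
      zeros : ∀ {u v} → u ≈ᴹ 0ᴹ → v ≈ᴹ 0ᴹ → u +ᴹ v ≈ᴹ 0ᴹ
      zeros = Action.+ᴹ-zeros 𝕂 N
      zero* : ∀ {t u} → u ≈ᴹ 0ᴹ → t *ₗ u ≈ᴹ 0ᴹ
      zero* = Action.*ₗ-zero 𝕂 N _

  -- It commutes with every eⱼ and vanishes at the empty word.
  f-relator-kills : ∀ {x} → CoreRelator A x → ∀ p g → ρ p (mapᵗ 𝕂 f x) g ≋ 𝟎
  f-relator-kills {x} core p g with Negative.image-parity (relator-monomial A core)
  ... | q , hθ with p ℙ.≟ q
  ...   | no p≢q = act-vanishes chevalleyParity op-linear hθ p≢q g
  ...   | yes ≡.refl = go g
    where
    θ : Elt
    θ = mapᵗ 𝕂 f x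

    commutes : ∀ j g → supercommutator (parityOf j) q (E j) (ρ q θ) g ≋ 𝟎
    commutes j g = ≋-trans (≋-sym (ρ-bracketˡ (e j) hθ g))
                           (ρ-sound (Negative.X-relator j core) (parityOf j ℙ.+ q) g)

    go : ∀ g → ρ q θ g ≋ 𝟎
    go g []      = f-vanishes-[] q x g
    -- The value of `θ g` at `j ∷ w` is that of `E j (θ g)` at `w`, which the commutation turns into
    -- `± θ (E j g)` at the shorter word `w`.
    go g (j ∷ w) = N-trans (N-sym (N-trans (+-congˡ′ (Action.*ₗ-zero 𝕂 N _ (go (E j g) w))) (N-idʳ _)))
                           (commutes j g w)
      where open LeftModule N using () renaming (≈ᴹ-sym to N-sym; +ᴹ-congˡ to +-congˡ′; +ᴹ-identityʳ to N-idʳ)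

  ρᵉ : Parity → Term 𝕂 I → Function → Function
  ρᵉ = act parityOf E

  ρᵉ-linear : ∀ p x → IsLinear (ρᵉ p x)
  ρᵉ-linear = act-linear parityOf E-linear

  ρ-e : ∀ p x g → ρ p (mapᵗ 𝕂 e x) g ≡ ρᵉ p x g
  ρ-e = act-mapᵗ e

  -- `shift (j ∷ u) g` is `shift u (E j g)` by computation, so this is the translate of `g` by a
  -- product of the `E`. Quantifying over `u` below thus makes stability under `E` immediate.
  shift : List I → Function → Function
  shift u g w = g (u ++ w)

  -- `S` is a parameter because the action of 𝔤 uses the core relators, whereas the ideal of part
  -- (2) uses a larger set.
  module _ {t} (S : Pred (Term 𝕂 I) t) where

    AnnihilatedAfter : List I → Pred Function (c ⊔ t ⊔ ℓm)
    AnnihilatedAfter u g = ∀ {x} → S x → ∀ p → ρᵉ p x (shift u g) ≋ 𝟎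

    Annihilated : Pred Function (c ⊔ t ⊔ ℓm)
    Annihilated g = ∀ u → AnnihilatedAfter u g

    after-≋ : ∀ u {g k} → g ≋ k → AnnihilatedAfter u g → AnnihilatedAfter u k
    after-≋ u g≋k ann {x} x∈ p =
      ≋-trans (cong (ρᵉ-linear p x) (λ w → LeftModule.≈ᴹ-sym N (g≋k (u ++ w)))) (ann x∈ p)

    after-0 : ∀ u → AnnihilatedAfter u 𝟎
    after-0 u {x} x∈ p = homo-0 (ρᵉ-linear p x)

    after-+ : ∀ u {g k} → AnnihilatedAfter u g → AnnihilatedAfter u k → AnnihilatedAfter u (g ⊞ k)
    after-+ u ann ann′ {x} x∈ p = ≋-trans (homo-+ (ρᵉ-linear p x) _ _) (+ᴹ-zeros (ann x∈ p) (ann′ x∈ p))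

    after-* : ∀ u t {g} → AnnihilatedAfter u g → AnnihilatedAfter u (t ⊡ g)
    after-* u t ann {x} x∈ p = ≋-trans (homo-* (ρᵉ-linear p x) t _) (*ₗ-zero t (ann x∈ p))

    E∈ : ∀ i {g} → Annihilated g → Annihilated (E i g)
    E∈ i ann u = ann (i ∷ u)

  private
    V : Pred Function _
    V = Annihilated (CoreRelator A)

    eigen-kills : ∀ z {x κ g} → CoreRelator A x → [ gen z , mapᵗ 𝕂 e x ] ∼ κ *ᵗ mapᵗ 𝕂 e x →
      (∀ p → ρᵉ p x g ≋ 𝟎) → ∀ p → ρᵉ p x (op z g) ≋ 𝟎
    eigen-kills z {x} {g = g} core eigen killed p =
      ≋-trans (≋-sym (≋-reflexive (ρ-e p x (op z g))))
        (killed-by-eigenvector z (proj₂ (image-parity (relator-monomial A core))) eigen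
          (λ q → ≋-trans (≋-reflexive (ρ-e q x g)) (killed q)) p)
      where open Chevalley±.Positive A (SerreFreeRelation A) (λ r → r) using (image-parity)

    -- At the empty prefix the relator is an eigenvector of `h l`. A further letter is absorbed by
    -- `E j H l = H l E j - a l j E j`.
    H-after : ∀ l u {g} → V g → AnnihilatedAfter (CoreRelator A) u (H l g)
    H-after l []      ann core = eigen-kills (h l) core (proj₂ (h-positive l (relator-monomial A core))) (ann [] core)
    H-after l (j ∷ u) {g} ann {x} core p =
      after-≋ (CoreRelator A) u {H l (E j g) ⊞ ((- a l j) ⊡ E j g)} {E j (H l g)} EH
        (after-+ (CoreRelator A) u {H l (E j g)} {(- a l j) ⊡ E j g}
          (H-after l u {E j g} (E∈ (CoreRelator A) j {g} ann))
          (after-* (CoreRelator A) u (- a l j) {E j g} (E∈ (CoreRelator A) j {g} ann u))) core p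
      where
      EH : (H l (E j g) ⊞ ((- a l j) ⊡ E j g)) ≋ E j (H l g)
      EH w = N-trans (≈ᴹ-sym (*ₗ-distribʳ _ _ _)) (*ₗ-congʳ (trans (+-comm _ _) (-‿+-comm _ _)))
        where
        open LeftModule N using (≈ᴹ-sym; *ₗ-distribʳ; *ₗ-congʳ)
        open RingProperties (CommutativeRing.ring commutativeRing) using (-‿+-comm)

    F-after : ∀ l u {g} → V g → AnnihilatedAfter (CoreRelator A) u (F l g)
    F-after l []      ann core =
      eigen-kills (f l) core (Presented.∼-trans (f-positive l core) (Presented.∼-sym (Presented.*-zeroˡ′ _))) (ann [] core)
    -- The recursion for `F` writes `E j (F l g)` as a signed `F l (E j g)` plus, if `j = l`, the
    -- function `H l g`. So the prefix shrinks and `H-after` covers the diagonal.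
    F-after l (j ∷ u) {g} ann {x} core p =
      after-+ (CoreRelator A) u {sgn (parityOf j ℙ.* parityOf l) ⊡ F l (E j g)}
        {λ w → if does (index-≟ s j l) then H l g w else 0ᴹ}
        (after-* (CoreRelator A) u (sgn (parityOf j ℙ.* parityOf l)) {F l (E j g)} (F-after l u {E j g} (E∈ (CoreRelator A) j {g} ann)))
        diagonal core p
      where
      diagonal : AnnihilatedAfter (CoreRelator A) u (λ w → if does (index-≟ s j l) then H l g w else 0ᴹ)
      diagonal with index-≟ s j l
      ... | yes _ = H-after l u {g} ann
      ... | no  _ = after-0 (CoreRelator A) u

    op∈ : ∀ z {g} → V g → V (op z g)
    op∈ (e i) {g} ann   = E∈ (CoreRelator A) i {g} ann
    op∈ (f i) {g} ann u = F-after i u {g} ann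
    op∈ (h i) {g} ann u = H-after i u {g} ann

  -- Reduces all Serre and commutation relations of 𝔤 to the core relators, for the `eᵢ` and the
  -- `fᵢ` at once.
  module _ (y : I → ChevalleyGenerator) (y-parity : ∀ i → chevalleyParity (y i) ≡ parityOf i)
           {w} (U : Pred Function w) (op∈U : ∀ i {g} → U g → U (op (y i) g))
           (core-kills : ∀ {x} → CoreRelator A x → ∀ p {g} → U g → ρ p (mapᵗ 𝕂 y x) g ≋ 𝟎) where

    private
      odd : ∀ {i} → Ψ i → parityOf i ≡ 1ℙ
      odd {i} ψ with Ψ? i
      ... | yes _ = ≡.refl
      ... | no ¬ψ = ⊥-elim (¬ψ ψ)

      y-HasParity : ∀ {i p} → parityOf i ≡ p → HasParity p (gen (y i))
      y-HasParity {i} eq = gen (≡.trans (≡.sym eq) (≡.sym (y-parity i)))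

      bracket-kills : ∀ i θ → (∀ p {g} → U g → ρ p θ g ≋ 𝟎) → ∀ p {g} → U g → ρ p [ gen (y i) , θ ] g ≋ 𝟎
      bracket-kills i θ θ-kills p {g} g∈ = +ᴹ-zeros (commutator 0ℙ p) (commutator 1ℙ (p ℙ.⁻¹))
        where
        ρ-y : ∀ q r → ρ r θ (ρ q (gen (y i)) g) ≋ 𝟎
        ρ-y q r with chevalleyParity (y i) ℙ.≟ q
        ... | yes _ = θ-kills r (op∈U i {g} g∈)
        ... | no  _ = homo-0 (ρ-linear r θ)

        commutator : ∀ q r → supercommutator q r (ρ q (gen (y i))) (ρ r θ) g ≋ 𝟎
        commutator q r = +ᴹ-zeros
          (≋-trans (cong (ρ-linear q (gen (y i))) (θ-kills r g∈)) (homo-0 (ρ-linear q (gen (y i)))))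
          (*ₗ-zero _ (ρ-y q r))

      mapped : ∀ {x z} → mapᵗ 𝕂 y x ≡ z → (∀ p {g} → U g → ρ p (mapᵗ 𝕂 y x) g ≋ 𝟎) →
               ∀ p {g} → U g → ρ p z g ≋ 𝟎
      mapped ≡.refl k = k

    serre-kills : ∀ {x} → SerreElement x → ∀ p {g} → U g → ρ p (mapᵗ 𝕂 y x) g ≋ 𝟎
    serre-kills (real m re i≢j a≈) = core-kills (real m re i≢j a≈)
    serre-kills (null ψ)           = core-kills (null ψ)
    -- Here `a i j = - 2m`, so the core relator is `(ad yᵢ)^(2m+1) yⱼ`. The power `m + 1` of
    -- `ad [yᵢ,yᵢ]` is a multiple of `(ad yᵢ)^(2m+2)`, which is one more bracket with `yᵢ`.
    serre-kills (oddReal {i} {j} m (ψ , re) i≢j a≈) p {g} g∈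
      with ad-square (y-HasParity (odd ψ)) (y-HasParity {j} ≡.refl) (suc m)
    ... | t , square = ≋-trans
      (≋-reflexive (≡.cong (λ z → ρ p z g) (mapᵗ-ad 𝕂 y [ gen i , gen i ] (suc m) (gen j))))
      (≋-trans (ρ-sound square p g) (*ₗ-zero t
        (bracket-kills i (ad_^_$_ 𝕂 (gen (y i)) (suc (m ℕ.* 2)) (gen (y j))) (mapped {x = ad_^_$_ 𝕂 (gen i) (suc (m ℕ.* 2)) (gen j)}
                            (mapᵗ-ad 𝕂 y (gen i) (suc (m ℕ.* 2)) (gen j))
                            (core-kills (real (m ℕ.* 2) re i≢j (trans a≈ (-‿cong (2·nat m))))))
                       p g∈)))

    commute-kills : ∀ {i j} → a i j ≈ 0# → ∀ p {g} → U g → ρ p [ gen (y i) , gen (y j) ] g ≋ 𝟎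
    commute-kills {i} {j} a≈0 p {g} g∈ with index-≟ s i j
    ... | no i≢j = core-kills (commute i≢j a≈0) p g∈
    -- The commutation relations of 𝔤 include `i = j` with `a i i = 0`. For even `i` the square is 0
    -- anyway, and for odd `i` it is the null Serre element.
    ... | yes ≡.refl = diagonal (parityOf i) ≡.refl
      where
      diagonal : ∀ q → parityOf i ≡ q → ρ p [ gen (y i) , gen (y i) ] g ≋ 𝟎
      diagonal 0ℙ eq = ρ-sound (even-square (y-HasParity eq)) p g
      diagonal 1ℙ eq = core-kills (null (odd-index eq , a≈0)) p g∈
        where
        odd-index : parityOf i ≡ 1ℙ → Ψ i
        odd-index eq with Ψ? i
        ... | yes ψ = ψ
        ... | no _ with () ← eq

  private
    e-kills : ∀ {x} → CoreRelator A x → ∀ p {g} → V g → ρ p (mapᵗ 𝕂 e x) g ≋ 𝟎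
    e-kills {x} core p {g} ann = ≋-trans (≋-reflexive (ρ-e p x g)) (ann [] core p)

    f-kills : ∀ {x} → CoreRelator A x → ∀ p {g} → V g → ρ p (mapᵗ 𝕂 f x) g ≋ 𝟎
    f-kills core p {g} _ = f-relator-kills core p g

    respects : ∀ {x y} → Presentation._≐_ 𝔤-presentation x y → ∀ p {g} → V g → ρ p x g ≋ ρ p y g
    respects (hh i j)     p {g} ann = ρ-respects (hh i j) p g
    respects (he i j)     p {g} ann = ρ-respects (he i j) p g
    respects (hf i j)     p {g} ann = ρ-respects (hf i j) p g
    respects (ef-≡ i)     p {g} ann = ρ-respects (ef-≡ i) p g
    respects (ef-≢ i≢j)   p {g} ann = ρ-respects (ef-≢ i≢j) p g
    respects (serreᵉ x∈)  p {g} ann = serre-kills e (λ _ → ≡.refl) V (λ i {g} → op∈ (e i) {g}) e-kills x∈ p {g} ann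
    respects (serreᶠ x∈)  p {g} ann = serre-kills f (λ _ → ≡.refl) V (λ i {g} → op∈ (f i) {g}) f-kills x∈ p {g} ann
    respects (ee a≈0)     p {g} ann = commute-kills e (λ _ → ≡.refl) V (λ i {g} → op∈ (e i) {g}) e-kills a≈0 p {g} ann
    respects (ff a≈0)     p {g} ann = commute-kills f (λ _ → ≡.refl) V (λ i {g} → op∈ (f i) {g}) f-kills a≈0 p {g} ann

  -- The relators in the `fᵢ` kill every function, those in the `eᵢ` only the functions in `V`. This
  -- decides the choice of subspace.
  module 𝔤-action = Soundness 𝔤-presentation op-linear V
    (λ u → after-0 (CoreRelator A) u)
    (λ {g} {k} ann ann′ u → after-+ (CoreRelator A) u {g} {k} (ann u) (ann′ u))
    (λ t {g} ann u → after-* (CoreRelator A) u t {g} (ann u))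
    op∈ respects

-- The truncated orbit of a derivation and injectivity in degree 𝐤.

module TruncatedOrbit {c ℓ₁ ℓ₂ ℓ₃} {𝕂 : ScalarField c ℓ₁ ℓ₂ ℓ₃} {s : IndexSet} (A : BKMSupermatrix 𝕂 s)
                      (i₀ : ⟦ s ⟧) where
  open ScalarField 𝕂 hiding (zeroˡ; zeroʳ; ring; _≤_)
  open RingProperties (CommutativeRing.ring commutativeRing) using (-0#≈0#)
  open Scalars 𝕂 using (nat; nat-+)
  open BKM 𝕂 A using (I; a; Iʳᵉ; Ψ₀; parityOf; SerreElement; HalvedSerreElement;
                      real; oddReal; null; halved; LS-presentation; multidegree; zeroPattern; module 𝔤; φ)
  open Presented 𝕂 LS-presentation hiding (0∈; +∈; *∈)
  open LieCalculus 𝕂 LS-presentation using (+-idʳ; [,]-0ˡ; [,]-0ʳ; *-cancel; jacobi′)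
    renaming (*ₗ-zero to *-zero; +ᴹ-zeros to +-zeros; *ₗ-commute to *-commute)
  open Multidegree A
  open CoinducedAction A whole
  open Coinduced A whole
  open LeftModule W using () renaming
    ( Carrierᴹ to Function; _≈ᴹ_ to _≋_; ≈ᴹ-refl to ≋-refl; ≈ᴹ-sym to ≋-sym; ≈ᴹ-trans to ≋-trans
    ; ≈ᴹ-reflexive to ≋-reflexive; _+ᴹ_ to _⊞_; _*ₗ_ to _⊡_; 0ᴹ to 𝟎; +ᴹ-cong to ⊞-cong; *ₗ-congˡ to ⊡-congˡ)
  open Action 𝕂 W
  open IsLinear
  open LeftModule whole using (≈ᴹ-setoid)
  open SetoidReasoning ≈ᴹ-setoid

  -- orbit y  is the image of y under the map from the adjoint module
  -- to the coinduced one.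
  orbit : Elt → Function
  orbit y []      = y
  orbit y (i ∷ w) = orbit [ gen i , y ] w

  orbit-cong : ∀ {y z} → y ∼ z → orbit y ≋ orbit z
  orbit-cong e []      = e
  orbit-cong e (i ∷ w) = orbit-cong ([,]-cong ∼-refl e) w

  orbit-+ : ∀ y z → orbit (y +ᵗ z) ≋ (orbit y ⊞ orbit z)
  orbit-+ y z []      = ∼-refl
  orbit-+ y z (i ∷ w) = ∼-trans (orbit-cong ([,]-+ʳ (gen i) y z) w) (orbit-+ _ _ w)

  orbit-* : ∀ t y → orbit (t *ᵗ y) ≋ (t ⊡ orbit y)
  orbit-* t y []      = ∼-refl
  orbit-* t y (i ∷ w) = ∼-trans (orbit-cong ([,]-*ʳ t (gen i) y) w) (orbit-* t _ w)

  orbit-0 : ∀ {y} → y ∼ 0ᵗ → orbit y ≋ 𝟎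
  orbit-0 e []      = e
  orbit-0 e (i ∷ w) = orbit-0 ([,]-0ʳ (gen i) e) w

  orbit-combination : ∀ t y z → orbit (y +ᵗ t *ᵗ z) ≋ (orbit y ⊞ (t ⊡ orbit z))
  orbit-combination t y z = ≋-trans (orbit-+ y (t *ᵗ z)) (⊞-cong {orbit y} {orbit y} ≋-refl (orbit-* t z))

  -- Equivariance of `orbit`. It holds for generators by construction, and `jacobi′` carries it over
  -- to brackets.
  act-orbit : ∀ {p q x z} → HasParity p x → HasParity q z → ρᵉ p x (orbit z) ≋ orbit [ x , z ]
  act-orbit {z = z} (gen {x = i} ≡.refl) hz =
    ≋-reflexive (act-gen parityOf E-linear i (orbit z))
  act-orbit 0ᵗ hz = ≋-sym (orbit-0 ([,]-0ˡ _ ∼-refl))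
  act-orbit {x = x +ᵗ y} {z} (hx +ᵗ hy) hz = ≋-trans (⊞-cong (act-orbit hx hz) (act-orbit hy hz))
    (≋-sym (≋-trans (orbit-cong ([,]-+ˡ x y z)) (orbit-+ _ _)))
  act-orbit {x = t *ᵗ x} {z} (_ *ᵗ hx) hz = ≋-trans (⊡-congˡ (act-orbit hx hz))
    (≋-sym (≋-trans (orbit-cong ([,]-*ˡ t x z)) (orbit-* t _)))
  act-orbit {z = z} ([_,_] {p} {q} {x = x} {y} hx hy {eq}) hz =
    ≋-trans (act-bracket parityOf E-linear hx hy eq (orbit z))
    (≋-trans (⊞-cong
      (≋-trans (cong (ρᵉ-linear p x) (act-orbit hy hz)) (act-orbit hx ([_,_] hy hz {≡.refl})))
      (⊡-congˡ (≋-trans (cong (ρᵉ-linear q y) (act-orbit hx hz)) (act-orbit hy ([_,_] hx hz {≡.refl})))))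
    (≋-trans (≋-sym (orbit-combination _ _ _)) (orbit-cong (jacobi′ hx hy hz))))

  -- The orbit of the derivation d with [ x , d ] = n x for x of degree n in eᵢ₀.
  Φ : Function
  Φ []      = 0ᵗ
  Φ (j ∷ w) = orbit (nat (δ i₀ j) *ᵗ gen j) w

  -- The right side is the orbit of `[x,d]`. For a bracket, `derivation` evaluates `[[x,y],d]` from
  -- `[x,d] = m x` and `[y,d] = n y`.
  act-Φ : ∀ {p n x} → DegreeIn i₀ n x → HasParity p x → ρᵉ p x Φ ≋ orbit (nat n *ᵗ x)
  act-Φ (gen ≡.refl) (gen {x = i} ≡.refl) = ≋-reflexive (act-gen parityOf E-linear i Φ)
  act-Φ 0ᵗ 0ᵗ = ≋-sym (orbit-0 (*-zeroʳ′ _))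
  act-Φ (dx +ᵗ dy) (hx +ᵗ hy) =
    ≋-trans (⊞-cong (act-Φ dx hx) (act-Φ dy hy)) (≋-sym (≋-trans (orbit-cong (*-distˡ _ _ _)) (orbit-+ _ _)))
  act-Φ (_ *ᵗ dx) (t *ᵗ hx) =
    ≋-trans (⊡-congˡ (act-Φ dx hx)) (≋-sym (≋-trans (orbit-cong (*-commute _ t _)) (orbit-* t _)))
  act-Φ ([_,_] {m} {n} {x = x} {y} dx dy {≡.refl}) ([_,_] {p} {q} hx hy {eq}) =
    ≋-trans (act-bracket parityOf E-linear hx hy eq Φ)
    (≋-trans (⊞-cong
      (≋-trans (cong (ρᵉ-linear p x) (act-Φ dy hy)) (act-orbit hx (_ *ᵗ hy)))
      (⊡-congˡ (≋-trans (cong (ρᵉ-linear q y) (act-Φ dx hx)) (act-orbit hy (_ *ᵗ hx)))))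
    (≋-trans (≋-sym (orbit-combination _ _ _)) (orbit-cong derivation)))
    where
    σ : Carrier
    σ = - sgn (p ℙ.* q)

    derivation : [ x , nat n *ᵗ y ] +ᵗ σ *ᵗ [ y , nat m *ᵗ x ] ∼ nat (m ℕ.+ n) *ᵗ [ x , y ]
    derivation = begin
      [ x , nat n *ᵗ y ] +ᵗ σ *ᵗ [ y , nat m *ᵗ x ]
        ≈⟨ +-cong′ ([,]-*ʳ _ _ _) (∼-trans (*-cong′ refl ([,]-*ʳ _ _ _)) (*-commute _ _ _)) ⟩
      nat n *ᵗ [ x , y ] +ᵗ nat m *ᵗ (σ *ᵗ [ y , x ])
        ≈⟨ +-cong′ ∼-refl (*-cong′ refl (skew hx hy)) ⟨
      nat n *ᵗ [ x , y ] +ᵗ nat m *ᵗ [ x , y ]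
        ≈⟨ *-distʳ _ _ _ ⟨
      (nat n + nat m) *ᵗ [ x , y ]
        ≈⟨ *-cong′ (trans (+-comm _ _) (sym (nat-+ m n))) ∼-refl ⟩
      nat (m ℕ.+ n) *ᵗ [ x , y ] ∎

  indicator : ∀ {b} {B : Set b} → Dec B → Carrier
  indicator d = if does d then 1# else 0#

  indicator-cong : ∀ {b b′} {B : Set b} {B′ : Set b′} (d : Dec B) (d′ : Dec B′) →
                   (B → B′) → (B′ → B) → indicator d ≡ indicator d′
  indicator-cong (yes _) (yes _)  _  _    = ≡.refl
  indicator-cong (no  _) (no  _)  _  _    = ≡.refl
  indicator-cong (yes p) (no ¬p′) to _    = ⊥-elim (¬p′ (to p))
  indicator-cong (no ¬p) (yes p′) _  from = ⊥-elim (¬p (from p′))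

  indicator-no : ∀ {b} {B : Set b} (d : Dec B) → ¬ B → indicator d ≡ 0#
  indicator-no (yes p) ¬p = ⊥-elim (¬p p)
  indicator-no (no _)  _  = ≡.refl

  indicator-yes : ∀ {b} {B : Set b} (d : Dec B) → B → indicator d ≡ 1#
  indicator-yes (yes _) _ = ≡.refl
  indicator-yes (no ¬p) p = ⊥-elim (¬p p)

  cutoff : (I → ℕ) → List I → Carrier
  cutoff k w = indicator (bounded? k w)

  truncate : (I → ℕ) → Function → Function
  truncate k g w = cutoff k w *ᵗ g w

  truncate-linear : ∀ k → IsLinear (truncate k)
  truncate-linear k = record
    { cong   = λ e w → *-cong′ refl (e w)
    ; homo-+ = λ _ _ _ → *-distˡ _ _ _
    ; homo-* = λ _ _ _ → *-commute _ _ _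
    }

  -- A term of degree `l` evaluates `g` at words longer by `l`. Cutting off at `k` before it acts is
  -- therefore cutting off at `k - l` afterwards, with the subtraction expressed by `k = l + k′`.
  act-truncate : ∀ {l x} → Homogeneous 𝕂 ℤ₊[ I ] multidegree l x → ∀ {k k′} →
                 (∀ i → k i ≡ at l i ℕ.+ k′ i) → ∀ p g →
                 ρᵉ p x (truncate k g) ≋ truncate k′ (ρᵉ p x g)
  act-truncate (gen {l} {j} l≡) {k} {k′} k≡ p g w with parityOf j ℙ.≟ p
  ... | no  _ = ∼-sym (*-zeroʳ′ _)
  ... | yes _ = *-cong′ (reflexive (indicator-cong (bounded? k (j ∷ w)) (bounded? k′ w) lower raise)) ∼-refl
    where
    k≡′ : ∀ i → k i ≡ δ i j ℕ.+ k′ i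
    k≡′ i = ≡.trans (k≡ i) (≡.cong (ℕ._+ k′ i) (l≡ i))
    lower : Bounded k (j ∷ w) → Bounded k′ w
    lower b i = ℕ.+-cancelˡ-≤ (δ i j) _ _ (≡.subst (δ i j ℕ.+ count i w ≤_) (k≡′ i) (b i))
    raise : Bounded k′ w → Bounded k (j ∷ w)
    raise b i = ≡.subst (δ i j ℕ.+ count i w ≤_) (≡.sym (k≡′ i)) (ℕ.+-monoʳ-≤ (δ i j) (b i))
  act-truncate 0ᵗ k≡ p g w = ∼-sym (*-zeroʳ′ _)
  act-truncate (hx +ᵗ hy) k≡ p g w =
    ∼-trans (+-cong′ (act-truncate hx k≡ p g w) (act-truncate hy k≡ p g w)) (∼-sym (*-distˡ _ _ _))
  act-truncate (t *ᵗ hx) k≡ p g w =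
    ∼-trans (*-cong′ refl (act-truncate hx k≡ p g w)) (*-commute t _ _)
  act-truncate ([_,_] {m} {n} {l} {x} {y} hx hy {l≡}) {k} {k′} k≡ p g =
    ≋-trans (⊞-cong (both 0ℙ p) (both 1ℙ (p ℙ.⁻¹))) (≋-sym (homo-+ (truncate-linear k′) _ _))
    where
    k≡′ : ∀ i → k i ≡ at m i ℕ.+ (at n i ℕ.+ k′ i)
    k≡′ i = ≡.trans (k≡ i) (≡.trans (≡.cong (ℕ._+ k′ i) (l≡ i)) (ℕ.+-assoc (at m i) _ _))
    k≡″ : ∀ i → k i ≡ at n i ℕ.+ (at m i ℕ.+ k′ i)
    k≡″ i = ≡.trans (k≡ i) (≡.trans (≡.cong (ℕ._+ k′ i) (≡.trans (l≡ i) (ℕ.+-comm (at m i) _)))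
                                    (ℕ.+-assoc (at n i) _ _))
    both : ∀ q r → supercommutator q r (ρᵉ q x) (ρᵉ r y) (truncate k g) ≋
                   truncate k′ (supercommutator q r (ρᵉ q x) (ρᵉ r y) g)
    both q r = ≋-trans
      (⊞-cong
        (≋-trans (cong (ρᵉ-linear q x) (act-truncate hy k≡″ r g))
                 (act-truncate hx (λ _ → ≡.refl) q (ρᵉ r y g)))
        (⊡-congˡ (≋-trans (cong (ρᵉ-linear r y) (act-truncate hx k≡′ q g))
                          (act-truncate hy (λ _ → ≡.refl) r (ρᵉ q x g)))))
      (≋-sym (homo-combination (truncate-linear k′) _ _ _))

  VanishesFrom : I → ℕ → Pred Function _
  VanishesFrom i n g = ∀ w → n ≤ count i w → g w ∼ 0ᵗ

  -- A term of degree `m` in the letter `i` evaluates `g` only at words that contain `m` further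
  -- copies of `i`.
  act-vanishesFrom : ∀ i {m x} → DegreeIn i m x → ∀ p {n g} →
                     VanishesFrom i (m ℕ.+ n) g → VanishesFrom i n (ρᵉ p x g)
  act-vanishesFrom i (gen {x = j} ≡.refl) p van w n≤ with parityOf j ℙ.≟ p
  ... | yes _ = van (j ∷ w) (ℕ.+-monoʳ-≤ (δ i j) n≤)
  ... | no  _ = ∼-refl
  act-vanishesFrom i 0ᵗ        p van w n≤ = ∼-refl
  act-vanishesFrom i (x +ᵗ y)  p van w n≤ =
    +-zeros (act-vanishesFrom i x p van w n≤) (act-vanishesFrom i y p van w n≤)
  act-vanishesFrom i (t *ᵗ x)  p van w n≤ = *-zero t (act-vanishesFrom i x p van w n≤)
  act-vanishesFrom i ([_,_] {l} {m} {x = x} {y} dx dy {≡.refl}) p {n} {g} van w n≤ =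
    +-zeros (both 0ℙ p) (both 1ℙ (p ℙ.⁻¹))
    where
    van′ : VanishesFrom i (l ℕ.+ (m ℕ.+ n)) g
    van′ = ≡.subst (λ k → VanishesFrom i k g) (ℕ.+-assoc l m n) van
    van″ : VanishesFrom i (m ℕ.+ (l ℕ.+ n)) g
    van″ = ≡.subst (λ k → VanishesFrom i k g) (≡.trans (≡.cong (ℕ._+ n) (ℕ.+-comm l m)) (ℕ.+-assoc m l n)) van
    both : ∀ q r → supercommutator q r (ρᵉ q x) (ρᵉ r y) g w ∼ 0ᵗ
    both q r = +-zeros (act-vanishesFrom i dx q (act-vanishesFrom i dy r van″) w n≤)
                       (*-zero _ (act-vanishesFrom i dy r (act-vanishesFrom i dx q van′) w n≤))

  -- One predicate for both parts: the core relators lead to the 𝔤-module and contain the relations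
  -- of LS, and the others generate the ideal.
  Relator : Pred Elt (c ⊔ ℓ₁)
  Relator = CoreRelator A ∪ (SerreElement ∪ HalvedSerreElement)

  relator : ∀ {i j} → i ≢ j → a i j ≈ 0# → [ gen i , gen j ] ∼ 0ᵗ
  relator i≢j a≈0 = relation (commute i≢j λ { (_ , a#0) → #-irrefl a≈0 a#0 })

  module _ (k : I → ℕ) where

    truncatedΦ : Function
    truncatedΦ = truncate k Φ

    private
      -- Two supercommuting letters may be exchanged at any position of the word, up to sign;
      -- `jacobi′` does this at the place reached after the prefix `u`.
      swap-orbit : ∀ {i j q z} → [ gen i , gen j ] ∼ 0ᵗ → HasParity q z → ∀ u w →
        orbit z (u ++ j ∷ i ∷ w) +ᵗ (- sgn (parityOf i ℙ.* parityOf j)) *ᵗ orbit z (u ++ i ∷ j ∷ w) ∼ 0ᵗ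
      swap-orbit {z = z} e hz [] w =
        ∼-trans (∼-sym (orbit-combination _ _ _ w))
          (orbit-0 (∼-trans (jacobi′ (gen ≡.refl) (gen ≡.refl) hz) ([,]-0ˡ z e)) w)
      swap-orbit e hz (l ∷ u) w = swap-orbit e ([_,_] (gen ≡.refl) hz {≡.refl}) u w

      swap-Φ : ∀ {i j} → [ gen i , gen j ] ∼ 0ᵗ → [ gen j , gen i ] ∼ 0ᵗ → ∀ u w →
        Φ (u ++ j ∷ i ∷ w) +ᵗ (- sgn (parityOf i ℙ.* parityOf j)) *ᵗ Φ (u ++ i ∷ j ∷ w) ∼ 0ᵗ
      -- Next to d itself both terms vanish separately, being orbits of multiples of `[eᵢ,eⱼ]` and
      -- of `[eⱼ,eᵢ]`.
      swap-Φ e e′ [] w = +-zeros (orbit-0 (∼-trans ([,]-*ʳ _ _ _) (*-zero _ e)) w)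
                                 (*-zero _ (orbit-0 (∼-trans ([,]-*ʳ _ _ _) (*-zero _ e′)) w))
      swap-Φ e e′ (l ∷ u) w = swap-orbit e (_ *ᵗ gen ≡.refl) u w

      commuting : ∀ {i j} → i ≢ j → a i j ≈ 0# → ∀ u p →
                  ρᵉ p [ gen i , gen j ] (shift u truncatedΦ) ≋ 𝟎
      commuting {i} {j} i≢j a≈0 u = act-relation parityOf E-linear {i} {j} {0ᵗ} 0ᵗ {shift u truncatedΦ} λ w → begin
        cutoff k (u ++ j ∷ i ∷ w) *ᵗ Φ (u ++ j ∷ i ∷ w) +ᵗ
        (- σ) *ᵗ (cutoff k (u ++ i ∷ j ∷ w) *ᵗ Φ (u ++ i ∷ j ∷ w))
          -- The cutoff depends only on how often each letter occurs, so exchanging two letters does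
          -- not change it.
          ≡⟨ ≡.cong (λ t → t *ᵗ Φ (u ++ j ∷ i ∷ w) +ᵗ (- σ) *ᵗ (cutoff k (u ++ i ∷ j ∷ w) *ᵗ Φ (u ++ i ∷ j ∷ w))) (swapped w) ⟩
        cutoff k (u ++ i ∷ j ∷ w) *ᵗ Φ (u ++ j ∷ i ∷ w) +ᵗ
        (- σ) *ᵗ (cutoff k (u ++ i ∷ j ∷ w) *ᵗ Φ (u ++ i ∷ j ∷ w))
          ≈⟨ +-cong′ ∼-refl (*-commute _ _ _) ⟩
        cutoff k (u ++ i ∷ j ∷ w) *ᵗ Φ (u ++ j ∷ i ∷ w) +ᵗ
        cutoff k (u ++ i ∷ j ∷ w) *ᵗ ((- σ) *ᵗ Φ (u ++ i ∷ j ∷ w))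
          ≈⟨ *-distˡ _ _ _ ⟨
        cutoff k (u ++ i ∷ j ∷ w) *ᵗ (Φ (u ++ j ∷ i ∷ w) +ᵗ (- σ) *ᵗ Φ (u ++ i ∷ j ∷ w))
          ≈⟨ *-zero _ (swap-Φ (relator i≢j a≈0)
               (relator (i≢j ∘ ≡.sym) (Equivalence.to (zeroPattern i j) a≈0)) u w) ⟩
        0ᵗ ∎
        where
        σ : Carrier
        σ = sgn (parityOf i ℙ.* parityOf j)
        swapped : ∀ w → cutoff k (u ++ j ∷ i ∷ w) ≡ cutoff k (u ++ i ∷ j ∷ w)
        swapped w = indicator-cong (bounded? k (u ++ j ∷ i ∷ w)) (bounded? k (u ++ i ∷ j ∷ w))
          (λ b l → ≡.subst (_≤ k l) (count-swap l u w) (b l))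
          (λ b l → ≡.subst (_≤ k l) (count-swap l u w) (b l))

      -- A term of degree at least 2 in `i` evaluates the function only at words with two letters
      -- `i`, and the cutoff at `k i ≤ 1` has removed those.
      repeated : ∀ {i m x} → k i ≤ 1 → 2 ≤ m → DegreeIn i m x → ∀ u p →
                 ρᵉ p x (shift u truncatedΦ) ≋ 𝟎
      repeated {i} {m} ki≤1 2≤m dx u p w = act-vanishesFrom i dx p vanishes-u w z≤n
        where
        vanishes-u : VanishesFrom i (m ℕ.+ 0) (shift u truncatedΦ)
        vanishes-u w m≤ = ∼-trans
          (*-cong′ (reflexive (indicator-no (bounded? k (u ++ w)) λ b → ℕ.<-irrefl ≡.refl
            (ℕ.≤-trans (ℕ.≤-trans 2≤m (ℕ.≤-trans (ℕ.m≤m+n m 0) (ℕ.≤-trans m≤ (count-++ i u w))))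
                       (ℕ.≤-trans (b i) ki≤1)))) ∼-refl)
          (*-zeroˡ′ _)

      degree-gen : ∀ i → DegreeIn i 1 (gen i)
      degree-gen i = gen (≡.sym (δ-≡ i))

      degree-ad : ∀ {i m n x y} → DegreeIn i m x → DegreeIn i n y → ∀ r →
                  DegreeIn i (r ℕ.* m ℕ.+ n) (ad_^_$_ 𝕂 x r y)
      degree-ad dx dy zero = dy
      degree-ad {m = m} {n} dx dy (suc r) =
        [_,_] dx (degree-ad dx dy r) {ℕ.+-assoc m (r ℕ.* m) n}

    module _ (small : ∀ i → Iʳᵉ i ⊎ Ψ₀ i → k i ≤ 1) where

      private
        real-chain : ∀ {i j m} → Iʳᵉ i → i ≢ j → a i j ≈ - nat m → ∀ u p →
                     ρᵉ p (ad_^_$_ 𝕂 (gen i) (suc m) (gen j)) (shift u truncatedΦ) ≋ 𝟎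
        -- With `a i j = 0` the Serre element is `[eᵢ,eⱼ]`, of degree 1 in `i`; the degree argument
        -- does not reach it, but it is 0 in LS.
        real-chain {m = zero}  re i≢j a≈ = commuting i≢j (trans a≈ -0#≈0#)
        real-chain {i} {j} {suc m} re i≢j a≈ =
          repeated (small i (inj₁ re)) (s≤s (s≤s z≤n)) (degree-ad (degree-gen i) (gen ≡.refl) (suc (suc m)))

        null-square : ∀ {i} → Ψ₀ i → ∀ u p → ρᵉ p [ gen i , gen i ] (shift u truncatedΦ) ≋ 𝟎
        null-square {i} ψ = repeated (small i (inj₂ ψ)) ℕ.≤-refl ([_,_] (degree-gen i) (degree-gen i) {≡.refl})

      truncatedΦ-annihilated : Annihilated Relator truncatedΦ
      truncatedΦ-annihilated u (inj₁ (real m re i≢j a≈))  = real-chain {m = m} re i≢j a≈ u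
      truncatedΦ-annihilated u (inj₁ (null ψ))            = null-square ψ u
      truncatedΦ-annihilated u (inj₁ (commute i≢j a≈0))   = commuting i≢j a≈0 u
      truncatedΦ-annihilated u (inj₂ (inj₁ (real m re i≢j a≈))) = real-chain {m = m} re i≢j a≈ u
      truncatedΦ-annihilated u (inj₂ (inj₁ (null ψ)))     = null-square ψ u
      -- Each factor `[eᵢ,eᵢ]` has degree 2 in `i`, so the degree bound covers `m = 0` as well.
      truncatedΦ-annihilated u (inj₂ (inj₁ (oddReal {i} m (_ , re) i≢j a≈))) =
        repeated (small i (inj₁ re)) (s≤s (s≤s z≤n))
          (degree-ad ([_,_] (degree-gen i) (degree-gen i) {≡.refl}) (gen ≡.refl) (suc m)) u
      truncatedΦ-annihilated u (inj₂ (inj₂ (halved zero (_ , re) i≢j a≈))) =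
        commuting i≢j (trans a≈ (trans (-‿cong (trans (+-cong refl (+-identityʳ 0#)) (+-identityʳ 0#))) -0#≈0#)) u
      truncatedΦ-annihilated u (inj₂ (inj₂ (halved {i} (suc m) (_ , re) i≢j a≈))) =
        repeated (small i (inj₁ re)) (s≤s (s≤s z≤n)) (degree-ad (degree-gen i) (gen ≡.refl) (suc (suc m))) u

      private
        respects : ∀ {x y} → x ≐ y → ∀ p {g} → Annihilated Relator g → ρᵉ p x g ≋ ρᵉ p y g
        respects (commute i≢j ¬adjacent) p ann =
          -- Non-adjacency only denies `a i j # 0#`; tightness of the apartness turns this into
          -- `a i j ≈ 0#`.
          ann [] (inj₁ (commute i≢j (proj₁ (tight _ _) λ a#0 → ¬adjacent (i≢j , a#0)))) p

      module LS-action = Soundness LS-presentation E-linear (Annihilated Relator)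
        (λ u → after-0 Relator u)
        (λ {g} {k} ann ann′ u → after-+ Relator u {g} {k} (ann u) (ann′ u))
        (λ t {g} ann u → after-* Relator u t {g} (ann u))
        (λ i {g} → E∈ Relator i {g})
        respects

      ideal-annihilates : ∀ {x} → Ideal (SerreElement ∪ HalvedSerreElement) x →
                          ∀ p {g} → Annihilated Relator g → ρᵉ p x g ≋ 𝟎
      ideal-annihilates (Ideal.incl x∈)      p ann = ann [] (inj₂ x∈) p
      ideal-annihilates (Ideal.resp x∼y x∈)  p ann =
        ≋-trans (≋-sym (LS-action.act-sound x∼y p ann)) (ideal-annihilates x∈ p ann)
      ideal-annihilates Ideal.0∈             p ann = ≋-refl
      ideal-annihilates (Ideal.+∈ x∈ y∈)     p ann =
        +ᴹ-zeros (ideal-annihilates x∈ p ann) (ideal-annihilates y∈ p ann)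
      ideal-annihilates (Ideal.*∈ t x∈)      p ann = *ₗ-zero t (ideal-annihilates x∈ p ann)
      ideal-annihilates (Ideal.[,]∈ˡ {x} y x∈) p {g} ann = +ᴹ-zeros (both 0ℙ p) (both 1ℙ (p ℙ.⁻¹))
        where
        both : ∀ q r → supercommutator q r (ρᵉ q x) (ρᵉ r y) g ≋ 𝟎
        both q r = +ᴹ-zeros (ideal-annihilates x∈ q (LS-action.act∈ r y {g} ann))
          (*ₗ-zero _ (≋-trans (cong (ρᵉ-linear r y) (ideal-annihilates x∈ q ann)) (homo-0 (ρᵉ-linear r y))))
      ideal-annihilates (Ideal.[,]∈ʳ x {y} y∈) p {g} ann = +ᴹ-zeros (both 0ℙ p) (both 1ℙ (p ℙ.⁻¹))
        where
        both : ∀ q r → supercommutator q r (ρᵉ q x) (ρᵉ r y) g ≋ 𝟎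
        both q r = +ᴹ-zeros
          (≋-trans (cong (ρᵉ-linear q x) (ideal-annihilates y∈ r ann)) (homo-0 (ρᵉ-linear q x)))
          (*ₗ-zero _ (ideal-annihilates y∈ r (LS-action.act∈ q x {g} ann)))

  module _ {k : CommutativeMonoid.Carrier ℤ₊[ I ]} (ki₀≢0 : at k i₀ ≢ 0) (small : ∀ i → Iʳᵉ i ⊎ Ψ₀ i → at k i ≤ 1) where

    private
      open ParitySplitting 𝕂 LS-presentation ℤ₊[ I ] multidegree

      homogeneous-zero : ∀ {p x} → Homogeneous 𝕂 ℤ₊[ I ] multidegree k x → HasParity p x →
                         ρᵉ p x (truncatedΦ (at k)) [] ∼ 0ᵗ → x ∼ 0ᵗ
      homogeneous-zero {p} {x} hx px killed = nat-cancel ki₀≢0 (begin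
        nat (at k i₀) *ᵗ x                     ≈⟨ act-Φ (coordinate i₀ hx) px [] ⟨
        ρᵉ p x Φ []                            ≈⟨ *-idˡ _ ⟨
        -- The action of `x` uses up the whole bound `at k` and leaves the cutoff at degree 0, which
        -- still admits the empty word.
        1# *ᵗ ρᵉ p x Φ []                      ≡⟨ ≡.cong (_*ᵗ ρᵉ p x Φ []) (indicator-yes (bounded? (λ _ → 0) []) λ _ → z≤n) ⟨
        truncate (λ _ → 0) (ρᵉ p x Φ) []       ≈⟨ act-truncate hx (λ i → ≡.sym (ℕ.+-identityʳ (at k i))) p Φ [] ⟨
        ρᵉ p x (truncatedΦ (at k)) []          ≈⟨ killed ⟩
        0ᵗ                                     ∎)
        where
        nat-cancel : ∀ {n} → n ≢ 0 → nat n *ᵗ x ∼ 0ᵗ → x ∼ 0ᵗ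
        nat-cancel {zero}  0≢0 _ = ⊥-elim (0≢0 ≡.refl)
        nat-cancel {suc n} _   e = *-cancel (charZero n) e

    -- The term `x` equals the sum of its parts only modulo `∼`. The hypothesis is carried over to
    -- the parts by soundness of the LS-action on the annihilated functions.
    faithful : ∀ {x} → Homogeneous 𝕂 ℤ₊[ I ] multidegree k x →
               (∀ p → ρᵉ p x (truncatedΦ (at k)) ≋ 𝟎) → x ∼ 0ᵗ
    faithful {x} hx killed = ∼-trans (part-sum x) (+-zeros (part-zero 0ℙ) (part-zero 1ℙ))
      where
      g : Function
      g = truncatedΦ (at k)

      only : ∀ p → ρᵉ p (part 0ℙ x +ᵗ part 1ℙ x) g ≋ ρᵉ p (part p x) g
      only 0ℙ w = ∼-trans (+-cong′ ∼-refl (act-vanishes parityOf E-linear (part-parity 1ℙ x) (λ ()) g w)) (+-idʳ _)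
      only 1ℙ w = ∼-trans (+-cong′ (act-vanishes parityOf E-linear (part-parity 0ℙ x) (λ ()) g w) ∼-refl) (+-idˡ _)

      part-zero : ∀ p → part p x ∼ 0ᵗ
      part-zero p = homogeneous-zero (part-homogeneous p hx) (part-parity p x)
        (∼-trans (∼-sym (only p []))
        (∼-trans (∼-sym (LS-action.act-sound (at k) small (part-sum x) p
                          {g} (truncatedΦ-annihilated (at k) small) []))
                 (killed p [])))

    ideal-trivial : ∀ {x} → Homogeneous 𝕂 ℤ₊[ I ] multidegree k x →
                    Ideal (SerreElement ∪ HalvedSerreElement) x → x ∼ 0ᵗ
    ideal-trivial hx x∈ = faithful hx λ p →
      ideal-annihilates (at k) small x∈ p {truncatedΦ (at k)} (truncatedΦ-annihilated (at k) small)

    φ-kernel-trivial : ∀ {x} → Homogeneous 𝕂 ℤ₊[ I ] multidegree k x →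
                       𝔤._∼_ (φ x) 0ᵗ → x ∼ 0ᵗ
    φ-kernel-trivial {x} hx φx∼0 = faithful hx λ p →
      ≋-trans (≋-sym (≋-reflexive (ρ-e p x (truncatedΦ (at k)))))
        (𝔤-action.act-sound φx∼0 p {truncatedΦ (at k)}
          (λ u core → truncatedΦ-annihilated (at k) small u (inj₁ core)))

-- Triangular decomposition of 𝔤 and surjectivity.

module Triangular {c ℓ₁ ℓ₂ ℓ₃} {𝕂 : ScalarField c ℓ₁ ℓ₂ ℓ₃} {s : IndexSet} (A : BKMSupermatrix 𝕂 s) where
  open ScalarField 𝕂 hiding (zeroˡ; zeroʳ; ring)
  open BKM 𝕂 A using (I; parityOf; multidegree; e; f; h;
                      rootDegree; 𝔤-presentation; φ; hh; he; hf; ef-≡; ef-≢; _≐ᴮ_)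
  open Presented 𝕂 𝔤-presentation hiding (0∈; +∈; *∈)
  open LieCalculus 𝕂 𝔤-presentation
  open Span 𝕂 𝔤-presentation
  open Multidegree A using (δ)
  open Words A
  open ParitySplitting 𝕂 𝔤-presentation (rootLattice I) rootDegree

  serreFree⇒𝔤 : ∀ {x y} → SerreFreeRelation A x y → x ≐ᴮ y
  serreFree⇒𝔤 (hh i j)   = hh i j
  serreFree⇒𝔤 (he i j)   = he i j
  serreFree⇒𝔤 (hf i j)   = hf i j
  serreFree⇒𝔤 (ef-≡ i)   = ef-≡ i
  serreFree⇒𝔤 (ef-≢ i≢j) = ef-≢ i≢j

  open Chevalley± A _≐ᴮ_ serreFree⇒𝔤 using (base; h-positive; module Negative; module Positive)

  module Lower₋ = Negative.Lowering (λ n → ℤ.- (+ n)) (λ m n → ℤ.neg-distrib-+ (+ m) (+ n))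
  module Lower₊ = Positive.Lowering (λ n → + n) (λ _ _ → ≡.refl)

  -- A spanning family of degree `γ`, with no claim of linear independence. Degrees are bare
  -- functions compared pointwise, so supports need not be tracked.
  data Basis (γ : I → ℤ) : Pred Elt c where
    neg : ∀ i w → (∀ j → γ j ≡ ℤ.- (+ at (wordDegree i w) j)) → Basis γ (mapᵗ 𝕂 f (word i w))
    car : ∀ i → (∀ j → γ j ≡ + 0) → Basis γ (gen (h i))
    pos : ∀ i w → (∀ j → γ j ≡ + at (wordDegree i w) j) → Basis γ (mapᵗ 𝕂 e (word i w))

  basis-parity : ∀ {γ x} → Basis γ x → ∃ λ p → HasParity p x
  basis-parity (neg i w _) = Negative.image-parity (word-monomial i w)
  basis-parity (car i _)   = _ , gen ≡.refl
  basis-parity (pos i w _) = Positive.image-parity (word-monomial i w)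

  private
    root-e : ∀ i j → at (rootDegree (e i)) j ≡ + δ j i
    root-e i j with index-≟ s i j
    ... | yes _ = ≡.refl
    ... | no  _ = ≡.refl

    root-f : ∀ i j → at (rootDegree (f i)) j ≡ ℤ.- (+ δ j i)
    root-f i j with index-≟ s i j
    ... | yes _ = ≡.refl
    ... | no  _ = ≡.refl

    from₋ : ∀ {γ x} → Lower₋.Borel γ x → Spanned (Basis γ) x
    from₋ (Lower₋.nilpotent i w γ≡) = incl (neg i w γ≡)
    from₋ (Lower₋.cartan i γ≡)      = incl (car i γ≡)

    from₊ : ∀ {γ x} → Lower₊.Borel γ x → Spanned (Basis γ) x
    from₊ (Lower₊.nilpotent i w γ≡) = incl (pos i w γ≡)
    from₊ (Lower₊.cartan i γ≡)      = *∈ _ (incl (car i γ≡))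

    +-commute-cartan : ∀ {x y} → HasParity 0ℙ y → ∀ {p} → HasParity p x → ∀ {t} → [ y , x ] ∼ t *ᵗ x →
                       ∃ λ t′ → [ x , y ] ∼ t′ *ᵗ x
    +-commute-cartan hy hx {t} eq = _ , ∼-trans (skew hx hy) (∼-trans (*-cong′ refl eq) (∼-sym (*-assoc′ _ t _)))

    unscale : ∀ p {x y} → ∃ λ t → [ x , y ] ∼ t *ᵗ [ sgn p *ᵗ x , y ]
    unscale p {x} {y} = sgn p , ∼-sym (∼-trans (*-cong′ refl ([,]-*ˡ _ _ _))
      (∼-trans (∼-sym (*-assoc′ _ _ _)) (∼-trans (*-cong′ (square p) ∼-refl) (*-idˡ _))))
      where
      open RingProperties (CommutativeRing.ring commutativeRing) using (-1*x≈-x; -‿involutive)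
      square : ∀ p → sgn p * sgn p ≈ 1#
      square 0ℙ = *-identityˡ 1#
      square 1ℙ = trans (-1*x≈-x _) (-‿involutive 1#)

  -- A generator either prolongs a word, or rescales it, or, when its sign is opposite, lowers it as
  -- in `Lowering`. So the three families together are stable under generators.
  generator-bracket : ∀ z {γ γ′} → (∀ j → γ′ j ≡ at (rootDegree z) j ℤ.+ γ j) →
                      ∀ {x} → Basis γ x → Spanned (Basis γ′) [ gen z , x ]
  generator-bracket (e l) {γ} {γ′} γ′≡ (neg i w γ≡) = span-bind from₋ (Lower₋.lower l i w λ j → begin
    ℤ.- (+ δ j l) ℤ.+ γ′ j                   ≡⟨ ≡.cong (λ z → ℤ.- (+ δ j l) ℤ.+ z) (γ′≡ j) ⟩
    ℤ.- (+ δ j l) ℤ.+ (at (rootDegree (e l)) j ℤ.+ γ j)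
      ≡⟨ ≡.cong (λ z → ℤ.- (+ δ j l) ℤ.+ (z ℤ.+ γ j)) (root-e l j) ⟩
    ℤ.- (+ δ j l) ℤ.+ (+ δ j l ℤ.+ γ j)      ≡⟨ ℤ.+-assoc (ℤ.- (+ δ j l)) (+ δ j l) (γ j) ⟨
    (ℤ.- (+ δ j l) ℤ.+ + δ j l) ℤ.+ γ j      ≡⟨ ≡.cong (ℤ._+ γ j) (ℤ.+-inverseˡ (+ δ j l)) ⟩
    + 0 ℤ.+ γ j                              ≡⟨ ℤ.+-identityˡ _ ⟩
    γ j                                      ≡⟨ γ≡ j ⟩
    ℤ.- (+ at (wordDegree i w) j)            ∎)
    where open ≡.≡-Reasoning
  generator-bracket (e l) {γ} γ′≡ (car i γ≡0) =
    resp (∼-sym (proj₂ (+-commute-cartan (gen ≡.refl) (gen ≡.refl) (base (he i l)))))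
      (*∈ _ (incl (pos l [] λ j → ≡.trans (γ′≡ j)
        (≡.trans (≡.cong₂ ℤ._+_ (root-e l j) (γ≡0 j)) (ℤ.+-identityʳ _)))))
  generator-bracket (e l) γ′≡ (pos i w γ≡) =
    incl (pos i (l ∷ w) λ j → ≡.trans (γ′≡ j) (≡.cong₂ ℤ._+_ (root-e l j) (γ≡ j)))
  generator-bracket (f l) γ′≡ (neg i w γ≡) =
    incl (neg i (l ∷ w) λ j → ≡.trans (γ′≡ j)
      (≡.trans (≡.cong₂ ℤ._+_ (root-f l j) (γ≡ j)) (≡.sym (ℤ.neg-distrib-+ (+ δ j l) _))))
  generator-bracket (f l) γ′≡ (car i γ≡0) =
    resp (∼-sym (proj₂ (+-commute-cartan (gen ≡.refl) (gen ≡.refl) (base (hf i l)))))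
      (*∈ _ (incl (neg l [] λ j → ≡.trans (γ′≡ j)
        (≡.trans (≡.cong₂ ℤ._+_ (root-f l j) (γ≡0 j)) (ℤ.+-identityʳ _)))))
  generator-bracket (f l) {γ} {γ′} γ′≡ (pos i w γ≡) =
    resp (∼-sym (proj₂ (unscale (parityOf l)))) (*∈ _ (span-bind from₊ (Lower₊.lower l i w λ j → begin
      + δ j l ℤ.+ γ′ j                       ≡⟨ ≡.cong (λ z → + δ j l ℤ.+ z) (γ′≡ j) ⟩
      + δ j l ℤ.+ (at (rootDegree (f l)) j ℤ.+ γ j)
        ≡⟨ ≡.cong (λ z → + δ j l ℤ.+ (z ℤ.+ γ j)) (root-f l j) ⟩
      + δ j l ℤ.+ (ℤ.- (+ δ j l) ℤ.+ γ j)    ≡⟨ ℤ.+-assoc (+ δ j l) (ℤ.- (+ δ j l)) (γ j) ⟨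
      (+ δ j l ℤ.+ ℤ.- (+ δ j l)) ℤ.+ γ j    ≡⟨ ≡.cong (ℤ._+ γ j) (ℤ.+-inverseʳ (+ δ j l)) ⟩
      + 0 ℤ.+ γ j                            ≡⟨ ℤ.+-identityˡ _ ⟩
      γ j                                    ≡⟨ γ≡ j ⟩
      + at (wordDegree i w) j                ∎)))
    where open ≡.≡-Reasoning
  generator-bracket (h l) γ′≡ (neg i w γ≡) =
    resp (∼-sym (proj₂ (Negative.K-eigen l (word-monomial i w))))
      (*∈ _ (incl (neg i w λ j → ≡.trans (γ′≡ j) (≡.trans (ℤ.+-identityˡ _) (γ≡ j)))))
  generator-bracket (h l) γ′≡ (car i γ≡0) = zero∈ (base (hh l i))
  generator-bracket (h l) γ′≡ (pos i w γ≡) =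
    resp (∼-sym (proj₂ (h-positive l (word-monomial i w))))
      (*∈ _ (incl (pos i w λ j → ≡.trans (γ′≡ j) (≡.trans (ℤ.+-identityˡ _) (γ≡ j)))))

  private
    Homog : CommutativeMonoid.Carrier (rootLattice I) → Elt → Set _
    Homog = Homogeneous 𝕂 (rootLattice I) rootDegree

  -- Passes from generators to terms: `jacobi′` replaces the bracket with `[x,y]` by successive
  -- brackets with `x` and `y`, which is why `x` needs a parity.
  term-bracket : ∀ {g p x} → Homog g x → HasParity p x → ∀ {γ γ′} → (∀ j → γ′ j ≡ at g j ℤ.+ γ j) →
                 ∀ {b} → Basis γ b → Spanned (Basis γ′) [ x , b ]
  term-bracket (gen {x = z} g≡) _ γ′≡ b∈ =
    generator-bracket z (λ j → ≡.trans (γ′≡ j) (≡.cong (ℤ._+ _) (g≡ j))) b∈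
  term-bracket 0ᵗ        _         γ′≡ b∈ = zero∈ ([,]-0ˡ _ ∼-refl)
  term-bracket (hx +ᵗ hy) (px +ᵗ py) γ′≡ b∈ =
    resp (∼-sym ([,]-+ˡ _ _ _)) (+∈ (term-bracket hx px γ′≡ b∈) (term-bracket hy py γ′≡ b∈))
  term-bracket (t *ᵗ hx) (_ *ᵗ px) γ′≡ b∈ = resp (∼-sym ([,]-*ˡ t _ _)) (*∈ t (term-bracket hx px γ′≡ b∈))
  term-bracket ([_,_] {g₁} {g₂} {x = x} {y} hx hy {g≡}) ([_,_] px py) {γ} {γ′} γ′≡ b∈ =
    resp (jacobi′ px py (proj₂ (basis-parity b∈)))
      (+∈ (span-bracket x (term-bracket hx px γ′≡₁) (term-bracket hy py (λ _ → ≡.refl) b∈))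
          (*∈ _ (span-bracket y (term-bracket hy py γ′≡₂) (term-bracket hx px (λ _ → ≡.refl) b∈))))
    where
    γ′≡₁ : ∀ j → γ′ j ≡ at g₁ j ℤ.+ (at g₂ j ℤ.+ γ j)
    γ′≡₁ j = ≡.trans (γ′≡ j) (≡.trans (≡.cong (ℤ._+ γ j) (g≡ j)) (ℤ.+-assoc (at g₁ j) _ _))
    γ′≡₂ : ∀ j → γ′ j ≡ at g₂ j ℤ.+ (at g₁ j ℤ.+ γ j)
    γ′≡₂ j = ≡.trans (γ′≡ j) (≡.trans (≡.cong (ℤ._+ γ j) (≡.trans (g≡ j) (ℤ.+-comm (at g₁ j) _)))
                                      (ℤ.+-assoc (at g₂ j) _ _))

  triangular : ∀ {g x} → Homog g x → ∀ {γ} → (∀ j → γ j ≡ at g j) → Spanned (Basis γ) x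
  triangular (gen {x = e i} g≡) γ≡ = incl (pos i [] λ j → ≡.trans (γ≡ j) (≡.trans (g≡ j) (root-e i j)))
  triangular (gen {x = f i} g≡) γ≡ = incl (neg i [] λ j → ≡.trans (γ≡ j) (≡.trans (g≡ j) (root-f i j)))
  triangular (gen {x = h i} g≡) γ≡ = incl (car i λ j → ≡.trans (γ≡ j) (g≡ j))
  triangular 0ᵗ         γ≡ = 0∈
  triangular (hx +ᵗ hy) γ≡ = +∈ (triangular hx γ≡) (triangular hy γ≡)
  triangular (t *ᵗ hx)  γ≡ = *∈ t (triangular hx γ≡)
  triangular ([_,_] {g₁} {g₂} {x = x} {y} hx hy {g≡}) {γ} γ≡ =
    resp (∼-sym (∼-trans ([,]-cong (part-sum x) ∼-refl) ([,]-+ˡ _ _ _))) (+∈ (summand 0ℙ) (summand 1ℙ))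
    where
    summand : ∀ p → Spanned (Basis γ) [ part p x , y ]
    summand p = span-bracket (part p x)
      (term-bracket (part-homogeneous p hx) (part-parity p x) (λ j → ≡.trans (γ≡ j) (g≡ j)))
      (triangular hy (λ _ → ≡.refl))

  module _ {k : CommutativeMonoid.Carrier ℤ₊[ I ]} {i₀ : I} (ki₀≢0 : at k i₀ ≢ 0) where

    -- Degree `η k` has non-negative coordinates and a positive one at `i₀`. This excludes negative
    -- words and Cartan generators, so only images of words of LS remain.
    private
      positive : ∀ {x} → Spanned (Basis (λ j → + at k j)) x →
                 ∃ λ y → Homogeneous 𝕂 ℤ₊[ I ] multidegree k y × φ y ∼ x
      positive (incl (neg i w k≡)) = ⊥-elim (ki₀≢0 (both-zero (at k i₀) (at (wordDegree i w) i₀) (k≡ i₀)))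
        where
        both-zero : ∀ m n → + m ≡ ℤ.- (+ n) → m ≡ 0
        both-zero m zero eq = ℤ.+-injective eq
      positive (incl (car i k≡0))  = ⊥-elim (ki₀≢0 (ℤ.+-injective (k≡0 i₀)))
      positive (incl (pos i w k≡)) = word i w , word-homogeneous i w (λ j → ℤ.+-injective (k≡ j)) , ∼-refl
      positive 0∈                  = 0ᵗ , 0ᵗ , ∼-refl
      positive (+∈ x∈ y∈) with positive x∈ | positive y∈
      ... | x , hx , φx∼ | y , hy , φy∼ = x +ᵗ y , hx +ᵗ hy , +-cong′ φx∼ φy∼
      positive (*∈ t x∈) with positive x∈
      ... | x , hx , φx∼ = t *ᵗ x , t *ᵗ hx , *-cong′ refl φx∼
      positive (resp x∼y x∈) with positive x∈
      ... | x , hx , φx∼ = x , hx , ∼-trans φx∼ x∼y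

    φ-onto : ∀ {x} → Homog (η k) x → ∃ λ y → Homogeneous 𝕂 ℤ₊[ I ] multidegree k y × φ y ∼ x
    φ-onto hx = positive (triangular hx λ _ → ≡.refl)

-- Dimensions under an isomorphism, and the assembly of both parts.

module DimensionTransport {r ℓr m ℓm n ℓn} {R : Ring r ℓr} (M : LeftModule R m ℓm) (N : LeftModule R n ℓn)
  {F : LeftModule.Carrierᴹ M → LeftModule.Carrierᴹ N}
  (iso : LeftModuleMorphisms.IsLeftModuleIsomorphism (LeftModule.rawLeftModule M) (LeftModule.rawLeftModule N) F)
  where
  open Ring R using (Carrier)
  private
    module M = LeftModule M
    module N = LeftModule N
  open LeftModuleMorphisms.IsLeftModuleIsomorphism iso

  F-combination : ∀ {d} (t : Vector Carrier d) b →
                  F (linearCombination M t b) N.≈ᴹ linearCombination N t (F ∘ b)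
  F-combination {zero}  t b = 0ᴹ-homo
  F-combination {suc d} t b = N.≈ᴹ-trans (+ᴹ-homo _ _)
    (N.+ᴹ-cong (*ₗ-homo _ _) (F-combination (t ∘ suc) (b ∘ suc)))

  combination-cong : ∀ {d} (t : Vector Carrier d) {b b′} → (∀ j → b j N.≈ᴹ b′ j) →
                     linearCombination N t b N.≈ᴹ linearCombination N t b′
  combination-cong {zero}  t b≈ = N.≈ᴹ-refl
  combination-cong {suc d} t b≈ = N.+ᴹ-cong (N.*ₗ-congˡ (b≈ zero)) (combination-cong (t ∘ suc) (b≈ ∘ suc))

  to : ∀ {d} → HasDimension M d → HasDimension N d
  to (b , basis) = F ∘ b , record
    { independent = λ t e → independent t (injective (N.≈ᴹ-trans (F-combination t b)
                                                     (N.≈ᴹ-trans e (N.≈ᴹ-sym 0ᴹ-homo))))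
    ; spanning    = λ y → let x , Fx≈y = surjective y ; t , x≈ = spanning x in
                    t , N.≈ᴹ-trans (N.≈ᴹ-sym (Fx≈y (M.≈ᴹ-sym x≈))) (F-combination t b)
    }
    where open IsBasis basis

  from : ∀ {d} → HasDimension N d → HasDimension M d
  from (b , basis) = b′ , record
    { independent = λ t e → independent t (N.≈ᴹ-trans (N.≈ᴹ-sym (image t)) (N.≈ᴹ-trans (⟦⟧-cong e) 0ᴹ-homo))
    ; spanning    = λ x → let t , Fx≈ = spanning (F x) in
                    t , injective (N.≈ᴹ-trans Fx≈ (N.≈ᴹ-sym (image t)))
    }
    where
    open IsBasis basis
    b′ : Vector M.Carrierᴹ _
    b′ j = proj₁ (surjective (b j))
    image : ∀ t → F (linearCombination M t b′) N.≈ᴹ linearCombination N t b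
    image t = N.≈ᴹ-trans (F-combination t b′) (combination-cong t λ j → proj₂ (surjective (b j)) M.≈ᴹ-refl)

module Main {c ℓ₁ ℓ₂ ℓ₃} (𝕂 : ScalarField c ℓ₁ ℓ₂ ℓ₃) {s : IndexSet} (A : BKMSupermatrix 𝕂 s) where
  open BKM 𝕂 A

  φ-superhomomorphism : IsSuperHomomorphism 𝕂 LS-presentation 𝔤-presentation φ
  φ-superhomomorphism = record
    { isLeftModuleHomomorphism = record
      { +ᴹ-isGroupHomomorphism = record
        { isMonoidHomomorphism = record
          { isMagmaHomomorphism = record
            { isRelHomomorphism = record { cong = φ-cong }
            ; homo = λ _ _ → 𝔤.∼-refl
            }
          ; ε-homo = 𝔤.∼-refl
          }
        ; ⁻¹-homo = λ _ → 𝔤.∼-refl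
        }
      ; *ₗ-homo = λ _ _ → 𝔤.∼-refl
      }
    ; [,]-homo    = λ _ _ → 𝔤.∼-refl
    ; parity-homo = λ { p x (y , hy , x∼y) →
        φ y ,
        mapᵗ-homogeneous 𝕂 {G = ℙ.+-0-commutativeMonoid} {H = ℙ.+-0-commutativeMonoid}
          (λ q → q) (λ eq → eq) (λ _ _ → ≡.refl) e (λ _ → ≡.refl) hy ,
        φ-cong x∼y }
    }

  φ-in-𝔫₊ : ∀ x → 𝔫₊ (φ x)
  φ-in-𝔫₊ (gen i)   = 𝔤.Subalgebra.incl (i , ≡.refl)
  φ-in-𝔫₊ 0ᵗ        = 𝔤.Subalgebra.0∈
  φ-in-𝔫₊ (x +ᵗ y)  = 𝔤.Subalgebra.+∈ (φ-in-𝔫₊ x) (φ-in-𝔫₊ y)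
  φ-in-𝔫₊ (t *ᵗ x)  = 𝔤.Subalgebra.*∈ t (φ-in-𝔫₊ x)
  φ-in-𝔫₊ [ x , y ] = 𝔤.Subalgebra.[,]∈ (φ-in-𝔫₊ x) (φ-in-𝔫₊ y)

  φ-onto-𝔫₊ : ∀ {y} → 𝔫₊ y → ∃ λ x → φ x 𝔤.∼ y
  φ-onto-𝔫₊ (𝔤.Subalgebra.incl (i , ≡.refl)) = gen i , 𝔤.∼-refl
  φ-onto-𝔫₊ (𝔤.Subalgebra.resp y∼z y∈) with φ-onto-𝔫₊ y∈
  ... | x , φx∼y = x , 𝔤.∼-trans φx∼y y∼z
  φ-onto-𝔫₊ 𝔤.Subalgebra.0∈ = 0ᵗ , 𝔤.∼-refl
  φ-onto-𝔫₊ (𝔤.Subalgebra.+∈ y∈ z∈) with φ-onto-𝔫₊ y∈ | φ-onto-𝔫₊ z∈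
  ... | x , φx∼y | w , φw∼z = x +ᵗ w , 𝔤.+-cong′ φx∼y φw∼z
  φ-onto-𝔫₊ (𝔤.Subalgebra.*∈ t y∈) with φ-onto-𝔫₊ y∈
  ... | x , φx∼y = t *ᵗ x , 𝔤.*-cong′ (ScalarField.refl 𝕂) φx∼y
  φ-onto-𝔫₊ (𝔤.Subalgebra.[,]∈ y∈ z∈) with φ-onto-𝔫₊ y∈ | φ-onto-𝔫₊ z∈
  ... | x , φx∼y | w , φw∼z = [ x , w ] , 𝔤.[,]-cong φx∼y φw∼z

  module _ {k : CommutativeMonoid.Carrier ℤ₊[ I ]} {i₀ : I} (ki₀≢0 : at k i₀ ≢ 0) (small : ∀ i → Iʳᵉ i ⊎ Ψ₀ i → at k i ≤ 1) where

    -- Members of a graded component are only `∼` to homogeneous terms. Their homogeneous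
    -- representatives are subtracted, and the difference lies in the kernel in degree 𝐤.
    φ-injective : ∀ {x y} → LS-grading.Component k x → LS-grading.Component k y → φ x 𝔤.∼ φ y → x LS.∼ y
    φ-injective {x} {y} (x′ , hx , x∼x′) (y′ , hy , y∼y′) φx∼φy =
      LS.∼-trans x∼x′ (LS.∼-trans (LieCalculus.subtract-zero 𝕂 LS-presentation
        (TruncatedOrbit.φ-kernel-trivial A i₀ ki₀≢0 small (hx +ᵗ (_ *ᵗ hy)) difference)) (LS.∼-sym y∼y′))
      where
      φx′∼φy′ : φ x′ 𝔤.∼ φ y′
      φx′∼φy′ = 𝔤.∼-trans (φ-cong (LS.∼-sym x∼x′)) (𝔤.∼-trans φx∼φy (φ-cong y∼y′))

      difference : φ (x′ +ᵗ LS.-ᵗ y′) 𝔤.∼ 0ᵗ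
      difference = 𝔤.∼-trans (𝔤.+-cong′ φx′∼φy′ 𝔤.∼-refl)
                             (LieCalculus.neg-inverseʳ 𝕂 𝔤-presentation (φ y′))

    φ-isomorphism : IsLinearIsomorphismInDegree k
    φ-isomorphism = record
      { isLeftModuleMonomorphism = record
        { isLeftModuleHomomorphism = record
          { +ᴹ-isGroupHomomorphism = record
            { isMonoidHomomorphism = record
              { isMagmaHomomorphism = record
                { isRelHomomorphism = record { cong = φ-cong }
                ; homo = λ _ _ → 𝔤.∼-refl
                }
              ; ε-homo = 𝔤.∼-refl
              }
            ; ⁻¹-homo = λ _ → 𝔤.∼-refl
            }
          ; *ₗ-homo = λ _ _ → 𝔤.∼-refl
          }
        ; injective = λ { {x , x∈} {y , y∈} → φ-injective x∈ y∈ }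
        }
      ; surjective = λ { (y , y′ , hy , y∼y′) →
          -- The preimage is a combination of words of degree 𝐤, hence homogeneous and its own
          -- representative in the component.
          let x , hx , φx∼y′ = Triangular.φ-onto A ki₀≢0 hy in
          (x , x , hx , LS.∼-refl) ,
          λ z∼x → 𝔤.∼-trans (φ-cong z∼x) (𝔤.∼-trans φx∼y′ (𝔤.∼-sym y∼y′)) }
      }

lemma1 : ∀ {c ℓ₁ ℓ₂ ℓ₃} (𝕂 : ScalarField c ℓ₁ ℓ₂ ℓ₃) {s : IndexSet} (A : BKMSupermatrix 𝕂 s) →
    let open BKM 𝕂 A in
    (k : CommutativeMonoid.Carrier ℤ₊[ I ]) →
    (∃ λ i → at k i ≢ 0) →
    (∀ i → Iʳᵉ i ⊎ Ψ₀ i → at k i ≤ 1) →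
    ( IsSuperHomomorphism 𝕂 LS-presentation 𝔤-presentation φ
    × (∀ x → 𝔫₊ (φ x))
    × (∀ y → 𝔫₊ y → ∃ λ x → φ x 𝔤.∼ y)
    × (∀ l x → LS-grading.Component l x → 𝔤-grading.Component (η l) (φ x))
    × IsLinearIsomorphismInDegree k
    × (∀ (d : ℕ) → HasDimension (𝔤-grading.component (η k)) d ⇔ HasDimension (LS-grading.component k) d))
    × (∀ x → LS-grading.Component k x → LS.Ideal (SerreElement ∪ HalvedSerreElement) x → x LS.∼ 0ᵗ)
lemma1 𝕂 A k (i₀ , ki₀≢0) small =
  ( φ-superhomomorphism
  , φ-in-𝔫₊
  , (λ _ → φ-onto-𝔫₊)
  , (λ l _ → φ-grade l)
  , φ-isomorphism ki₀≢0 small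
  , λ _ → mk⇔ from to )
  -- Ideals are closed under `∼`, so the homogeneous representative `y` lies in the ideal too.
  , λ { x (y , hy , x∼y) x∈ → LS.∼-trans x∼y
          (TruncatedOrbit.ideal-trivial A i₀ ki₀≢0 small hy (LS.Ideal.resp x∼y x∈)) }
  where
  open BKM 𝕂 A
  open Main 𝕂 A
  open DimensionTransport (LS-grading.component k) (𝔤-grading.component (η k)) (φ-isomorphism ki₀≢0 small)
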